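{- Let $A$ be an algorithm that maintains a dynamic data structure $D$ with worst-case expected update time $\alpha$ for each update operation, and let $n$ be a parameter such that the maximum number of items stored in the data structure at any point in time is polynomial in $n$. Assume that for any set of elements $S$ such that $|S|$ is polynomial in $n$, a new version of the data structure $D$ containing exactly the elements of $S$ can be constructed in polynomial time. Then there exists an algorithm $A'$ with the following properties: 1. For any sequence of updates $\sigma_1, \sigma_2, \ldots$, the algorithm $A'$ processes each update $\sigma_i$ in $O(\alpha \log^2(n))$ time with high probability. The amortized expected update time of $A'$ is $O(\alpha \log(n))$. 2. $A'$ maintains $\Theta(\log(n))$ data structures $D_1, D_2, \ldots, D_{\Theta(\log(n))}$, as well as a pointer to some $D_i$ that is guaranteed to be correct at the current time. Query operations are answered with $D_i$.
   Context: A dynamic data structure supports two types of operations: (1) update operations (e.g. insertion or deletion of an element), which manipulate the internal state but return no information, and (2) query operations, which return information about the internal state but do not manipulate it. The data structure has update time $\alpha$ if the maximum update time of any type of update is $\alpha$. A (randomized) algorithm has worst-case expected update time $\alpha$ if for every update $\sigma$ in the update sequence, the expected time to process $\sigma$ is at most $\alpha$. "Processes each update in time $T$ with high probability" means that for each individual update the probability that the time bound is violated is polynomially small in $n$ (at most $1/n^c$ for an arbitrary constant $c$, the hidden constants depending on $c$). The amortized expected update time is the expected total time for a sequence of updates divided by the number of updates. The update sequence is supplied by an oblivious adversary: it is fixed before the algorithm starts, independently of the algorithm's random choices. Each $D_i$ is a copy of the data structure $D$ maintained by its own run of $A$; $D_i$ is correct at the current time if it has completely processed all updates up to now, i.e.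 it correctly represents the current set of elements. -}

module Defs where

open import Data.Bool.Base using (Bool; true; false; if_then_else_)
open import Data.Fin.Base using (Fin)
open import Data.Integer.Base using (+_)
open import Data.List.Base as List using (List; []; _∷_; _++_; length; sum; filter; upTo; allFin; cartesianProductWith)
open import Data.List.Relation.Unary.Unique.Propositional using (Unique)
open import Data.Nat.Base as ℕ using (ℕ; zero; suc; NonZero; _≡ᵇ_)
open import Data.Nat.Properties using (m^n≢0)
open import Data.Product.Base using (Σ-syntax; ∃-syntax; _×_; _,_; proj₁; proj₂)
open import Data.Rational.Unnormalised.Base using (ℚᵘ; _/_; 1ℚᵘ; _≤_; _*_)
open import Data.Rational.Unnormalised.Properties using (_<?_)
open import Data.Vec.Base as Vec using (Vec; []; _∷_; lookup; replicate; _[_]≔_)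
open import Function.Bundles using (_↣_)
open import Level using (0ℓ)
open import Relation.Binary.PropositionalEquality using (_≡_)
open import Relation.Unary using (Pred; Decidable)

fromℕ : ℕ → ℚᵘ
fromℕ k = + k / 1

Polynomial : (ℕ → ℕ) → Set
Polynomial f = ∃[ k ] ∀ n → f n ℕ.≤ k ℕ.* n ℕ.^ k ℕ.+ k

------------------------------------------------------------------------
-- Uniform probability on sequences of M independent symbols from Fin b

module _ (b : ℕ) where

  sequences : (M : ℕ) → List (Vec (Fin b) M)
  sequences zero    = [] ∷ []
  sequences (suc M) = cartesianProductWith _∷_ (allFin b) (sequences M)

  module _ .{{_ : NonZero b}} (M : ℕ) where

    -- The denominator is the number of sequences.
    uniform : ℕ → ℚᵘ
    uniform k = _/_ (+ k) (b ℕ.^ M) {{m^n≢0 b M}}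

    𝔼 : (Vec (Fin b) M → ℕ) → ℚᵘ
    𝔼 X = uniform (sum (List.map X (sequences M)))

    ℙ : {E : Pred (Vec (Fin b) M) 0ℓ} → Decidable E → ℚᵘ
    ℙ E? = uniform (length (filter E? (sequences M)))

------------------------------------------------------------------------
-- Dynamic data structures

FinSet : Set → Set
FinSet E = Σ[ xs ∈ List E ] Unique xs

size : ∀ {E} → FinSet E → ℕ
size S = length (proj₁ S)

record Problem : Set₁ where
  field
    Element : Set
    Update  : Set
    Query   : Set
    Answer  : Set
    apply   : Update → FinSet Element → FinSet Element

  applyAll : List Update → FinSet Element → FinSet Element
  applyAll []       S = S
  applyAll (u ∷ us) S = applyAll us (apply u S)

  -- At most N elements are present initially and after every update.
  Bounded : ℕ → FinSet Element → List Update → Set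
  Bounded N S []       = size S ℕ.≤ N
  Bounded N S (u ∷ us) = size S ℕ.≤ N × Bounded N (apply u S) us

-- A randomized algorithm, executed in unit-time steps, each of which may use
-- a fresh uniformly random symbol (a machine word, say).  `construct` and
-- `update` only begin an operation; it is carried out by `step` and is
-- complete when the state is idle again.
record Algorithm (P : Problem) : Set₁ where
  open Problem P
  field
    State       : Set
    symbols     : ℕ
    {{nonZero}} : NonZero symbols
    construct   : FinSet Element → State
    update      : Update → State → State
    step        : Fin symbols → State → State
    idle        : State → Bool
    query       : Query → State → Answer

------------------------------------------------------------------------
-- Runs and their running times

module Run {P : Problem} (A : Algorithm P) where
  open Problem P
  open Algorithm A

  -- A state with the queue of updates that have not been begun.
  Process : Set
  Process = State × List Update

  -- One unit of time.  Beginning an update takes a unit by itself.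
  tick : Fin symbols → Process → Process
  tick x (s , us) with idle s | us
  ... | false | _        = step x s , us
  ... | true  | []       = s , []
  ... | true  | u ∷ us′  = update u s , us′

  run : ∀ {M} → Vec (Fin symbols) M → Process → Process
  run []       p = p
  run (x ∷ xs) p = run xs (tick x p)

  caughtUp : Process → Bool
  caughtUp (s , [])    = idle s
  caughtUp (s , _ ∷ _) = false

  -- Does the next unit of time go to the update that has exactly k updates
  -- after it in the queue?
  serves : ℕ → Process → Bool
  serves k (s , us) with idle s | us
  ... | false | _       = length us ≡ᵇ k
  ... | true  | []      = false
  ... | true  | _ ∷ us′ = length us′ ≡ᵇ k

  -- The part of the first M time units that goes to that update.
  time : ∀ {M} → ℕ → Process → Vec (Fin symbols) M → ℕ
  time k p []       = 0
  time k p (x ∷ xs) = (if serves k p then 1 else 0) ℕ.+ time k (tick x p) xs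

  -- The construction has every update of the queue after it, and so it
  -- does not contribute.
  totalTime : ∀ {M} → Process → Vec (Fin symbols) M → ℕ
  totalTime p xs = sum (List.map (λ k → time k p xs) (upTo (length (proj₂ p))))

  -- `s` has been reached by a run that has completely processed updates
  -- leading to the set S.
  Correct : State → FinSet Element → Set
  Correct s S =
    idle s ≡ true ×
    ∃[ S₀ ] ∃[ us ] ∃[ M ] Σ[ xs ∈ Vec (Fin symbols) M ]
      run xs (construct S₀ , us) ≡ (s , []) × applyAll us S₀ ≡ S

  ConstructedWithin : ℕ → FinSet Element → Set
  ConstructedWithin t S =
    ∀ (xs : Vec (Fin symbols) t) → caughtUp (run xs (construct S , [])) ≡ true

  -- In the next three definitions the running time T of an update on the
  -- infinite symbol sequence is the supremum over M of its truncations to M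
  -- time units.  By monotone convergence, 𝔼 T ≤ α iff the truncations have
  -- expectation ≤ α for all M, and similarly for ℙ (T > t).  The updates are
  -- quantified before the symbols: the adversary is oblivious.

  WorstCaseExpectedTime : (N : ℕ) (α : ℚᵘ) → Set
  WorstCaseExpectedTime N α = ∀ S us u vs → Bounded N S (us ++ u ∷ vs) →
    ∀ M → 𝔼 symbols M (time (length vs) (construct S , us ++ u ∷ vs)) ≤ α

  -- Each update takes time at most t, except with probability at most 1 / d.
  TimeWithHighProbability : (N : ℕ) (t : ℚᵘ) (d : ℕ) → Set
  TimeWithHighProbability N t d = ∀ S us u vs → Bounded N S (us ++ u ∷ vs) →
    ∀ M → fromℕ d * ℙ symbols M (λ xs →
      t <? fromℕ (time (length vs) (construct S , us ++ u ∷ vs) xs)) ≤ 1ℚᵘ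

  AmortizedExpectedTime : (N : ℕ) (t : ℚᵘ) → Set
  AmortizedExpectedTime N t = ∀ S us → Bounded N S us →
    ∀ M → 𝔼 symbols M (totalTime (construct S , us)) ≤ t * fromℕ (length us)

module _ {P : ℕ → Problem} (A : ∀ n → Algorithm (P n)) where

  ConstructibleInPolynomialTime : Set
  ConstructibleInPolynomialTime = ∀ s → Polynomial s →
    ∃[ t ] Polynomial t ×
      (∀ n S → size S ℕ.≤ s n → Run.ConstructedWithin (A n) (t n) S)

------------------------------------------------------------------------
-- Algorithms that maintain q copies of a data structure

data Action (q : ℕ) : Set where
  reset : Fin q → Action q  -- begin a new construction from the current set
  run   : Fin q → Action q  -- spend one unit of time on this copy
  point : Fin q → Action q  -- set the pointer
  wait  : Action q          -- the update is finished

-- The controller observes nothing about a copy except whether it has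
-- processed all updates.  Since it has only `states` many states, its memory
-- is O(log states) bits; for `states` polynomial in the parameters, this is a
-- constant number of machine words.
record Controller (q : ℕ) : Set₁ where
  field
    Control  : Set
    states   : ℕ
    encode   : Control ↣ Fin states
    start    : Control
    pointer₀ : Fin q
    act      : Control → Action q
    next     : Control → Bool → Control

module Copies {P : Problem} (A : Algorithm P) {q : ℕ} (C : Controller q) where
  open Problem P
  open Controller C
  private
    module A = Algorithm A
    module R = Run A

  record Configuration : Set where
    field
      control : Control
      copies  : Vec R.Process q
      pointer : Fin q
      current : FinSet Element
      toll    : ℕ

    pointed : A.State
    pointed = proj₁ (lookup copies pointer)

  open Configuration public

  enqueue : Update → R.Process → R.Process
  enqueue u (s , us) = s , us ++ u ∷ []

  begin : FinSet Element → Configuration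
  begin S = record
    { control = start
    ; copies  = replicate q (A.construct S , [])
    ; pointer = pointer₀
    ; current = S
    ; toll    = 0
    }

  -- An arriving update is put into the q queues and applied to the current
  -- set, which is charged q further units of time (`toll`).  With q of order
  -- log n this pays for q queue insertions and for updating a persistent
  -- search tree, of which a reset then takes a snapshot in constant time.
  receive : Update → Configuration → Configuration
  receive u κ = record
    { control = next (control κ) false
    ; copies  = Vec.map (enqueue u) (copies κ)
    ; pointer = pointer κ
    ; current = apply u (current κ)
    ; toll    = q
    }

  observe : Fin q → Configuration → Configuration
  observe i κ = record κ
    { control = next (control κ) (R.caughtUp (lookup (copies κ) i)) }

  perform : Action q → Fin A.symbols → Configuration → Configuration
  perform (reset i) x κ = observe i (record κ
    { copies = copies κ [ i ]≔ (A.construct (current κ) , []) })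
  perform (run i)   x κ = observe i (record κ
    { copies = copies κ [ i ]≔ R.tick x (lookup (copies κ) i) })
  perform (point i) x κ = observe i (record κ { pointer = i })
  perform wait      x κ = κ

  advance : Fin A.symbols → Configuration → Configuration
  advance x κ with toll κ
  ... | suc t = record κ { toll = t }
  ... | zero  = perform (act (control κ)) x κ

  waiting : Configuration → Bool
  waiting κ with toll κ | act (control κ)
  ... | zero | wait = true
  ... | _    | _    = false

  -- Queries are answered by the copy under the pointer.
  algorithm : Algorithm P
  algorithm = record
    { State     = Configuration
    ; symbols   = A.symbols
    ; construct = begin
    ; update    = receive
    ; step      = advance
    ; idle      = waiting
    ; query     = λ Q κ → A.query Q (pointed κ)
    }

  -- Whatever the random symbols, once all updates so far are processed.
  PointerCorrect : ℕ → Set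
  PointerCorrect N = ∀ S us → Bounded N S us →
    ∀ {M} (xs : Vec (Fin A.symbols) M) →
    let p = Run.run algorithm xs (begin S , us) in
    Run.caughtUp algorithm p ≡ true → R.Correct (pointed (proj₁ p)) (applyAll us S)

-- A controller keeps 2 (⌈log₂ n⌉ + 1) copies and grants each of them, per
-- update, a budget of O(α log n) time units for its backlog.  The copies form
-- two sides, which are reset alternately every L updates, where L is polynomial
-- in n and exceeds the construction time.  So there is always a steady side,
-- whose copies were reset at least L and less than 2 L updates ago.
--
-- Weight the time of the k-th last update by about 1 / k.  The weighted sum of
-- the times of the last 2 L updates has expectation O(α log n), whereas it is
-- at least of the order of the budget for a copy with a backlog, because in all
-- rounds since the backlog arose the budget has been used up.  With a large
-- constant in the budget, a steady copy has a backlog with probability at most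
-- 2 ^ (- c).  The copies get their symbols in an order that depends on earlier
-- symbols, but the product, over the steady copies, of the weighted sum so far
-- plus its expected remainder is a supermartingale; hence the probabilities
-- multiply, and with probability at least 1 - 1 / n ^ c some copy is up to date
-- within the budgets.  Otherwise all copies are run until they are.
--
-- A copy spends expected time at most α on every update, and the construction
-- costs less than L time units once every 2 L updates.  Hence the amortized bound.

module Submission where

open import Defs
open import Data.Integer.Base using (∣_∣)
open import Data.Nat.Base as ℕ using (ℕ)
open import Data.Nat.Logarithm using (⌈log₂_⌉)
open import Data.Product.Base using (Σ-syntax; ∃-syntax; _×_)
open import Data.Rational.Unnormalised.Base using (ℚᵘ; ceiling)

-- The hypothesis bounds a run of `A` that starts from a construction, has all updates queued and
-- reads its own symbols. Inside the composite a copy receives updates one by one, gets time units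
-- chosen by the controller and shares the symbols with the other copies. The bridge is that a
-- process with work left acts in the same way whatever is queued behind. As the adversary is
-- oblivious, the updates still to come may be appended to a copy's queue, and the copy is then in
-- the middle of a run that the hypothesis covers. A reset discards a copy, so weighted work is
-- expected of it only up to its next reset; the updates after that are reserved at the full
-- expected time each. A unit given to one copy leaves the factors of the others independent of the
-- symbol read; this takes the place of independence. Expectations are kept as natural numbers,
-- namely sums over all sequences of length `M`, and powers of the number of symbols do the
-- normalization. Rationals enter only at the end. Rounding `α` up is harmless: beginning an update
-- takes a unit, so `α` is at least 1 as soon as an admissible update exists.

module Development where

  import Algebra.Properties.CommutativeMonoid.Sum
  open import Data.Bool.Base as Bool using (Bool; true; false; if_then_else_; not)
  open import Data.Bool.Properties as Bool using ()
  open import Data.Fin.Base as Fin using (Fin; zero; suc; toℕ; inject₁; punchIn; splitAt; _↑ˡ_; _↑ʳ_)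
  open import Data.Fin.Properties as Fin using (toℕ-fromℕ; toℕ-inject₁; toℕ≤pred[n]; toℕ<n; toℕ-injective; punchInᵢ≢i; splitAt-↑ˡ; splitAt-↑ʳ; +↔⊎; *↔×)
  open import Data.Integer.Base as ℤ using (ℤ)
  import Data.Integer.DivMod as ℤ
  import Data.Integer.Properties as ℤ
  open import Data.List.Base as List using (List; []; _∷_; _++_; length; map; filter; upTo; allFin; cartesianProductWith)
  open import Data.List.Properties using (length-++; ++-assoc; map-++; map-cong; map-∘; map-upTo; length-tabulate; length-upTo)
  open import Data.Nat.Base hiding (_/_; _%_)
  open import Data.Nat.Induction using (<-rec)
  open import Data.Nat.ListAction using (sum)
  open import Data.Nat.ListAction.Properties using (sum-++)
  open import Data.Nat.Logarithm using (⌈log₂⌉-mono-≤; ⌈log₂⌈n/2⌉⌉≡⌈log₂n⌉∸1)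
  open import Data.Nat.Properties
  open import Data.Nat.Tactic.RingSolver using (solve-∀)
  open import Data.Product.Base using (_,_; proj₁; proj₂; map₂)
  open import Data.Product.Function.NonDependent.Propositional using (_×-↔_)
  open import Data.Rational.Unnormalised.Base as ℚ using (mkℚᵘ; 1ℚᵘ; _/_; *≤*)
  import Data.Rational.Unnormalised.Properties as ℚ
  open import Data.Sum.Base using (_⊎_; inj₁; inj₂; [_,_]′)
  open import Data.Sum.Function.Propositional using (_⊎-↔_)
  open import Data.Unit.Base using (⊤; tt)
  open import Data.Vec.Base as Vec using (Vec; []; _∷_; lookup; _[_]≔_; _∷ʳ_)
  open import Data.Vec.Properties using (lookup∘update; lookup∘update′; lookup-map; lookup-replicate)
  open import Function.Base using (_∘_; id; const)
  open import Function.Bundles using (_↔_; mk↔ₛ′)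
  open import Function.Construct.Composition using (_↔-∘_)
  open import Function.Construct.Identity using (↔-id)
  open import Function.Construct.Symmetry using (↔-sym)
  open import Function.Properties.Inverse using (↔⇒↣)
  open import Level using (0ℓ)
  open import Relation.Binary.PropositionalEquality hiding ([_])
  open import Relation.Nullary using (¬_; yes; no; does; contradiction)
  open import Relation.Unary using (Pred; Decidable)

  -- Finite sums

  private
    variable
      𝕏 𝕐 𝕎 : Set

  ∑ : List 𝕏 → (𝕏 → ℕ) → ℕ
  ∑ xs f = sum (map f xs)

  ∑-cong : ∀ (xs : List 𝕏) {f g : 𝕏 → ℕ} → (∀ x → f x ≡ g x) → ∑ xs f ≡ ∑ xs g
  ∑-cong xs f≗g = cong sum (map-cong f≗g xs)

  ∑-mono : ∀ (xs : List 𝕏) {f g : 𝕏 → ℕ} → (∀ x → f x ≤ g x) → ∑ xs f ≤ ∑ xs g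
  ∑-mono []       f≤g = z≤n
  ∑-mono (x ∷ xs) f≤g = +-mono-≤ (f≤g x) (∑-mono xs f≤g)

  ∑-+ : ∀ (xs : List 𝕏) (f g : 𝕏 → ℕ) → ∑ xs (λ x → f x + g x) ≡ ∑ xs f + ∑ xs g
  ∑-+ []       f g = refl
  ∑-+ (x ∷ xs) f g = trans (cong (f x + g x +_) (∑-+ xs f g)) (+-interchange (f x) (g x) _ _)
    where
    +-interchange : ∀ a b c d → a + b + (c + d) ≡ a + c + (b + d)
    +-interchange = solve-∀

  ∑-*ˡ : ∀ (xs : List 𝕏) c (f : 𝕏 → ℕ) → ∑ xs (λ x → c * f x) ≡ c * ∑ xs f
  ∑-*ˡ []       c f = sym (*-zeroʳ c)
  ∑-*ˡ (x ∷ xs) c f = trans (cong (c * f x +_) (∑-*ˡ xs c f)) (sym (*-distribˡ-+ c (f x) _))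

  ∑-*ʳ : ∀ (xs : List 𝕏) c (f : 𝕏 → ℕ) → ∑ xs (λ x → f x * c) ≡ ∑ xs f * c
  ∑-*ʳ xs c f = trans (∑-cong xs (λ x → *-comm (f x) c)) (trans (∑-*ˡ xs c f) (*-comm c _))

  ∑-const : ∀ (xs : List 𝕏) c → ∑ xs (λ _ → c) ≡ length xs * c
  ∑-const []       c = refl
  ∑-const (x ∷ xs) c = cong (c +_) (∑-const xs c)

  ∑-zero : ∀ (xs : List 𝕏) {f : 𝕏 → ℕ} → (∀ x → f x ≡ 0) → ∑ xs f ≡ 0
  ∑-zero xs f≗0 = trans (∑-cong xs f≗0) (trans (∑-const xs 0) (*-zeroʳ (length xs)))

  ∑-++ : ∀ (xs ys : List 𝕏) (f : 𝕏 → ℕ) → ∑ (xs ++ ys) f ≡ ∑ xs f + ∑ ys f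
  ∑-++ xs ys f = trans (cong sum (map-++ f xs ys)) (sum-++ (map f xs) (map f ys))

  ∑-map : ∀ (g : 𝕐 → 𝕏) (ys : List 𝕐) (f : 𝕏 → ℕ) → ∑ (map g ys) f ≡ ∑ ys (f ∘ g)
  ∑-map g ys f = cong sum (sym (map-∘ ys))

  ∑-swap : ∀ (xs : List 𝕏) (ys : List 𝕐) (f : 𝕏 → 𝕐 → ℕ) →
           ∑ xs (λ x → ∑ ys (f x)) ≡ ∑ ys (λ y → ∑ xs (λ x → f x y))
  ∑-swap []       ys f = sym (∑-zero ys (λ _ → refl))
  ∑-swap (x ∷ xs) ys f = trans (cong (∑ ys (f x) +_) (∑-swap xs ys f)) (sym (∑-+ ys (f x) _))

  ∑-cartesian : ∀ (g : 𝕏 → 𝕐 → 𝕎) xs ys (f : 𝕎 → ℕ) →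
                ∑ (cartesianProductWith g xs ys) f ≡ ∑ xs (λ x → ∑ ys (f ∘ g x))
  ∑-cartesian g []       ys f = refl
  ∑-cartesian g (x ∷ xs) ys f =
    trans (∑-++ (map (g x) ys) _ f) (cong₂ _+_ (∑-map (g x) ys f) (∑-cartesian g xs ys f))

  ∑-upTo-suc : ∀ n (f : ℕ → ℕ) → ∑ (upTo (suc n)) f ≡ f 0 + ∑ (upTo n) (f ∘ suc)
  ∑-upTo-suc n f = trans (cong sum (map-upTo f (suc n)))
                         (cong (λ ks → f 0 + sum ks) (sym (map-upTo (f ∘ suc) n)))

  indicator : Bool → ℕ
  indicator p = if p then 1 else 0

  ∑-pick : ∀ n (w : ℕ → ℕ) → (∀ k → n ≤ k → w k ≡ 0) → ∀ m →
           ∑ (upTo n) (λ k → w k * indicator (m ≡ᵇ k)) ≡ w m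
  ∑-pick zero    w w≡0 m = sym (w≡0 m z≤n)
  ∑-pick (suc n) w w≡0 m
    rewrite ∑-upTo-suc n (λ k → w k * indicator (m ≡ᵇ k)) with m
  ... | zero  = trans (cong₂ _+_ (*-identityʳ (w 0)) (∑-zero (upTo n) (λ k → *-zeroʳ (w (suc k))))) (+-identityʳ (w 0))
  ... | suc m = cong₂ _+_ (*-zeroʳ (w 0)) (∑-pick n (w ∘ suc) (λ k n≤k → w≡0 (suc k) (s≤s n≤k)) m)

  length-filter-≤ : ∀ {E : Pred 𝕏 0ℓ} (E? : Decidable E) (f : 𝕏 → ℕ) → (∀ x → E x → 1 ≤ f x) →
                    ∀ xs → length (filter E? xs) ≤ ∑ xs f
  length-filter-≤ E? f 1≤f []       = z≤n
  length-filter-≤ E? f 1≤f (x ∷ xs) with E? x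
  ... | yes e = +-mono-≤ (1≤f x e) (length-filter-≤ E? f 1≤f xs)
  ... | no  _ = ≤-trans (length-filter-≤ E? f 1≤f xs) (m≤n+m _ (f x))

  ^-distribʳ-* : ∀ n x y → (x * y) ^ n ≡ x ^ n * y ^ n
  ^-distribʳ-* zero    x y = refl
  ^-distribʳ-* (suc n) x y = trans (cong (x * y *_) (^-distribʳ-* n x y)) (rearrange x y (x ^ n) (y ^ n))
    where
    rearrange : ∀ x y p q → x * y * (p * q) ≡ x * p * (y * q)
    rearrange = solve-∀

  module _ (b : ℕ) where

    ∑-sequences : ∀ M (f : Vec (Fin b) (suc M) → ℕ) →
                  ∑ (sequences b (suc M)) f ≡ ∑ (allFin b) (λ x → ∑ (sequences b M) (λ xs → f (x ∷ xs)))
    ∑-sequences M f = ∑-cartesian _∷_ (allFin b) (sequences b M) f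

    ∑-allFin-const : ∀ c → ∑ (allFin b) (λ _ → c) ≡ b * c
    ∑-allFin-const c = trans (∑-const (allFin b) c) (cong (_* c) (length-tabulate {n = b} id))

    ∑-sequences-const : ∀ M c → ∑ (sequences b M) (λ _ → c) ≡ b ^ M * c
    ∑-sequences-const zero    c = refl
    ∑-sequences-const (suc M) c = begin
      ∑ (sequences b (suc M)) (λ _ → c)                  ≡⟨ ∑-sequences M (λ _ → c) ⟩
      ∑ (allFin b) (λ _ → ∑ (sequences b M) (λ _ → c))  ≡⟨ ∑-allFin-const _ ⟩
      b * ∑ (sequences b M) (λ _ → c)                    ≡⟨ cong (b *_) (∑-sequences-const M c) ⟩
      b * (b ^ M * c)                                    ≡⟨ *-assoc b (b ^ M) c ⟨
      b ^ suc M * c                                      ∎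
      where open ≡-Reasoning

  split-at-length : ∀ {k} (xs : List 𝕏) → k < length xs →
                    ∃[ ys ] ∃[ x ] ∃[ zs ] (xs ≡ ys ++ x ∷ zs × length zs ≡ k)
  split-at-length {k = k} (x ∷ xs) (s≤s k≤) with k <? length xs
  ... | no k≮ = [] , x , xs , refl , ≤-antisym (≮⇒≥ k≮) k≤
  ... | yes k< with split-at-length xs k<
  ...   | ys , y , zs , eq , eq′ = x ∷ ys , y , zs , cong (x ∷_) eq , eq′

  ≡ᵇ-refl : ∀ m → (m ≡ᵇ m) ≡ true
  ≡ᵇ-refl zero    = refl
  ≡ᵇ-refl (suc m) = ≡ᵇ-refl m

  ≢⇒≡ᵇ≡false : ∀ {m n} → m ≢ n → (m ≡ᵇ n) ≡ false
  ≢⇒≡ᵇ≡false {zero}  {zero}  m≢n = contradiction refl m≢n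
  ≢⇒≡ᵇ≡false {zero}  {suc n} m≢n = refl
  ≢⇒≡ᵇ≡false {suc m} {zero}  m≢n = refl
  ≢⇒≡ᵇ≡false {suc m} {suc n} m≢n = ≢⇒≡ᵇ≡false (m≢n ∘ cong suc)

  ≢ᵇ-length-++ : ∀ (xs : List 𝕏) y → (length (xs ++ y ∷ []) ≡ᵇ 0) ≡ false
  ≢ᵇ-length-++ []      y = refl
  ≢ᵇ-length-++ (_ ∷ _) y = refl

  -- Expected work

  module _ {P : Problem} where
    open Problem P

    bounded⇒small : ∀ {N} S us → Bounded N S us → size S ≤ N
    bounded⇒small S []       small       = small
    bounded⇒small S (u ∷ us) (small , _) = small

    bounded-prefix : ∀ {N} S us vs → Bounded N S (us ++ vs) → Bounded N S us
    bounded-prefix S []       vs bounded           = bounded⇒small S vs bounded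
    bounded-prefix S (u ∷ us) vs (small , bounded) = small , bounded-prefix (apply u S) us vs bounded

  module Work {P : Problem} (A : Algorithm P) where
    open Problem P
    open Algorithm A
    open Run A renaming (run to execute)

    served : (ℕ → ℕ) → Process → ℕ
    served w (s , us) with idle s | us
    ... | false | _       = w (length us)
    ... | true  | []      = 0
    ... | true  | _ ∷ us′ = w (length us′)

    work : (ℕ → ℕ) → ∀ {M} → Process → Vec (Fin symbols) M → ℕ
    work w p []       = 0
    work w p (x ∷ xs) = served w p + work w (tick x p) xs

    -- The expectation of `work`, scaled by the number of sequences.
    totalWork : (ℕ → ℕ) → ℕ → Process → ℕ
    totalWork w M p = ∑ (sequences symbols M) (work w p)

    module _ (n : ℕ) (w : ℕ → ℕ) (w≡0 : ∀ k → n ≤ k → w k ≡ 0) where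

      served-serves : ∀ p → served w p ≡ ∑ (upTo n) (λ k → w k * indicator (serves k p))
      served-serves (s , us) with idle s | us
      ... | false | us      = sym (∑-pick n w w≡0 (length us))
      ... | true  | []      = sym (∑-zero (upTo n) (λ k → *-zeroʳ (w k)))
      ... | true  | _ ∷ us′ = sym (∑-pick n w w≡0 (length us′))

      work-time : ∀ {M} p (xs : Vec (Fin symbols) M) → work w p xs ≡ ∑ (upTo n) (λ k → w k * time k p xs)
      work-time p []       = sym (∑-zero (upTo n) (λ k → *-zeroʳ (w k)))
      work-time p (x ∷ xs) = begin
        served w p + work w (tick x p) xs
          ≡⟨ cong₂ _+_ (served-serves p) (work-time (tick x p) xs) ⟩
        ∑ (upTo n) (λ k → w k * indicator (serves k p)) + ∑ (upTo n) (λ k → w k * time k (tick x p) xs)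
          ≡⟨ ∑-+ (upTo n) _ _ ⟨
        ∑ (upTo n) (λ k → w k * indicator (serves k p) + w k * time k (tick x p) xs)
          ≡⟨ ∑-cong (upTo n) (λ k → *-distribˡ-+ (w k) _ _) ⟨
        ∑ (upTo n) (λ k → w k * time k p (x ∷ xs)) ∎
        where open ≡-Reasoning

    -- Linearity of expectation over the updates. The weight has to vanish from `length us` on
    -- because the time at this index goes to the construction, about which a bound for updates says
    -- nothing.
    totalWork-bound : ∀ {c n} (w : ℕ → ℕ) M s us →
      length us ≤ n →
      (∀ k → length us ≤ k → w k ≡ 0) →
      (∀ us₁ u us₂ → us ≡ us₁ ++ u ∷ us₂ → ∑ (sequences symbols M) (time (length us₂) (s , us)) ≤ c) →
      totalWork w M (s , us) ≤ c * ∑ (upTo n) w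
    totalWork-bound {c} {n} w M s us us≤n w≡0 bound = begin
      ∑ (sequences symbols M) (work w (s , us))
        ≡⟨ ∑-cong (sequences symbols M) (work-time n w (λ k n≤k → w≡0 k (≤-trans us≤n n≤k)) (s , us)) ⟩
      ∑ (sequences symbols M) (λ xs → ∑ (upTo n) (λ k → w k * time k (s , us) xs))
        ≡⟨ ∑-swap (sequences symbols M) (upTo n) _ ⟩
      ∑ (upTo n) (λ k → ∑ (sequences symbols M) (λ xs → w k * time k (s , us) xs))
        ≡⟨ ∑-cong (upTo n) (λ k → ∑-*ˡ (sequences symbols M) (w k) _) ⟩
      ∑ (upTo n) (λ k → w k * ∑ (sequences symbols M) (time k (s , us)))
        ≤⟨ ∑-mono (upTo n) pointwise ⟩
      ∑ (upTo n) (λ k → w k * c)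
        ≡⟨ ∑-*ʳ (upTo n) c w ⟩
      ∑ (upTo n) w * c
        ≡⟨ *-comm (∑ (upTo n) w) c ⟩
      c * ∑ (upTo n) w ∎
      where
      open ≤-Reasoning
      pointwise : ∀ k → w k * ∑ (sequences symbols M) (time k (s , us)) ≤ w k * c
      pointwise k with k <? length us
      ... | no k≮ rewrite w≡0 k (≮⇒≥ k≮) = z≤n
      ... | yes k< with split-at-length us k<
      ...   | us₁ , u , us₂ , refl , refl = *-monoʳ-≤ (w k) (bound us₁ u us₂ refl)

    -- Conditioning on the first symbol, multiplied by the number of sequences. Both the
    -- supermartingale inequality and the amortized induction use it.
    totalWork-suc : ∀ w M p → totalWork w (suc M) p ≡
      symbols ^ suc M * served w p + ∑ (allFin symbols) (λ x → totalWork w M (tick x p))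
    totalWork-suc w M p = begin
      totalWork w (suc M) p
        ≡⟨ ∑-sequences symbols M (work w p) ⟩
      ∑ (allFin symbols) (λ x → ∑ (sequences symbols M) (λ xs → served w p + work w (tick x p) xs))
        ≡⟨ ∑-cong (allFin symbols) (λ x → trans (∑-+ (sequences symbols M) _ _)
             (cong (_+ totalWork w M (tick x p)) (∑-sequences-const symbols M (served w p)))) ⟩
      ∑ (allFin symbols) (λ x → symbols ^ M * served w p + totalWork w M (tick x p))
        ≡⟨ ∑-+ (allFin symbols) _ _ ⟩
      ∑ (allFin symbols) (λ _ → symbols ^ M * served w p) + ∑ (allFin symbols) (λ x → totalWork w M (tick x p))
        ≡⟨ cong (_+ ∑ (allFin symbols) (λ x → totalWork w M (tick x p))) (trans (∑-allFin-const symbols _) (sym (*-assoc symbols (symbols ^ M) _))) ⟩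
      symbols ^ suc M * served w p + ∑ (allFin symbols) (λ x → totalWork w M (tick x p)) ∎
      where open ≡-Reasoning

    -- More time units can only add work; the factor on the left makes up for the larger number of
    -- sequences. It is used for a copy while the unit goes elsewhere.
    totalWork-mono : ∀ w M p → symbols * totalWork w M p ≤ totalWork w (suc M) p
    totalWork-mono w zero    p = ≤-trans (≤-reflexive (*-zeroʳ symbols)) z≤n
    totalWork-mono w (suc M) p = begin
      symbols * totalWork w (suc M) p
        ≡⟨ cong (symbols *_) (totalWork-suc w M p) ⟩
      symbols * (symbols ^ suc M * served w p + ∑ (allFin symbols) (λ x → totalWork w M (tick x p)))
        ≡⟨ *-distribˡ-+ symbols (symbols ^ suc M * served w p) _ ⟩
      symbols * (symbols ^ suc M * served w p) + symbols * ∑ (allFin symbols) (λ x → totalWork w M (tick x p))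
        ≡⟨ cong₂ _+_ (sym (*-assoc symbols (symbols ^ suc M) _)) (sym (∑-*ˡ (allFin symbols) symbols _)) ⟩
      symbols ^ suc (suc M) * served w p + ∑ (allFin symbols) (λ x → symbols * totalWork w M (tick x p))
        ≤⟨ +-monoʳ-≤ _ (∑-mono (allFin symbols) (λ x → totalWork-mono w M (tick x p))) ⟩
      symbols ^ suc (suc M) * served w p + ∑ (allFin symbols) (λ x → totalWork w (suc M) (tick x p))
        ≡⟨ totalWork-suc w (suc M) p ⟨
      totalWork w (suc (suc M)) p ∎
      where open ≤-Reasoning

    time-beyond : ∀ {M} k s us (xs : Vec (Fin symbols) M) → length us < k → time k (s , us) xs ≡ 0
    time-beyond k s us       []       us<k = refl
    time-beyond k s us       (x ∷ xs) us<k with idle s | us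
    ... | false | us rewrite ≢⇒≡ᵇ≡false (<⇒≢ us<k) = time-beyond k (step x s) us xs us<k
    ... | true  | [] = time-beyond k s [] xs us<k
    ... | true  | u ∷ us rewrite ≢⇒≡ᵇ≡false (<⇒≢ (<-trans (n<1+n (length us)) us<k)) =
      time-beyond k (update u s) us xs (<-trans (n<1+n (length us)) us<k)

    time-done : ∀ {M} s us (xs : Vec (Fin symbols) M) → time (length us) (s , us) xs ≡ time 0 (s , []) xs
    time-done s us       [] = refl
    time-done s us       (x ∷ xs) with idle s in eq | us
    ... | false | us rewrite ≡ᵇ-refl (length us) = cong suc (time-done (step x s) us xs)
    ... | true  | [] = refl
    ... | true  | u ∷ us rewrite ≢⇒≡ᵇ≡false (<⇒≢ (n<1+n (length us))) =
      trans (time-beyond (suc (length us)) (update u s) us xs (n<1+n _)) (sym (time-idle s xs eq))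
      where
      time-idle : ∀ {M} s (xs : Vec (Fin symbols) M) → idle s ≡ true → time 0 (s , []) xs ≡ 0
      time-idle s []       eq = refl
      time-idle s (x ∷ xs) eq rewrite eq = time-idle s xs eq

    -- An update is processed without regard to what is queued behind it. Hence the high-probability
    -- bound has to be shown only for the last update of a sequence.
    time-prefix : ∀ {M} s us u vs (xs : Vec (Fin symbols) M) →
                  time (length vs) (s , us ++ u ∷ vs) xs ≡ time 0 (s , us ++ u ∷ []) xs
    time-prefix s us       u vs [] = refl
    time-prefix s us       u vs (x ∷ xs) with idle s | us
    ... | false | us
      rewrite ≢ᵇ-length-++ us u
      | ≢⇒≡ᵇ≡false {length (us ++ u ∷ vs)} {length vs} (>⇒≢ (≤-trans (m≤n+m _ (length us)) (≤-reflexive (sym (length-++ us)))))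
      = time-prefix (step x s) us u vs xs
    ... | true  | [] rewrite ≡ᵇ-refl (length vs) = cong suc (time-done (update u s) vs xs)
    ... | true  | u′ ∷ us
      rewrite ≢ᵇ-length-++ us u
      | ≢⇒≡ᵇ≡false {length (us ++ u ∷ vs)} {length vs} (>⇒≢ (≤-trans (m≤n+m _ (length us)) (≤-reflexive (sym (length-++ us)))))
      = time-prefix (update u′ s) us u vs xs

    tick-empty : ∀ x {s} → idle s ≡ true → tick x (s , []) ≡ (s , [])
    tick-empty x i rewrite i = refl

    tick-caughtUp : ∀ x p → caughtUp p ≡ true → tick x p ≡ p
    tick-caughtUp x (s , []) up rewrite up = refl

    -- Appended updates matter only to an idle state with nothing queued, which would wait without
    -- them and begin one with them. Apart from this case, a copy can be treated as if the updates
    -- yet to arrive were queued already.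
    tick-++ : ∀ x s us vs → caughtUp (s , us) ≡ false →
              tick x (s , us ++ vs) ≡ map₂ (_++ vs) (tick x (s , us))
    tick-++ x s []       vs behind rewrite behind = refl
    tick-++ x s (u ∷ us) vs behind with idle s
    ... | false = refl
    ... | true  = refl

    caughtUp⁻ : ∀ p → caughtUp p ≡ true → idle (proj₁ p) ≡ true × proj₂ p ≡ []
    caughtUp⁻ (s , []) up = up , refl

    -- With an empty queue only the operation in progress counts. For a state just constructed this
    -- is `ConstructedWithin`.
    Ready : ℕ → State → Set
    Ready h s = ∀ (xs : Vec (Fin symbols) h) → caughtUp (execute xs (s , [])) ≡ true

    Ready-step : ∀ {h s} x → idle s ≡ false → Ready (suc h) s → Ready h (step x s)
    Ready-step {s = s} x busy ready xs with ready (x ∷ xs)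
    ... | r rewrite busy = r

    tick-idle : ∀ x {s u us} → idle s ≡ true → tick x (s , u ∷ us) ≡ (update u s , us)
    tick-idle x i rewrite i = refl

    tick-busy : ∀ x {s us} → idle s ≡ false → tick x (s , us) ≡ (step x s , us)
    tick-busy x i rewrite i = refl

    served-idle : ∀ w {s u us} → idle s ≡ true → served w (s , u ∷ us) ≡ w (length us)
    served-idle w i rewrite i = refl

    served-busy : ∀ w {s us} → idle s ≡ false → served w (s , us) ≡ w (length us)
    served-busy w i rewrite i = refl

    served-empty : ∀ w {s} → idle s ≡ true → served w (s , []) ≡ 0
    served-empty w i rewrite i = refl

    serves-idle : ∀ k {s u us} → idle s ≡ true → serves k (s , u ∷ us) ≡ (length us ≡ᵇ k)
    serves-idle k i rewrite i = refl

    serves-busy : ∀ k {s us} → idle s ≡ false → serves k (s , us) ≡ (length us ≡ᵇ k)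
    serves-busy k i rewrite i = refl

    serves-empty : ∀ k {s} → idle s ≡ true → serves k (s , []) ≡ false
    serves-empty k i rewrite i = refl

    -- Once the construction is over, beginning the first update takes a unit by itself. This is the
    -- source of `α` ≥ 1.
    time-first : ∀ h s u us → Ready h s → ∀ (xs : Vec (Fin symbols) (suc h)) →
                 1 ≤ time (length us) (s , u ∷ us) xs
    time-first h s u us ready (x ∷ xs) with idle s in eq
    ... | true rewrite ≡ᵇ-refl (length us) = s≤s z≤n
    time-first zero    s u us ready (x ∷ xs) | false = contradiction (trans (sym eq) (ready [])) λ ()
    time-first (suc h) s u us ready (x ∷ xs) | false =
      ≤-trans (time-first h (step x s) u us (Ready-step x eq ready) xs) (m≤n+m _ _)

  T⇒≡ : ∀ {p} → Bool.T p → p ≡ true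
  T⇒≡ {true} _ = refl

  ≤⇒≤ᵇ≡true : ∀ {m n} → m ≤ n → (m ≤ᵇ n) ≡ true
  ≤⇒≤ᵇ≡true m≤n = T⇒≡ (≤⇒≤ᵇ m≤n)

  ≤ᵇ⇔<ᵇsuc : ∀ m n → (m ≤ᵇ n) ≡ (m <ᵇ suc n)
  ≤ᵇ⇔<ᵇsuc zero    n = refl
  ≤ᵇ⇔<ᵇsuc (suc m) n = refl

  <ᵇsuc-≢ : ∀ m n → m ≢ n → (m <ᵇ suc n) ≡ (m <ᵇ n)
  <ᵇsuc-≢ zero    zero    m≢n = contradiction refl m≢n
  <ᵇsuc-≢ zero    (suc n) m≢n = refl
  <ᵇsuc-≢ (suc m) zero    m≢n = refl
  <ᵇsuc-≢ (suc m) (suc n) m≢n = <ᵇsuc-≢ m n (m≢n ∘ cong suc)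

  <ᵇ-irrefl : ∀ m → (m <ᵇ m) ≡ false
  <ᵇ-irrefl zero    = refl
  <ᵇ-irrefl (suc m) = <ᵇ-irrefl m

  -- The controller

  -- In a round, which begins when an update arrives, every copy in turn has a
  -- slot of at most 2 + β time units (`opening` and `serving`); then a copy that
  -- is up to date is sought, and in case there is none, all copies are brought
  -- up to date (`finishing`).
  data Phase (Q β : ℕ) : Set where
    opening   : Fin Q → Phase Q β
    serving   : Fin Q → Fin (suc β) → Phase Q β
    seeking   : Fin Q → Phase Q β
    finishing : Fin Q → Phase Q β
    resting   : Phase Q β

  phases : ℕ → ℕ → ℕ
  phases Q β = Q + (Q * suc β + (Q + (Q + 1)))

  Phase↔Fin : ∀ {Q β} → Phase Q β ↔ Fin (phases Q β)
  Phase↔Fin {Q} {β} = ↔-sym codes ↔-∘ mk↔ₛ′ to from to-from from-to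
    where
    Code : Set
    Code = Fin Q ⊎ Fin Q × Fin (suc β) ⊎ Fin Q ⊎ Fin Q ⊎ Fin 1

    codes : Fin (phases Q β) ↔ Code
    codes = (↔-id _ ⊎-↔ ((*↔× ⊎-↔ ((↔-id _ ⊎-↔ +↔⊎) ↔-∘ +↔⊎)) ↔-∘ +↔⊎)) ↔-∘ +↔⊎

    to : Phase Q β → Code
    to (opening i)   = inj₁ i
    to (serving i r) = inj₂ (inj₁ (i , r))
    to (seeking i)   = inj₂ (inj₂ (inj₁ i))
    to (finishing i) = inj₂ (inj₂ (inj₂ (inj₁ i)))
    to resting       = inj₂ (inj₂ (inj₂ (inj₂ zero)))

    from : Code → Phase Q β
    from (inj₁ i)                         = opening i
    from (inj₂ (inj₁ (i , r)))            = serving i r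
    from (inj₂ (inj₂ (inj₁ i)))           = seeking i
    from (inj₂ (inj₂ (inj₂ (inj₁ i))))    = finishing i
    from (inj₂ (inj₂ (inj₂ (inj₂ zero)))) = resting

    to-from : ∀ c → to (from c) ≡ c
    to-from (inj₁ i)                         = refl
    to-from (inj₂ (inj₁ (i , r)))            = refl
    to-from (inj₂ (inj₂ (inj₁ i)))           = refl
    to-from (inj₂ (inj₂ (inj₂ (inj₁ i))))    = refl
    to-from (inj₂ (inj₂ (inj₂ (inj₂ zero)))) = refl

    from-to : ∀ p → from (to p) ≡ p
    from-to (opening i)   = refl
    from-to (serving i r) = refl
    from-to (seeking i)   = refl
    from-to (finishing i) = refl
    from-to resting       = refl

  Bool↔Fin2 : Bool ↔ Fin 2
  Bool↔Fin2 = mk↔ₛ′ (λ { false → zero ; true → suc zero }) (λ { zero → false ; (suc zero) → true })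
                    (λ { zero → refl ; (suc zero) → refl }) (λ { false → refl ; true → refl })

  module Scheduler {Q′ : ℕ} (side : Fin (suc Q′) → Bool) (β L′ : ℕ) where

    Q L : ℕ
    Q = suc Q′
    L = suc L′

    top : Fin Q
    top = Fin.fromℕ Q′

    -- A clock (γ , t) counts t down to 0, when the copies on side γ are reset.
    Clock : Set
    Clock = Bool × Fin L

    Control : Set
    Control = Clock × Phase Q β

    tickClock : Clock → Clock
    tickClock (γ , zero)  = not γ , Fin.fromℕ L′
    tickClock (γ , suc t) = γ , inject₁ t

    -- Starting in `finishing` lets all copies complete their first construction without budgets.
    -- The clock stands at 0, but resets occur only in `opening`, and the first update moves it to a
    -- full count for the other side.
    initialControl : Control
    initialControl = (true , zero) , finishing top

    open-slot : Clock → Fin Q → Action Q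
    open-slot (γ , zero)  i = if does (side i Bool.≟ γ) then reset i else run i
    open-slot (γ , suc t) i = run i

    act : Control → Action Q
    act (clock , opening i)   = open-slot clock i
    act (_     , serving i r) = run i
    act (_     , seeking i)   = point i
    act (_     , finishing i) = run i
    act (_     , resting)     = wait

    nextSlot : Fin Q → Phase Q β
    nextSlot zero    = seeking top
    nextSlot (suc i) = opening (inject₁ i)

    nextPhase : Phase Q β → Bool → Phase Q β
    nextPhase (opening i)         true  = nextSlot i
    nextPhase (opening i)         false = serving i (Fin.fromℕ β)
    nextPhase (serving i r)       true  = nextSlot i
    nextPhase (serving i zero)    false = nextSlot i
    nextPhase (serving i (suc r)) false = serving i (inject₁ r)
    nextPhase (seeking i)         true  = resting
    nextPhase (seeking zero)      false = finishing top
    nextPhase (seeking (suc i))   false = seeking (inject₁ i)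
    nextPhase (finishing zero)    true  = resting
    nextPhase (finishing (suc i)) true  = finishing (inject₁ i)
    nextPhase (finishing i)       false = finishing i
    nextPhase resting             _     = opening top

    next : Control → Bool → Control
    next (clock , resting) o = tickClock clock , opening top
    next (clock , phase)   o = clock , nextPhase phase o

    controller : Controller Q
    controller = record
      { Control  = Control
      ; states   = 2 * L * phases Q β
      ; encode   = ↔⇒↣ (↔-sym *↔× ↔-∘ ((↔-sym *↔× ↔-∘ (Bool↔Fin2 ×-↔ ↔-id _)) ×-↔ Phase↔Fin))
      ; start    = initialControl
      ; pointer₀ = zero
      ; act      = act
      ; next     = next
      }

    awaits : Phase Q β → Fin Q → Bool
    awaits (opening j)   i = toℕ i ≤ᵇ toℕ j
    awaits (serving j r) i = toℕ i <ᵇ toℕ j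
    awaits _             i = false

    -- For the side that the clock resets next. At 0 the reset falls into the current round, and the
    -- count is 0 or a whole period `L + L` according to whether the slot of the copy is still to
    -- open.
    untilOwnReset : Fin L → Bool → ℕ
    untilOwnReset zero    true  = 0
    untilOwnReset zero    false = L + L
    untilOwnReset (suc t) _     = suc (toℕ t)

    untilOwnReset-true : ∀ t → untilOwnReset t true ≡ toℕ t
    untilOwnReset-true zero    = refl
    untilOwnReset-true (suc t) = refl

    -- How many more updates arrive before the next reset of copy i; 0 if it is
    -- still to come in this round.
    untilReset : Control → Fin Q → ℕ
    untilReset ((γ , t) , phase) i =
      if does (side i Bool.≟ γ) then untilOwnReset t (awaits phase i) else toℕ t + L

    -- Time units that copy i is still granted in this round, if it needs them.
    owed : Phase Q β → Fin Q → ℕ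
    owed (opening j)   i = if toℕ i ≤ᵇ toℕ j then suc β else 0
    owed (serving j r) i = if toℕ i <ᵇ toℕ j then suc β else
                           if toℕ i ≡ᵇ toℕ j then suc (toℕ r) else 0
    owed _             i = 0

    awaits-nextSlot : ∀ j i → awaits (nextSlot j) i ≡ (toℕ i <ᵇ toℕ j)
    awaits-nextSlot zero    i = refl
    awaits-nextSlot (suc j) i rewrite toℕ-inject₁ j = ≤ᵇ⇔<ᵇsuc (toℕ i) (toℕ j)

    owed-nextSlot : ∀ j i → owed (nextSlot j) i ≡ (if toℕ i <ᵇ toℕ j then suc β else 0)
    owed-nextSlot zero    i = refl
    owed-nextSlot (suc j) i rewrite toℕ-inject₁ j | ≤ᵇ⇔<ᵇsuc (toℕ i) (toℕ j) = refl

    ≤ᵇ-≢ : ∀ {i j : Fin Q} → i ≢ j → (toℕ i ≤ᵇ toℕ j) ≡ (toℕ i <ᵇ toℕ j)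
    ≤ᵇ-≢ {i} {j} i≢j = trans (≤ᵇ⇔<ᵇsuc (toℕ i) (toℕ j)) (<ᵇsuc-≢ _ _ (i≢j ∘ toℕ-injective))

    ≤ᵇ-refl : ∀ (i : Fin Q) → (toℕ i ≤ᵇ toℕ i) ≡ true
    ≤ᵇ-refl i = ≤⇒≤ᵇ≡true (≤-refl {toℕ i})

    ≤ᵇ-top : ∀ (i : Fin Q) → (toℕ i ≤ᵇ toℕ top) ≡ true
    ≤ᵇ-top i = ≤⇒≤ᵇ≡true (≤-trans (toℕ≤pred[n] i) (≤-reflexive (sym (toℕ-fromℕ Q′))))

    awaits-nextPhase : ∀ phase j o i → phase ≡ opening j ⊎ (∃[ r ] phase ≡ serving j r) →
                       awaits (nextPhase phase o) i ≡ (toℕ i <ᵇ toℕ j)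
    awaits-nextPhase _ j true  i (inj₁ refl)             = awaits-nextSlot j i
    awaits-nextPhase _ j false i (inj₁ refl)             = refl
    awaits-nextPhase _ j true  i (inj₂ (r , refl))       = awaits-nextSlot j i
    awaits-nextPhase _ j false i (inj₂ (zero , refl))    = awaits-nextSlot j i
    awaits-nextPhase _ j false i (inj₂ (suc r , refl))   = refl

    untilReset-cong : ∀ clock phase phase′ i → awaits phase′ i ≡ awaits phase i →
                      untilReset (clock , phase′) i ≡ untilReset (clock , phase) i
    untilReset-cong (γ , t) phase phase′ i eq rewrite eq = refl

    untilReset-other : ∀ clock phase o j i → phase ≡ opening j → i ≢ j →
                       untilReset (clock , nextPhase phase o) i ≡ untilReset (clock , phase) i
    untilReset-other clock phase o j i refl i≢j =
      untilReset-cong clock phase (nextPhase phase o) i (trans (awaits-nextPhase phase j o i (inj₁ refl)) (sym (≤ᵇ-≢ i≢j)))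

    -- A run changes `awaits` only for the copy whose slot it opens, and this matters only at clock
    -- 0 on the side to be reset. There, however, a slot opens with a reset and not with a run.
    untilReset-run : ∀ c j → act c ≡ run j → ∀ o i → untilReset (next c o) i ≡ untilReset c i
    untilReset-run ((γ , zero) , opening j) _ eq o i with side j Bool.≟ γ | i Fin.≟ j
    untilReset-run ((γ , zero) , opening j) _ () o i | yes _ | _
    ... | no _  | no i≢j  = untilReset-other (γ , zero) (opening j) o j i refl i≢j
    ... | no ≢γ | yes refl with side j Bool.≟ γ
    ...   | no _  = refl
    ...   | yes e = contradiction e ≢γ
    untilReset-run ((γ , suc t) , opening j) _ eq o i with side i Bool.≟ γ
    ... | yes _ = refl
    ... | no  _ = refl
    untilReset-run (clock , serving j r) _ eq o i =
      untilReset-cong clock (serving j r) (nextPhase (serving j r) o) i (awaits-nextPhase (serving j r) j o i (inj₂ (r , refl)))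
    untilReset-run (clock , finishing zero)    _ eq true  i = refl
    untilReset-run (clock , finishing (suc j)) _ eq true  i = refl
    untilReset-run (clock , finishing j)       _ eq false i =
      untilReset-cong clock (finishing j) (nextPhase (finishing j) false) i (cong (λ p → awaits p i) (finishing-false j))
      where
      finishing-false : ∀ j → nextPhase (finishing j) false ≡ finishing j
      finishing-false zero    = refl
      finishing-false (suc j) = refl

    untilReset-point : ∀ c j → act c ≡ point j → ∀ o i → untilReset (next c o) i ≡ untilReset c i
    untilReset-point ((γ , zero) , opening j) _ eq o i with does (side j Bool.≟ γ)
    untilReset-point ((γ , zero) , opening j) _ () o i | true
    untilReset-point ((γ , zero) , opening j) _ () o i | false
    untilReset-point (clock , seeking zero)    _ eq true  i = refl
    untilReset-point (clock , seeking (suc j)) _ eq true  i = refl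
    untilReset-point (clock , seeking zero)    _ eq false i = refl
    untilReset-point (clock , seeking (suc j)) _ eq false i = refl

    reset⇒opening : ∀ c j → act c ≡ reset j →
                    ∃[ γ ] c ≡ ((γ , zero) , opening j) × side j ≡ γ
    reset⇒opening ((γ , zero) , opening j) _ eq with side j Bool.≟ γ
    reset⇒opening ((γ , zero) , opening j) _ refl | yes e = γ , refl , e
    reset⇒opening ((γ , zero) , opening j) _ ()   | no _
    reset⇒opening (clock , serving i r)   j ()
    reset⇒opening (clock , seeking i)     j ()
    reset⇒opening (clock , finishing i)   j ()
    reset⇒opening (clock , resting)       j ()

    untilReset-reset-other : ∀ c j → act c ≡ reset j → ∀ o i → i ≢ j → untilReset (next c o) i ≡ untilReset c i
    untilReset-reset-other c j eq o i i≢j with reset⇒opening c j eq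
    ... | γ , refl , _ = untilReset-other (γ , zero) (opening j) o j i refl i≢j

    untilReset-reset : ∀ c j → act c ≡ reset j → untilReset c j ≡ 0 × (∀ o → untilReset (next c o) j ≡ L + L)
    untilReset-reset c j eq with reset⇒opening c j eq
    ... | γ , refl , e with side j Bool.≟ γ
    ...   | no ≢γ = contradiction e ≢γ
    ...   | yes _ = cong (untilOwnReset zero) (≤ᵇ-refl j) , λ o →
      cong (untilOwnReset zero) (trans (awaits-nextPhase (opening j) j o j (inj₁ refl)) (<ᵇ-irrefl (toℕ j)))

    wait⇒resting : ∀ c → act c ≡ wait → ∃[ clock ] c ≡ (clock , resting)
    wait⇒resting ((γ , zero) , opening j) eq with does (side j Bool.≟ γ)
    wait⇒resting ((γ , zero) , opening j) () | true
    wait⇒resting ((γ , zero) , opening j) () | false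
    wait⇒resting (clock , resting) eq = clock , refl

    -- When the clock wraps around, the two branches of `untilReset` change places: the side just
    -- reset goes from `L + L` to `L′ + L`, and the other one from `L` to `L′`.
    untilReset-wait : ∀ c → act c ≡ wait → ∀ o i → untilReset c i ≡ suc (untilReset (next c o) i)
    untilReset-wait c eq o i with wait⇒resting c eq
    ... | (γ , zero) , refl with side i Bool.≟ γ | side i Bool.≟ not γ
    ...   | yes e | yes e′ = contradiction (trans (sym e) e′) (Bool.not-¬ refl)
    ...   | yes e | no  _  = cong (λ t → suc (t + L)) (sym (toℕ-fromℕ L′))
    ...   | no ¬e | yes _  rewrite ≤ᵇ-top i =
      cong suc (sym (trans (untilOwnReset-true (Fin.fromℕ L′)) (toℕ-fromℕ L′)))
    ...   | no ¬e | no ¬e′ = contradiction (Bool.¬-not ¬e) ¬e′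
    untilReset-wait c eq o i | (γ , suc t) , refl with side i Bool.≟ γ
    ... | no  _ = cong (λ t → suc (t + L)) (sym (toℕ-inject₁ t))
    ... | yes _ rewrite ≤ᵇ-top i =
      cong suc (sym (trans (untilOwnReset-true (inject₁ t)) (toℕ-inject₁ t)))

    untilReset≤2L : ∀ c i → untilReset c i ≤ L + L
    untilReset≤2L ((γ , t) , phase) i with does (side i Bool.≟ γ) | t | awaits phase i
    ... | true  | zero  | true  = z≤n
    ... | true  | zero  | false = ≤-refl
    ... | true  | suc t | _     = ≤-trans (<⇒≤ (toℕ<n (suc t))) (m≤m+n L L)
    ... | false | t     | _     = +-monoˡ-≤ L (<⇒≤ (toℕ<n t))

    -- The side that has gone longest without a reset. At clock 0 the side of the clock is itself
    -- being renewed in this round, so the other one takes over.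
    steadySide : Clock → Bool
    steadySide (γ , zero)  = not γ
    steadySide (γ , suc t) = γ

    untilReset-steady : ∀ clock phase i → side i ≡ steadySide clock → untilReset (clock , phase) i ≤ L
    untilReset-steady (γ , zero) phase i e with side i Bool.≟ γ
    ... | yes e′ = contradiction (trans (sym e′) e) (Bool.not-¬ refl)
    ... | no  _  = ≤-refl
    untilReset-steady (γ , suc t) phase i e with side i Bool.≟ γ
    ... | yes _  = <⇒≤ (toℕ<n (suc t))
    ... | no  ¬e = contradiction e ¬e

    untilReset-start : ∀ i → L ≤ untilReset initialControl i
    untilReset-start i with does (side i Bool.≟ true)
    ... | true  = m≤m+n L L
    ... | false = ≤-refl

    phaseOf : Control → Phase Q β
    phaseOf = proj₂

    next-acting : ∀ c o → act c ≢ wait → next c o ≡ (proj₁ c , nextPhase (phaseOf c) o)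
    next-acting (clock , opening i)   o busy = refl
    next-acting (clock , serving i s) o busy = refl
    next-acting (clock , seeking i)   o busy = refl
    next-acting (clock , finishing i) o busy = refl
    next-acting (clock , resting)     o busy = contradiction refl busy

    resting⇒wait : ∀ c → phaseOf c ≡ resting → act c ≡ wait
    resting⇒wait (clock , resting) refl = refl

    above-top : ∀ (i : Fin Q) → ¬ toℕ top < toℕ i
    above-top i top<i = <-irrefl refl (≤-trans top<i (≤-trans (toℕ≤pred[n] i) (≤-reflexive (sym (toℕ-fromℕ Q′)))))

    above-inject₁ : ∀ {n} (j : Fin n) i → toℕ (inject₁ j) < toℕ i → i ≡ suc j ⊎ suc (toℕ j) < toℕ i
    above-inject₁ j i j<i with i Fin.≟ suc j
    ... | yes eq = inj₁ eq
    ... | no i≢j = inj₂ (≤∧≢⇒< (subst (_< toℕ i) (toℕ-inject₁ j) j<i) (i≢j ∘ sym ∘ toℕ-injective))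

    owed-slot : ∀ phase j o i → phase ≡ opening j ⊎ (∃[ r ] phase ≡ serving j r) → i ≢ j →
                owed (nextPhase phase o) i ≡ owed phase i
    owed-slot _ j true  i (inj₁ refl) i≢j rewrite ≤ᵇ-≢ i≢j = owed-nextSlot j i
    owed-slot _ j false i (inj₁ refl) i≢j
      rewrite ≤ᵇ-≢ i≢j | ≢⇒≡ᵇ≡false {toℕ i} {toℕ j} (i≢j ∘ toℕ-injective) = refl
    owed-slot _ j true  i (inj₂ (r , refl)) i≢j
      rewrite ≢⇒≡ᵇ≡false {toℕ i} {toℕ j} (i≢j ∘ toℕ-injective) = owed-nextSlot j i
    owed-slot _ j false i (inj₂ (zero , refl)) i≢j
      rewrite ≢⇒≡ᵇ≡false {toℕ i} {toℕ j} (i≢j ∘ toℕ-injective) = owed-nextSlot j i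
    owed-slot _ j false i (inj₂ (suc r , refl)) i≢j
      rewrite ≢⇒≡ᵇ≡false {toℕ i} {toℕ j} (i≢j ∘ toℕ-injective) = refl

    owed-finishing : ∀ j o i → owed (nextPhase (finishing j) o) i ≡ 0
    owed-finishing zero    true  i = refl
    owed-finishing zero    false i = refl
    owed-finishing (suc j) true  i = refl
    owed-finishing (suc j) false i = refl

    owed-run-other : ∀ c j → act c ≡ run j → ∀ o i → i ≢ j →
                     owed (phaseOf (next c o)) i ≡ owed (phaseOf c) i
    owed-run-other ((γ , zero) , opening j) _ eq o i i≢j with does (side j Bool.≟ γ)
    owed-run-other ((γ , zero) , opening j) _ ()   o i i≢j | true
    owed-run-other ((γ , zero) , opening j) _ refl o i i≢j | false = owed-slot (opening j) j o i (inj₁ refl) i≢j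
    owed-run-other ((γ , suc t) , opening j) _ refl o i i≢j = owed-slot (opening j) j o i (inj₁ refl) i≢j
    owed-run-other (clock , serving j r) _ refl o i i≢j = owed-slot (serving j r) j o i (inj₂ (r , refl)) i≢j
    owed-run-other (clock , finishing j) _ refl o i i≢j = owed-finishing j o i

    -- The unit of `opening` is left out of `owed`, since a reset may take it; a run in that unit
    -- therefore leaves `owed` as it is, and only the units of `serving` lower it.
    owed-run : ∀ c j → act c ≡ run j → owed (phaseOf c) j ≤ suc (owed (phaseOf (next c false)) j)
    owed-run ((γ , zero) , opening j) _ eq with does (side j Bool.≟ γ)
    owed-run ((γ , zero) , opening j) _ ()   | true
    owed-run ((γ , zero) , opening j) _ refl | false
      rewrite ≤ᵇ-refl j | <ᵇ-irrefl (toℕ j) | ≡ᵇ-refl (toℕ j) | toℕ-fromℕ β = n≤1+n _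
    owed-run ((γ , suc t) , opening j) _ refl
      rewrite ≤ᵇ-refl j | <ᵇ-irrefl (toℕ j) | ≡ᵇ-refl (toℕ j) | toℕ-fromℕ β = n≤1+n _
    owed-run (clock , serving j zero) _ refl
      rewrite <ᵇ-irrefl (toℕ j) | ≡ᵇ-refl (toℕ j) = s≤s z≤n
    owed-run (clock , serving j (suc r)) _ refl
      rewrite <ᵇ-irrefl (toℕ j) | ≡ᵇ-refl (toℕ j) | toℕ-inject₁ r = ≤-refl
    owed-run (clock , finishing j) _ refl = z≤n

    owed-point : ∀ c j → act c ≡ point j → ∀ o i → owed (phaseOf (next c o)) i ≡ owed (phaseOf c) i
    owed-point ((γ , zero) , opening j) _ eq o i with does (side j Bool.≟ γ)
    owed-point ((γ , zero) , opening j) _ () o i | true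
    owed-point ((γ , zero) , opening j) _ () o i | false
    owed-point (clock , seeking zero)    _ eq true  i = refl
    owed-point (clock , seeking (suc j)) _ eq true  i = refl
    owed-point (clock , seeking zero)    _ eq false i = refl
    owed-point (clock , seeking (suc j)) _ eq false i = refl

    owed-reset-other : ∀ c j → act c ≡ reset j → ∀ o i → i ≢ j →
                       owed (phaseOf (next c o)) i ≡ owed (phaseOf c) i
    owed-reset-other c j eq o i i≢j with reset⇒opening c j eq
    ... | γ , refl , _ = owed-slot (opening j) j o i (inj₁ refl) i≢j

    owed-wait : ∀ c → act c ≡ wait → ∀ o i → owed (phaseOf c) i ≡ 0 × owed (phaseOf (next c o)) i ≡ suc β
    owed-wait c eq o i with wait⇒resting c eq
    ... | clock , refl rewrite ≤ᵇ-top i = refl , refl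

  <ᵇ≡true⇒< : ∀ {m n} → (m <ᵇ n) ≡ true → m < n
  <ᵇ≡true⇒< {m} {n} eq = <ᵇ⇒< m n (subst Bool.T (sym eq) _)

  <⇒<ᵇ≡true : ∀ {m n} → m < n → (m <ᵇ n) ≡ true
  <⇒<ᵇ≡true m<n = T⇒≡ (<⇒<ᵇ m<n)

  ≥⇒<ᵇ≡false : ∀ {m n} → n ≤ m → (m <ᵇ n) ≡ false
  ≥⇒<ᵇ≡false {m}     {zero}  _         = refl
  ≥⇒<ᵇ≡false {suc m} {suc n} (s≤s n≤m) = ≥⇒<ᵇ≡false n≤m

  -- The effect of one time unit on a single copy

  module Analysis {P : Problem} (A : Algorithm P) {Q′ : ℕ} (side : Fin (suc Q′) → Bool) (β L′ : ℕ) where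
    open Problem P
    open Scheduler side β L′ public
    open Copies A controller public renaming (begin to initially)
    module A = Algorithm A
    module R = Run A
    module R′ = Run algorithm
    module W = Work A

    copy : Configuration → Fin Q → R.Process
    copy κ i = lookup (copies κ) i

    phase : Configuration → Phase Q β
    phase κ = phaseOf (control κ)

    module W′ = Work algorithm

    waiting-paying : ∀ κ {t} → toll κ ≡ suc t → waiting κ ≡ false
    waiting-paying κ paying with toll κ | act (control κ)
    waiting-paying κ refl | .(suc _) | reset _ = refl
    waiting-paying κ refl | .(suc _) | run _   = refl
    waiting-paying κ refl | .(suc _) | point _ = refl
    waiting-paying κ refl | .(suc _) | wait    = refl

    waiting-acting : ∀ κ → act (control κ) ≢ wait → waiting κ ≡ false
    waiting-acting κ acts with toll κ | act (control κ)
    ... | zero  | reset _ = refl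
    ... | zero  | run _   = refl
    ... | zero  | point _ = refl
    ... | zero  | wait    = contradiction refl acts
    ... | suc _ | reset _ = refl
    ... | suc _ | run _   = refl
    ... | suc _ | point _ = refl
    ... | suc _ | wait    = refl

    advance-paying : ∀ x κ {t} → toll κ ≡ suc t → advance x κ ≡ record κ { toll = t }
    advance-paying x κ paying with toll κ
    advance-paying x κ refl | .(suc _) = refl

    advance-acting : ∀ x κ → toll κ ≡ 0 → advance x κ ≡ perform (act (control κ)) x κ
    advance-acting x κ free with toll κ
    advance-acting x κ refl | .0 = refl

    tick-paying : ∀ x κ us {t} → toll κ ≡ suc t → R′.tick x (κ , us) ≡ (record κ { toll = t } , us)
    tick-paying x κ us paying =
      trans (W′.tick-busy x {κ} {us} (waiting-paying κ paying)) (cong (_, us) (advance-paying x κ paying))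

    tick-acting : ∀ x κ us {α} → toll κ ≡ 0 → act (control κ) ≡ α → α ≢ wait →
                  R′.tick x (κ , us) ≡ (perform α x κ , us)
    tick-acting x κ us free refl acts =
      trans (W′.tick-busy x {κ} {us} (waiting-acting κ acts)) (cong (_, us) (advance-acting x κ free))

    waiting-wait : ∀ κ → toll κ ≡ 0 → act (control κ) ≡ wait → waiting κ ≡ true
    waiting-wait κ free waits with toll κ | act (control κ)
    waiting-wait κ refl refl | .0 | .wait = refl

    tick-arrival : ∀ x κ u us → toll κ ≡ 0 → act (control κ) ≡ wait → R′.tick x (κ , u ∷ us) ≡ (receive u κ , us)
    tick-arrival x κ u us free waits = W′.tick-idle x {κ} {u} {us} (waiting-wait κ free waits)

    tick-wait : ∀ x κ → toll κ ≡ 0 → act (control κ) ≡ wait → R′.tick x (κ , []) ≡ (κ , [])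
    tick-wait x κ free waits = W′.tick-empty x {κ} (waiting-wait κ free waits)

    -- Rules out the actions that a copy has to pay for, which is what the amortization needs to
    -- know. While a toll is being paid, no action is performed, whence the premise.
    Passive : Configuration → Fin Q → Set
    Passive κ i = toll κ ≡ 0 →
      (act (control κ) ≡ run i → R.caughtUp (copy κ i) ≡ true) × act (control κ) ≢ reset i

    -- The last alternative covers a unit given to a copy that is up to date: it ends the slot and
    -- thereby forfeits what was owed.
    Stays : Configuration → List Update → Fin Q → R′.Process → Set
    Stays κ us i (κ′ , us′) =
      us′ ≡ us × copy κ′ i ≡ copy κ i × untilReset (control κ′) i ≡ untilReset (control κ) i ×
      (owed (phase κ) i ≤ owed (phase κ′) i ⊎ R.caughtUp (copy κ i) ≡ true)

    Receives : Configuration → Update → List Update → Fin Q → R′.Process → Set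
    Receives κ u us i (κ′ , us′) =
      us′ ≡ us × copy κ′ i ≡ enqueue u (copy κ i) × untilReset (control κ) i ≡ suc (untilReset (control κ′) i) ×
      owed (phase κ) i ≡ 0 × owed (phase κ′) i ≡ suc β

    Ticks : Configuration → List Update → Fin Q → Fin A.symbols → R′.Process → Set
    Ticks κ us i x (κ′ , us′) =
      us′ ≡ us × copy κ′ i ≡ R.tick x (copy κ i) × untilReset (control κ′) i ≡ untilReset (control κ) i ×
      (owed (phase κ) i ≤ suc (owed (phase κ′) i) ⊎ R.caughtUp (copy κ′ i) ≡ true)

    Renews : Configuration → List Update → Fin Q → R′.Process → Set
    Renews κ us i (κ′ , us′) =
      us′ ≡ us × copy κ′ i ≡ (A.construct (current κ) , []) × untilReset (control κ′) i ≡ L + L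

    -- The quantifier over symbols stands inside the constructors, so which case applies is known
    -- before the symbol is read. In particular, the work credited to a copy in this unit does not
    -- depend on the symbol.
    data Effect (κ : Configuration) : List Update → Fin Q → Set where
      still    : ∀ {us i} → Passive κ i →
                 (∀ x → Stays κ us i (R′.tick x (κ , us))) → Effect κ us i
      received : ∀ {u us i} → act (control κ) ≡ wait →
                 (∀ x → Receives κ u us i (R′.tick x (κ , u ∷ us))) → Effect κ (u ∷ us) i
      ticked   : ∀ {us i} → act (control κ) ≡ run i → R.caughtUp (copy κ i) ≡ false →
                 (∀ x → Ticks κ us i x (R′.tick x (κ , us))) → Effect κ us i
      renewed  : ∀ {us i} → untilReset (control κ) i ≡ 0 →
                 (∀ x → Renews κ us i (R′.tick x (κ , us))) → Effect κ us i

    run-injective : ∀ {i j : Fin Q} → run i ≡ run j → i ≡ j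
    run-injective refl = refl

    reset-injective : ∀ {i j : Fin Q} → reset i ≡ reset j → i ≡ j
    reset-injective refl = refl

    effect : ∀ κ us i → Effect κ us i
    effect κ us i = cases (toll κ) refl (act (control κ)) refl us
      where
      c : Control
      c = control κ
      stays : ∀ {us p} x → R′.tick x (κ , us) ≡ p → Stays κ us i p → Stays κ us i (R′.tick x (κ , us))
      stays {us} x eq = subst (Stays κ us i) (sym eq)
      passive : ∀ {α} → act c ≡ α → (α ≡ run i → R.caughtUp (copy κ i) ≡ true) → α ≢ reset i → Passive κ i
      passive refl runs resets _ = runs , resets
      cases : ∀ t → toll κ ≡ t → ∀ α → act c ≡ α → ∀ us → Effect κ us i
      cases (suc t) tolls α acts us = still (λ free → contradiction (trans (sym tolls) free) λ ())
        λ x → stays x (tick-paying x κ us tolls) (refl , refl , refl , inj₁ ≤-refl)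
      cases zero tolls wait acts [] = still (passive acts (λ ()) λ ())
        λ x → stays x (tick-wait x κ tolls acts) (refl , refl , refl , inj₁ ≤-refl)
      cases zero tolls wait acts (u ∷ us) = received acts λ x →
        subst (Receives κ u us i) (sym (tick-arrival x κ u us tolls acts))
          (refl , lookup-map i (enqueue u) (copies κ) , untilReset-wait c acts false i , owed-wait c acts false i)
      cases zero tolls (point j) acts us = still (passive acts (λ ()) λ ())
        λ x → stays x (tick-acting x κ us tolls acts λ ())
          (refl , refl , untilReset-point c j acts _ i , inj₁ (≤-reflexive (sym (owed-point c j acts _ i))))
      cases zero tolls (reset j) acts us with i Fin.≟ j
      ... | yes refl = renewed (proj₁ (untilReset-reset c i acts)) λ x →
        subst (Renews κ us i) (sym (tick-acting x κ us tolls acts λ ()))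
          (refl , lookup∘update i (copies κ) _ , proj₂ (untilReset-reset c i acts) _)
      ... | no i≢j = still (passive acts (λ ()) (i≢j ∘ sym ∘ reset-injective))
        λ x → stays x (tick-acting x κ us tolls acts λ ())
          (refl , lookup∘update′ i≢j (copies κ) _ , untilReset-reset-other c j acts _ i i≢j ,
           inj₁ (≤-reflexive (sym (owed-reset-other c j acts _ i i≢j))))
      cases zero tolls (run j) acts us with i Fin.≟ j
      ... | no i≢j = still (passive acts (λ eq → contradiction (sym (run-injective eq)) i≢j) λ ())
        λ x → stays x (tick-acting x κ us tolls acts λ ())
          (refl , lookup∘update′ i≢j (copies κ) _ , untilReset-run c j acts _ i ,
           inj₁ (≤-reflexive (sym (owed-run-other c j acts _ i i≢j))))
      ... | yes refl = by (R.caughtUp (copy κ i)) refl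
        where
        by : ∀ o → R.caughtUp (copy κ i) ≡ o → Effect κ us i
        by true up = still (passive acts (λ _ → up) λ ())
          λ x → stays x (tick-acting x κ us tolls acts λ ())
            (refl , trans (lookup∘update i (copies κ) _) (W.tick-caughtUp x (copy κ i) up) ,
             untilReset-run c i acts _ i , inj₂ up)
        by false behind = ticked acts behind λ x →
          subst (Ticks κ us i x) (sym (tick-acting x κ us tolls acts λ ()))
            (refl , lookup∘update i (copies κ) _ , untilReset-run c i acts _ i ,
             owes (R.caughtUp (copy (perform (run i) x κ) i)))
          where
          owes : ∀ o → owed (phase κ) i ≤ suc (owed (phaseOf (next c o)) i) ⊎ o ≡ true
          owes true  = inj₂ refl
          owes false = inj₁ (owed-run c i acts)

    Continues : R′.Process → R′.Process → Set
    Continues (κ , us) (κ′ , us′) =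
      (us′ ≡ us × current κ′ ≡ current κ) ⊎ (∃[ u ] us ≡ u ∷ us′ × current κ′ ≡ apply u (current κ))

    continues : ∀ κ us x → Continues (κ , us) (R′.tick x (κ , us))
    continues κ us x = cases (toll κ) refl (act (control κ)) refl us
      where
      cases : ∀ t → toll κ ≡ t → ∀ α → act (control κ) ≡ α → ∀ us → Continues (κ , us) (R′.tick x (κ , us))
      cases (suc t) tolls α acts us =
        subst (Continues (κ , us)) (sym (tick-paying x κ us tolls)) (inj₁ (refl , refl))
      cases zero tolls (run j) acts us =
        subst (Continues (κ , us)) (sym (tick-acting x κ us tolls acts λ ())) (inj₁ (refl , refl))
      cases zero tolls (reset j) acts us =
        subst (Continues (κ , us)) (sym (tick-acting x κ us tolls acts λ ())) (inj₁ (refl , refl))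
      cases zero tolls (point j) acts us =
        subst (Continues (κ , us)) (sym (tick-acting x κ us tolls acts λ ())) (inj₁ (refl , refl))
      cases zero tolls wait acts [] =
        subst (Continues (κ , [])) (sym (tick-wait x κ tolls acts)) (inj₁ (refl , refl))
      cases zero tolls wait acts (u ∷ us) =
        subst (Continues (κ , u ∷ us)) (sym (tick-arrival x κ u us tolls acts)) (inj₂ (u , refl , refl))

    bounded-tick : ∀ {N} κ us x → Bounded N (current κ) us →
                   let (κ′ , us′) = R′.tick x (κ , us) in Bounded N (current κ′) us′
    bounded-tick κ us x bounded with R′.tick x (κ , us) | continues κ us x
    ... | _ | inj₁ (refl , eq) rewrite eq = bounded
    ... | _ | inj₂ (u , refl , eq) rewrite eq = proj₂ bounded

    length-tick : ∀ {n} κ us x → length us ≤ n → length (proj₂ (R′.tick x (κ , us))) ≤ n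
    length-tick κ us x us≤n with R′.tick x (κ , us) | continues κ us x
    ... | _ | inj₁ (refl , _)     = us≤n
    ... | _ | inj₂ (u , refl , _) = ≤-trans (n≤1+n _) us≤n

    -- Only the initial construction is going on.
    Fresh : Configuration → Set
    Fresh κ = toll κ ≡ 0 × (∃[ j ] phase κ ≡ finishing j × (∀ i → toℕ j < toℕ i → R.caughtUp (copy κ i) ≡ true))

    Rested : Configuration → Set
    Rested κ = toll κ ≡ 0 × phase κ ≡ resting × (∀ i → R.caughtUp (copy κ i) ≡ true)

    fresh-start : ∀ S → Fresh (initially S)
    fresh-start S = refl , top , refl , λ i top<i → contradiction top<i (above-top i)

    finishing⇒run : ∀ c {j} → phaseOf c ≡ finishing j → act c ≡ run j
    finishing⇒run (clock , finishing j) refl = refl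

    fresh-act : ∀ κ → Fresh κ → ∃[ j ] act (control κ) ≡ run j
    fresh-act κ (_ , j , finishes , _) = j , finishing⇒run (control κ) finishes

    Finishing : Configuration → List Update → R′.Process → Set
    Finishing κ us (κ′ , us′) =
      us′ ≡ us × (∀ i → untilReset (control κ′) i ≡ untilReset (control κ) i) × (Fresh κ′ ⊎ Rested κ′)

    fresh-step : ∀ κ us x → Fresh κ → Finishing κ us (R′.tick x (κ , us))
    fresh-step κ us x (free , j , finishes , up) =
      subst (Finishing κ us)
        (sym (tick-acting x κ us free (finishing⇒run (control κ) finishes) λ ()))
        (refl , untilReset-run (control κ) j (finishing⇒run (control κ) finishes) _ ,
         after j up (cong (λ ph → proj₁ (control κ) , ph) finishes) (R.caughtUp (copy (perform (run j) x κ) j)) refl)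
      where
      others : ∀ j i → i ≢ j → copy (perform (run j) x κ) i ≡ copy κ i
      others j i i≢j = lookup∘update′ i≢j (copies κ) _
      stays : ∀ (j : Fin Q) → nextPhase (finishing j) false ≡ finishing j
      stays zero    = refl
      stays (suc j) = refl
      after : ∀ j → (∀ i → toℕ j < toℕ i → R.caughtUp (copy κ i) ≡ true) →
              control κ ≡ (proj₁ (control κ) , finishing j) →
              ∀ o → R.caughtUp (copy (perform (run j) x κ) j) ≡ o →
              Fresh (perform (run j) x κ) ⊎ Rested (perform (run j) x κ)
      after j up c false behind =
        inj₁ (free , j , trans (cong₂ (λ c o → phaseOf (next c o)) c behind) (stays j) , λ i j<i →
          trans (cong R.caughtUp (others j i (λ { refl → <-irrefl refl j<i }))) (up i j<i))
      after zero up c true done = inj₂ (free , cong₂ (λ c o → phaseOf (next c o)) c done , all)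
        where
        all : ∀ i → R.caughtUp (copy (perform (run zero) x κ) i) ≡ true
        all zero    = done
        all (suc i) = trans (cong R.caughtUp (others zero (suc i) λ ())) (up (suc i) (s≤s z≤n))
      after (suc j) up c true done =
        inj₁ (free , inject₁ j , cong₂ (λ c o → phaseOf (next c o)) c done , above)
        where
        above : ∀ i → toℕ (inject₁ j) < toℕ i → R.caughtUp (copy (perform (run (suc j)) x κ) i) ≡ true
        above i j<i with above-inject₁ j i j<i
        ... | inj₁ refl = done
        ... | inj₂ lt   = trans (cong R.caughtUp (others (suc j) i (λ { refl → <-irrefl refl lt }))) (up i lt)

    -- The copy with the updates queued that are yet to arrive, as if they had
    -- been supplied at once.
    virtual : List Update → R.Process → R.Process
    virtual us (s , queue) = s , queue ++ us

    -- The expected remaining work of a copy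

    module Potential (N a n₀ : ℕ) (w : ℕ → ℕ)
      (fast : ∀ S us → Bounded N S us → ∀ us₁ u us₂ → us ≡ us₁ ++ u ∷ us₂ →
              ∀ M → ∑ (sequences A.symbols M) (R.time (length us₂) (A.construct S , us)) ≤ a * A.symbols ^ M) where

      private
        b = A.symbols

      -- When d updates are yet to arrive and ρ more before the next reset, the
      -- updates (counted from the last one) that arrive between the last reset
      -- and the next one, and those that arrive later.  Both are invariant when
      -- an update arrives, since only the difference of ρ and d matters.
      window later : ℕ → ℕ → ℕ → ℕ
      window d ρ k = if ρ + k <ᵇ d then 0 else if ρ + k <ᵇ d + (L + L) then w k else 0
      later  d ρ k = if ρ + k <ᵇ d then w k else 0

      -- An upper bound for the expected weighted work still to come, times the number of sequences:
      -- the present copy is imagined to get all `M` units, and each update after its next reset is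
      -- reserved at `a`, because it will be processed by a copy not yet constructed.
      value : ℕ → R.Process → ℕ → ℕ → ℕ
      value M p d ρ = W.totalWork (window d ρ) M p + a * b ^ M * ∑ (upTo n₀) (later d ρ)

      potential : ℕ → R′.Process → Fin Q → ℕ
      potential M (κ , us) i = value M (virtual us (copy κ i)) (length us) (untilReset (control κ) i)

      gainOf : ∀ {κ us i} → Effect κ us i → ℕ
      gainOf {κ} {us} {i} (ticked _ _ _) =
        W.served (window (length us) (untilReset (control κ) i)) (virtual us (copy κ i))
      gainOf _ = 0

      gain : Configuration → List Update → Fin Q → ℕ
      gain κ us i = gainOf (effect κ us i)

      value-mono : ∀ M p d ρ → b * value M p d ρ ≤ value (suc M) p d ρ
      value-mono M p d ρ = begin
        b * value M p d ρ
          ≡⟨ *-distribˡ-+ b (W.totalWork (window d ρ) M p) _ ⟩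
        b * W.totalWork (window d ρ) M p + b * (a * b ^ M * Z)
          ≡⟨ cong (b * W.totalWork (window d ρ) M p +_) (rearrange b a (b ^ M) Z) ⟩
        b * W.totalWork (window d ρ) M p + a * (b * b ^ M) * Z
          ≤⟨ +-monoˡ-≤ _ (W.totalWork-mono (window d ρ) M p) ⟩
        value (suc M) p d ρ ∎
        where
        open ≤-Reasoning
        Z = ∑ (upTo n₀) (later d ρ)
        rearrange : ∀ b a c z → b * (a * c * z) ≡ a * (b * c) * z
        rearrange = solve-∀

      -- A reset splits the updates that were reserved into those before the following reset and
      -- those after it. So the old reserve pays for the whole value of the new copy.
      restart-window : ∀ d k → window d (L + L) k + later d (L + L) k ≤ later d 0 k
      restart-window d k with L + L + k <ᵇ d in eq
      ... | true rewrite <⇒<ᵇ≡true {k} {d} (≤-trans (s≤s (m≤n+m k (L + L))) (<ᵇ≡true⇒< {L + L + k} eq)) = ≤-refl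
      ... | false with L + L + k <ᵇ d + (L + L) in eq′
      ...   | false = z≤n
      ...   | true rewrite <⇒<ᵇ≡true {k} {d} (+-cancelˡ-< (L + L) k d (subst (L + L + k <_) (+-comm d (L + L)) (<ᵇ≡true⇒< eq′)))
                   = ≤-reflexive (+-identityʳ (w k))

      window-later : ∀ d ρ k → window d ρ k + later d ρ k ≤ w k
      window-later d ρ k with ρ + k <ᵇ d
      ... | true = ≤-refl
      ... | false with ρ + k <ᵇ d + (L + L)
      ...   | true  = ≤-reflexive (+-identityʳ (w k))
      ...   | false = z≤n

      window-inside : ∀ {d ρ k} → d ≤ k → ρ + k < d + (L + L) → window d ρ k ≡ w k
      window-inside {d} {ρ} {k} d≤k inside
        rewrite ≥⇒<ᵇ≡false {ρ + k} {d} (≤-trans d≤k (m≤n+m k ρ)) | <⇒<ᵇ≡true inside = refl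

      window-vanishes : ∀ d ρ k → w k ≡ 0 → window d ρ k ≡ 0
      window-vanishes d ρ k w≡0 rewrite w≡0 with ρ + k <ᵇ d | ρ + k <ᵇ d + (L + L)
      ... | true  | _     = refl
      ... | false | true  = refl
      ... | false | false = refl

      value-construct : ∀ M S us ρ → Bounded N S us → length us ≤ n₀ →
        (∀ k → length us ≤ k → window (length us) ρ k ≡ 0) →
        ∀ z → (∀ k → window (length us) ρ k + later (length us) ρ k ≤ z k) →
        value M (A.construct S , us) (length us) ρ ≤ a * b ^ M * ∑ (upTo n₀) z
      value-construct M S us ρ bounded us≤n₀ vanish z below = begin
        value M (A.construct S , us) d ρ
          ≤⟨ +-monoˡ-≤ _ (W.totalWork-bound (window d ρ) M (A.construct S) us us≤n₀ vanish
               (λ us₁ u us₂ eq → fast S us bounded us₁ u us₂ eq M)) ⟩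
        a * b ^ M * ∑ (upTo n₀) (window d ρ) + a * b ^ M * ∑ (upTo n₀) (later d ρ)
          ≡⟨ *-distribˡ-+ (a * b ^ M) (∑ (upTo n₀) (window d ρ)) _ ⟨
        a * b ^ M * (∑ (upTo n₀) (window d ρ) + ∑ (upTo n₀) (later d ρ))
          ≡⟨ cong (a * b ^ M *_) (∑-+ (upTo n₀) (window d ρ) (later d ρ)) ⟨
        a * b ^ M * ∑ (upTo n₀) (λ k → window d ρ k + later d ρ k)
          ≤⟨ *-monoʳ-≤ (a * b ^ M) (∑-mono (upTo n₀) below) ⟩
        a * b ^ M * ∑ (upTo n₀) z ∎
        where
        open ≤-Reasoning
        d = length us

      potential-start : ∀ M S us i → Bounded N S us → length us ≡ n₀ → (∀ k → n₀ ≤ k → w k ≡ 0) →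
                        potential M (initially S , us) i ≤ a * b ^ M * ∑ (upTo n₀) w
      potential-start M S us i bounded eq w≡0 =
        subst (λ p → value M (virtual us p) (length us) (untilReset initialControl i) ≤ a * b ^ M * ∑ (upTo n₀) w)
          (sym (lookup-replicate i (A.construct S , [])))
          (value-construct M S us (untilReset initialControl i) bounded (≤-reflexive eq)
            (λ k d≤k → window-vanishes (length us) (untilReset initialControl i) k (w≡0 k (subst (_≤ k) eq d≤k))) w
            (window-later (length us) (untilReset initialControl i)))

      -- Just after a reset the window contains only updates yet to arrive, so the new construction
      -- carries no weight and the bound for updates applies.
      value-restart : ∀ M S us → Bounded N S us → length us ≤ n₀ →
        value M (A.construct S , us) (length us) (L + L) ≤ a * b ^ M * ∑ (upTo n₀) (later (length us) 0)
      value-restart M S us bounded us≤n₀ =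
        value-construct M S us (L + L) bounded us≤n₀ vanish _ (restart-window (length us))
        where
        vanish : ∀ k → length us ≤ k → window (length us) (L + L) k ≡ 0
        vanish k us≤k
          rewrite ≥⇒<ᵇ≡false {L + L + k} {length us} (≤-trans us≤k (m≤n+m k (L + L)))
                | ≥⇒<ᵇ≡false {L + L + k} {length us + (L + L)}
                    (≤-trans (+-monoˡ-≤ (L + L) us≤k) (≤-reflexive (+-comm k (L + L)))) = refl

      -- The form in which a potential can be pulled out of the sum over symbols: it may fall at a
      -- reset or by the passing of time, but not in a way that depends on the symbol.
      Constant : ℕ → Configuration → List Update → Fin Q → Set
      Constant M κ us i =
        ∃[ c ] (∀ x → potential M (R′.tick x (κ , us)) i ≡ c) × b * c ≤ potential (suc M) (κ , us) i

      module Step (M : ℕ) (κ : Configuration) (us : List Update)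
                  (bounded : Bounded N (current κ) us) (us≤n₀ : length us ≤ n₀) where

        still-constant : ∀ {i} → (∀ x → Stays κ us i (R′.tick x (κ , us))) → Constant M κ us i
        still-constant {i} stays =
          potential M (κ , us) i , (λ x → same (R′.tick x (κ , us)) (stays x)) ,
          value-mono M (virtual us (copy κ i)) (length us) (untilReset (control κ) i)
          where
          same : ∀ p → Stays κ us i p → potential M p i ≡ potential M (κ , us) i
          same (κ′ , _) (refl , eq , eq′ , _) rewrite eq | eq′ = refl

        received-constant : ∀ {i u us₁} → us ≡ u ∷ us₁ → (∀ x → Receives κ u us₁ i (R′.tick x (κ , us))) →
                            Constant M κ us i
        received-constant {i} {u} {us₁} refl receives =
          potential M (κ , us) i , (λ x → same (R′.tick x (κ , us)) (receives x)) ,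
          value-mono M (virtual us (copy κ i)) (length us) (untilReset (control κ) i)
          where
          same : ∀ p → Receives κ u us₁ i p → potential M p i ≡ potential M (κ , us) i
          same (κ′ , _) (refl , eq , eq′ , _) rewrite eq | eq′ | ++-assoc (proj₂ (copy κ i)) (u ∷ []) us₁ = refl

        renewed-constant : ∀ {i} → untilReset (control κ) i ≡ 0 → (∀ x → Renews κ us i (R′.tick x (κ , us))) →
                           Constant M κ us i
        renewed-constant {i} due renews =
          value M (A.construct (current κ) , us) (length us) (L + L) , (λ x → same (R′.tick x (κ , us)) (renews x)) , drop
          where
          same : ∀ p → Renews κ us i p → potential M p i ≡ value M (A.construct (current κ) , us) (length us) (L + L)
          same (κ′ , _) (refl , eq , eq′) rewrite eq | eq′ = refl
          rearrange : ∀ b a c z → b * (a * c * z) ≡ a * (b * c) * z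
          rearrange = solve-∀
          open ≤-Reasoning
          drop : b * value M (A.construct (current κ) , us) (length us) (L + L) ≤ potential (suc M) (κ , us) i
          drop = begin
            b * value M (A.construct (current κ) , us) (length us) (L + L)
              ≤⟨ *-monoʳ-≤ b (value-restart M (current κ) us bounded us≤n₀) ⟩
            b * (a * b ^ M * ∑ (upTo n₀) (later (length us) 0))
              ≡⟨ rearrange b a (b ^ M) _ ⟩
            a * b ^ suc M * ∑ (upTo n₀) (later (length us) 0)
              ≤⟨ m≤n+m _ (W.totalWork (window (length us) 0) (suc M) (virtual us (copy κ i))) ⟩
            value (suc M) (virtual us (copy κ i)) (length us) 0
              ≡⟨ cong (value (suc M) (virtual us (copy κ i)) (length us)) due ⟨
            potential (suc M) (κ , us) i ∎

        potential-constant : ∀ i → act (control κ) ≢ run i → Constant M κ us i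
        potential-constant i idle with effect κ us i
        ... | still _ stays = still-constant stays
        ... | received _ receives = received-constant refl receives
        ... | renewed due renews = renewed-constant due renews
        ... | ticked runs _ _ = contradiction runs idle

        constant-step : ∀ i → Constant M κ us i →
          ∑ (allFin b) (λ x → potential M (R′.tick x (κ , us)) i) + b ^ suc M * 0 ≤ potential (suc M) (κ , us) i
        constant-step i (c , same , drop) = begin
          ∑ (allFin b) (λ x → potential M (R′.tick x (κ , us)) i) + b ^ suc M * 0
            ≡⟨ cong₂ _+_ (trans (∑-cong (allFin b) same) (∑-allFin-const b c)) (*-zeroʳ (b ^ suc M)) ⟩
          b * c + 0                      ≡⟨ +-identityʳ (b * c) ⟩
          b * c                          ≤⟨ drop ⟩
          potential (suc M) (κ , us) i   ∎
          where open ≤-Reasoning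

        -- The supermartingale inequality. If copy `i` ticks, it is an equality: having a backlog,
        -- the copy does the same tick with the future updates appended, and conditioning on the
        -- symbol splits off the work of this unit.
        potential-step : ∀ i →
          ∑ (allFin b) (λ x → potential M (R′.tick x (κ , us)) i) + b ^ suc M * gain κ us i ≤ potential (suc M) (κ , us) i
        potential-step i with effect κ us i
        ... | still _ stays = constant-step i (still-constant stays)
        ... | received _ receives = constant-step i (received-constant refl receives)
        ... | renewed due renews = constant-step i (renewed-constant due renews)
        ... | ticked _ behind runs = begin
          ∑ (allFin b) (λ x → potential M (R′.tick x (κ , us)) i) + b ^ suc M * G
            ≡⟨ cong (_+ b ^ suc M * G) (trans (∑-cong (allFin b) same) (∑-+ (allFin b) _ _)) ⟩
          ∑ (allFin b) (λ x → W.totalWork v M (R.tick x p)) + ∑ (allFin b) (λ _ → a * b ^ M * Z) + b ^ suc M * G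
            ≡⟨ cong (λ y → ∑ (allFin b) (λ x → W.totalWork v M (R.tick x p)) + y + b ^ suc M * G)
                 (∑-allFin-const b (a * b ^ M * Z)) ⟩
          ∑ (allFin b) (λ x → W.totalWork v M (R.tick x p)) + b * (a * b ^ M * Z) + b ^ suc M * G
            ≡⟨ rearrange _ b a (b ^ M) Z (b ^ suc M * G) ⟩
          (b ^ suc M * G + ∑ (allFin b) (λ x → W.totalWork v M (R.tick x p))) + a * (b * b ^ M) * Z
            ≡⟨ cong (_+ a * (b * b ^ M) * Z) (W.totalWork-suc v M p) ⟨
          potential (suc M) (κ , us) i ∎
          where
          open ≤-Reasoning
          d = length us
          ρ = untilReset (control κ) i
          v = window d ρ
          p = virtual us (copy κ i)
          G = W.served v p
          Z = ∑ (upTo n₀) (later d ρ)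
          same : ∀ x → potential M (R′.tick x (κ , us)) i ≡ W.totalWork v M (R.tick x p) + a * b ^ M * Z
          same x = at (R′.tick x (κ , us)) (runs x)
            where
            at : ∀ p′ → Ticks κ us i x p′ → potential M p′ i ≡ W.totalWork v M (R.tick x p) + a * b ^ M * Z
            at (κ′ , _) (refl , eq , eq′ , _)
              rewrite eq | eq′ | W.tick-++ x (proj₁ (copy κ i)) (proj₂ (copy κ i)) us behind = refl
          rearrange : ∀ s b a c z g → s + b * (a * c * z) + g ≡ (g + s) + a * (b * c) * z
          rearrange = solve-∀

  -- The tail of the update time

  open Algebra.Properties.CommutativeMonoid.Sum *-1-commutativeMonoid
    using () renaming (sum to ∏; sum-remove to ∏-remove; sum-cong-≗ to ∏-cong)

  ∏-mono : ∀ {n} {f g : Fin n → ℕ} → (∀ i → f i ≤ g i) → ∏ f ≤ ∏ g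
  ∏-mono {zero}  f≤g = ≤-refl
  ∏-mono {suc n} f≤g = *-mono-≤ (f≤g zero) (∏-mono (f≤g ∘ suc))

  ∏-*ˡ : ∀ c {n} (f : Fin n → ℕ) → ∏ (λ i → c * f i) ≡ c ^ n * ∏ f
  ∏-*ˡ c {zero}  f = refl
  ∏-*ˡ c {suc n} f = trans (cong (c * f zero *_) (∏-*ˡ c (f ∘ suc))) (rearrange c (f zero) (c ^ n) _)
    where
    rearrange : ∀ c f d p → c * f * (d * p) ≡ c * d * (f * p)
    rearrange = solve-∀

  -- Only the factor j may depend on x, so the sum over x goes to this factor.
  ∏-focus : ∀ b {m} (j : Fin (suc m)) (f : Fin (suc m) → ℕ) (g : Fin b → Fin (suc m) → ℕ) →
            (∀ i → i ≢ j → ∃[ c ] (∀ x → g x i ≡ c) × b * c ≤ f i) →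
            ∑ (allFin b) (λ x → g x j) ≤ f j →
            b ^ m * ∑ (allFin b) (λ x → ∏ (g x)) ≤ ∏ f
  ∏-focus b {m} j f g others focus = begin
    b ^ m * ∑ (allFin b) (λ x → ∏ (g x))
      ≡⟨ cong (b ^ m *_) (∑-cong (allFin b) (λ x → trans (∏-remove {i = j} (g x))
           (cong (g x j *_) (∏-cong (λ i → proj₁ (proj₂ (rest i)) x))))) ⟩
    b ^ m * ∑ (allFin b) (λ x → g x j * ∏ c)
      ≡⟨ cong (b ^ m *_) (∑-*ʳ (allFin b) (∏ c) (λ x → g x j)) ⟩
    b ^ m * (∑ (allFin b) (λ x → g x j) * ∏ c)
      ≡⟨ rearrange (b ^ m) (∑ (allFin b) (λ x → g x j)) (∏ c) ⟩
    ∑ (allFin b) (λ x → g x j) * (b ^ m * ∏ c)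
      ≡⟨ cong (∑ (allFin b) (λ x → g x j) *_) (∏-*ˡ b c) ⟨
    ∑ (allFin b) (λ x → g x j) * ∏ (λ i → b * c i)
      ≤⟨ *-mono-≤ focus (∏-mono (λ i → proj₂ (proj₂ (rest i)))) ⟩
    f j * ∏ (λ i → f (punchIn j i))
      ≡⟨ ∏-remove {i = j} f ⟨
    ∏ f ∎
    where
    open ≤-Reasoning
    rest : ∀ i → ∃[ c ] (∀ x → g x (punchIn j i) ≡ c) × b * c ≤ f (punchIn j i)
    rest i = others (punchIn j i) (punchInᵢ≢i j i)
    c : Fin m → ℕ
    c i = proj₁ (rest i)
    rearrange : ∀ p s q → p * (s * q) ≡ s * (p * q)
    rearrange = solve-∀

  -- Up to a factor 2, dyadic D e is 2 ^ D / e for 1 ≤ e ≤ 2 ^ D.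
  dyadic : ℕ → ℕ → ℕ
  dyadic zero    e = indicator (e ≤ᵇ 1)
  dyadic (suc D) e = 2 * dyadic D e + indicator (e ≤ᵇ 2 ^ suc D)

  indicator-≤ᵇ-anti : ∀ {e e′} m → e ≤ e′ → indicator (e′ ≤ᵇ m) ≤ indicator (e ≤ᵇ m)
  indicator-≤ᵇ-anti {e} {e′} m e≤e′ with e′ ≤ᵇ m in eq
  ... | false = z≤n
  ... | true rewrite ≤⇒≤ᵇ≡true {e} {m} (≤-trans e≤e′ (≤ᵇ⇒≤ e′ m (subst Bool.T (sym eq) _))) = ≤-refl

  dyadic-anti : ∀ D {e e′} → e ≤ e′ → dyadic D e′ ≤ dyadic D e
  dyadic-anti zero    e≤e′ = indicator-≤ᵇ-anti 1 e≤e′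
  dyadic-anti (suc D) e≤e′ = +-mono-≤ (*-monoʳ-≤ 2 (dyadic-anti D e≤e′)) (indicator-≤ᵇ-anti (2 ^ suc D) e≤e′)

  -- By scales: up to `2 ^ D` the doubled weight suffices; beyond it the new indicator does so
  -- alone, because `e` exceeds half of the new power.
  dyadic-lower : ∀ D e → 1 ≤ e → e ≤ 2 ^ D → 2 ^ D ≤ 2 * (e * dyadic D e)
  dyadic-lower zero    (suc zero) _ _ = s≤s z≤n
  dyadic-lower zero    (suc (suc _)) _ (s≤s ())
  dyadic-lower (suc D) e 1≤e e≤ with e ≤? 2 ^ D
  ... | yes e≤2^D = begin
    2 * 2 ^ D                                   ≤⟨ *-monoʳ-≤ 2 (dyadic-lower D e 1≤e e≤2^D) ⟩
    2 * (2 * (e * dyadic D e))                  ≡⟨ cong (2 *_) (rearrange e (dyadic D e)) ⟩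
    2 * (e * (2 * dyadic D e))                  ≤⟨ *-monoʳ-≤ 2 (*-monoʳ-≤ e (m≤m+n (2 * dyadic D e) _)) ⟩
    2 * (e * dyadic (suc D) e)                  ∎
    where
    open ≤-Reasoning
    rearrange : ∀ e y → 2 * (e * y) ≡ e * (2 * y)
    rearrange = solve-∀
  ... | no  e≰2^D rewrite ≤⇒≤ᵇ≡true {e} {2 ^ suc D} e≤ = begin
    2 * 2 ^ D                       ≤⟨ *-monoʳ-≤ 2 (<⇒≤ (≰⇒> e≰2^D)) ⟩
    2 * e                           ≡⟨ cong (2 *_) (*-identityʳ e) ⟨
    2 * (e * 1)                     ≤⟨ *-monoʳ-≤ 2 (*-monoʳ-≤ e (m≤n+m 1 (2 * dyadic D e))) ⟩
    2 * (e * (2 * dyadic D e + 1))  ∎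
    where open ≤-Reasoning

  ∑-indicator : ∀ n m → ∑ (upTo n) (λ k → indicator (suc k ≤ᵇ m)) ≤ m
  ∑-indicator zero    m = z≤n
  ∑-indicator (suc n) zero = ≤-reflexive (∑-zero (upTo (suc n)) (λ _ → refl))
  ∑-indicator (suc n) (suc m) rewrite ∑-upTo-suc n (λ k → indicator (suc k ≤ᵇ suc m)) = s≤s (∑-indicator n m)

  -- A harmonic sum: on the scale `2 ^ j` the weight is `2 ^ (D - j)` at no more than `2 ^ j`
  -- positions, so each of the `suc D` scales contributes at most `2 ^ D`.
  dyadic-sum : ∀ D n → ∑ (upTo n) (λ k → dyadic D (suc k)) ≤ suc D * 2 ^ D
  dyadic-sum zero    n = ∑-indicator n 1
  dyadic-sum (suc D) n = begin
    ∑ (upTo n) (λ k → 2 * dyadic D (suc k) + indicator (suc k ≤ᵇ 2 ^ suc D))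
      ≡⟨ ∑-+ (upTo n) _ _ ⟩
    ∑ (upTo n) (λ k → 2 * dyadic D (suc k)) + ∑ (upTo n) (λ k → indicator (suc k ≤ᵇ 2 ^ suc D))
      ≤⟨ +-mono-≤ (≤-trans (≤-reflexive (∑-*ˡ (upTo n) 2 _)) (*-monoʳ-≤ 2 (dyadic-sum D n))) (∑-indicator n _) ⟩
    2 * (suc D * 2 ^ D) + 2 * 2 ^ D
      ≡⟨ rearrange D (2 ^ D) ⟩
    suc (suc D) * (2 * 2 ^ D) ∎
    where
    open ≤-Reasoning
    rearrange : ∀ D p → 2 * ((1 + D) * p) + 2 * p ≡ (2 + D) * (2 * p)
    rearrange = solve-∀

  -- Backlogs, deadlines and the probability of being late

  module Punctuality {P : Problem} (A : Algorithm P) {Q′ : ℕ} (side : Fin (suc Q′) → Bool) (r L′ : ℕ)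
    (N a T D : ℕ)
    (T≤L : T ≤ suc L′)
    (2L≤2^D : suc L′ + suc L′ ≤ 2 ^ D)
    (constructs : ∀ S → size S ≤ N → Run.ConstructedWithin A T S)
    (fast : ∀ S us → Problem.Bounded P N S us → ∀ us₁ u us₂ → us ≡ us₁ ++ u ∷ us₂ → ∀ M →
       ∑ (sequences (Algorithm.symbols A) M) (Run.time A (length us₂) (Algorithm.construct A S , us))
         ≤ a * Algorithm.symbols A ^ M)
    (n₀ : ℕ)
    where

    private
      β : ℕ
      β = 2 * r

    open Problem P
    open Analysis A side (2 * r) L′

    -- Indices count from 0 and positions from 1, whence `suc k`. The cut at `n₀`, the number of all
    -- updates, gives weight 0 to the initial construction.
    w : ℕ → ℕ
    w k = if k <ᵇ n₀ then dyadic D (suc k) else 0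

    w-inside : ∀ {k} → k < n₀ → w k ≡ dyadic D (suc k)
    w-inside k<n₀ rewrite <⇒<ᵇ≡true k<n₀ = refl

    open Potential N a n₀ w fast

    private
      b = A.symbols

    -- When the copy was last up to date or reset, e updates were yet to arrive.
    -- Since then it has always had work to do, and n time units have been spent
    -- on it; at most σ of them, and h more to come, belong to the construction.
    record Busy (us : List Update) (p : R.Process) (ρ acc owe : ℕ) : Set where
      field
        e h σ n : ℕ
        d≤e     : length us ≤ e
        e≤n₀    : e ≤ n₀
        recent  : e + ρ ≤ length us + (L + L)
        slack   : σ ≡ 0 ⊎ (σ ≤ L × length us + (L + L) ≤ e + ρ)
        h≤σ     : h ≤ σ
        stage   : (length (proj₂ p ++ us) < e × h ≡ 0) ⊎ (length (proj₂ p ++ us) ≡ e × W.Ready h (proj₁ p))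
        worked  : dyadic D e * (n + h) ≤ acc + dyadic D e * σ
        paid    : suc β * e ≤ n + owe + suc β * length us

    -- Being up to date erases the past: the backlog is dated anew, no time has been spent since,
    -- and whatever is in `acc` is more than enough.
    busy-fresh : ∀ {us p ρ acc owe} → R.caughtUp p ≡ true → length us ≤ n₀ → ρ ≤ L + L → Busy us p ρ acc owe
    busy-fresh {us} {p} {ρ} {acc} {owe} up d≤n₀ ρ≤2L with W.caughtUp⁻ p up
    ... | i , refl = record
      { e = length us ; h = 0 ; σ = 0 ; n = 0
      ; d≤e = ≤-refl ; e≤n₀ = d≤n₀ ; recent = +-monoʳ-≤ (length us) ρ≤2L
      ; slack = inj₁ refl ; h≤σ = z≤n ; stage = inj₂ (refl , λ { [] → i })
      ; worked = m≤n+m _ acc ; paid = m≤n+m _ owe }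

    busy-renewed : ∀ {us S acc owe} → size S ≤ N → length us ≤ n₀ → Busy us (A.construct S , []) (L + L) acc owe
    busy-renewed {us} {S} {acc} {owe} small d≤n₀ = record
      { e = length us ; h = T ; σ = T ; n = 0
      ; d≤e = ≤-refl ; e≤n₀ = d≤n₀ ; recent = ≤-refl
      ; slack = inj₂ (T≤L , ≤-refl) ; h≤σ = ≤-refl ; stage = inj₂ (refl , constructs S small)
      ; worked = m≤n+m _ acc ; paid = m≤n+m _ owe }

    busy-owe : ∀ {us p ρ acc owe owe′} → owe ≤ owe′ → Busy us p ρ acc owe → Busy us p ρ acc owe′
    busy-owe owe≤ B = record
      { Busy B
      ; paid = ≤-trans (Busy.paid B) (+-monoˡ-≤ _ (+-monoʳ-≤ (Busy.n B) owe≤)) }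

    -- An update arrives only after the previous round is over and nothing is owed any more. The
    -- `suc β` units granted now balance the decrease in the number of updates yet to arrive.
    busy-received : ∀ {u us p ρ acc} → Busy (u ∷ us) p (suc ρ) acc 0 → Busy us (enqueue u p) ρ acc (suc β)
    busy-received {u} {us} {s , q} {ρ} {acc} B = record
      { e = e ; h = h ; σ = σ ; n = n
      ; d≤e = ≤-trans (n≤1+n _) d≤e ; e≤n₀ = e≤n₀
      ; recent = s≤s⁻¹ (subst (_≤ suc (length us + (L + L))) (+-suc e ρ) recent)
      ; slack = slack′ slack ; h≤σ = h≤σ
      ; stage = subst (λ q → (length q < e × h ≡ 0) ⊎ (length q ≡ e × W.Ready h s)) (sym (++-assoc q (u ∷ []) us)) stage
      ; worked = worked
      ; paid = ≤-trans paid (≤-reflexive (rearrange n β (length us))) }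
      where
      open Busy B
      slack′ : σ ≡ 0 ⊎ (σ ≤ L × suc (length us) + (L + L) ≤ e + suc ρ) → σ ≡ 0 ⊎ (σ ≤ L × length us + (L + L) ≤ e + ρ)
      slack′ (inj₁ eq) = inj₁ eq
      slack′ (inj₂ (σ≤L , le)) = inj₂ (σ≤L , s≤s⁻¹ (subst (suc (length us + (L + L)) ≤_) (+-suc e ρ) le))
      rearrange : ∀ n β d → n + 0 + (1 + β) * (1 + d) ≡ n + (1 + β) + (1 + β) * d
      rearrange = solve-∀

    -- A unit of construction leaves `n + h` unchanged. Any other unit serves an update that comes
    -- after the origin of the backlog; it lies in the window by `recent`, and its weight is at
    -- least `dyadic D e` since the weights decrease in the distance from the end.
    busy-ticked : ∀ {us p ρ acc owe owe′} x → R.caughtUp p ≡ false → owe ≤ suc owe′ → Busy us p ρ acc owe →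
      Busy us (R.tick x p) ρ (acc + W.served (window (length us) ρ) (virtual us p)) owe′
    busy-ticked {us} {s , q} {ρ} {acc} {owe} {owe′} x behind owe≤ B = cases (A.idle s) refl
      where
      open Busy B
      dy = dyadic D e

      paid′ : suc β * e ≤ suc n + owe′ + suc β * length us
      paid′ = ≤-trans paid (+-monoˡ-≤ _ (≤-trans (+-monoʳ-≤ n owe≤) (≤-reflexive (+-suc n owe′))))

      gained : ∀ k → length us ≤ k → k < e → dy ≤ window (length us) ρ k
      gained k d≤k k<e = ≤-trans (dyadic-anti D k<e) (≤-reflexive (sym (trans (window-inside d≤k
        (≤-trans (subst (_≤ e + ρ) (cong suc (+-comm k ρ)) (+-monoˡ-≤ ρ k<e)) recent)) (w-inside (≤-trans k<e e≤n₀)))))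

      worked′ : ∀ {g} → dy ≤ g → dy * (suc n + 0) ≤ acc + g + dy * σ
      worked′ {g} dy≤g = begin
        dy * (suc n + 0)      ≡⟨ rearrange dy n ⟩
        dy * n + dy           ≤⟨ +-mono-≤ (*-monoʳ-≤ dy (m≤m+n n h)) dy≤g ⟩
        dy * (n + h) + g      ≤⟨ +-monoˡ-≤ g worked ⟩
        acc + dy * σ + g      ≡⟨ rearrange′ acc (dy * σ) g ⟩
        acc + g + dy * σ      ∎
        where
        open ≤-Reasoning
        rearrange : ∀ y n → y * (1 + n + 0) ≡ y * n + y
        rearrange = solve-∀
        rearrange′ : ∀ a y g → a + y + g ≡ a + g + y
        rearrange′ = solve-∀

      ticking : ∀ {s′ q′ g} → length (q′ ++ us) < e → dy ≤ g → Busy us (s′ , q′) ρ (acc + g) owe′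
      ticking shorter dy≤g = record
        { e = e ; h = 0 ; σ = σ ; n = suc n ; d≤e = d≤e ; e≤n₀ = e≤n₀ ; recent = recent ; slack = slack
        ; h≤σ = z≤n ; stage = inj₁ (shorter , refl) ; worked = worked′ dy≤g ; paid = paid′ }

      queued : ∀ q → length us ≤ length (q ++ us)
      queued q = ≤-trans (m≤n+m (length us) (length q)) (≤-reflexive (sym (length-++ q)))

      length≤e : length (q ++ us) ≤ e
      length≤e with stage
      ... | inj₁ (lt , _) = <⇒≤ lt
      ... | inj₂ (eq , _) = ≤-reflexive eq

      Goal : R.Process → ℕ → Set
      Goal p g = Busy us p ρ (acc + g) owe′

      cases : ∀ i → A.idle s ≡ i → Goal (R.tick x (s , q)) (W.served (window (length us) ρ) (s , q ++ us))
      cases false eq =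
        subst₂ Goal (sym (W.tick-busy x eq)) (sym (W.served-busy (window (length us) ρ) eq)) (go stage)
        where
        go : (length (q ++ us) < e × h ≡ 0) ⊎ (length (q ++ us) ≡ e × W.Ready h s) →
             Goal (A.step x s , q) (window (length us) ρ (length (q ++ us)))
        go (inj₁ (lt , _)) = ticking lt (gained _ (queued q) lt)
        go (inj₂ (eq′ , ready)) = building h refl ready
          where
          building : ∀ h′ → h ≡ h′ → W.Ready h′ s → Goal (A.step x s , q) (window (length us) ρ (length (q ++ us)))
          building zero    _    ready = contradiction (trans (sym eq) (ready [])) λ ()
          building (suc h′) refl ready = record
            { e = e ; h = h′ ; σ = σ ; n = suc n ; d≤e = d≤e ; e≤n₀ = e≤n₀ ; recent = recent ; slack = slack
            ; h≤σ = ≤-trans (n≤1+n h′) h≤σ ; stage = inj₂ (eq′ , W.Ready-step x eq ready)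
            ; worked = ≤-trans (≤-reflexive (cong (dy *_) (sym (+-suc n h′))))
                         (≤-trans worked (+-monoˡ-≤ (dy * σ) (m≤m+n acc _)))
            ; paid = paid′ }
      cases true eq = go q refl
        where
        go : ∀ q′ → q ≡ q′ → Goal (R.tick x (s , q′)) (W.served (window (length us) ρ) (s , q′ ++ us))
        go []       refl = contradiction (trans (sym eq) behind) λ ()
        go (u ∷ q′) refl = subst₂ Goal (sym (W.tick-idle x eq)) (sym (W.served-idle (window (length us) ρ) eq))
          (ticking length≤e (gained _ (queued q′) length≤e))

    -- The backlog of a steady copy goes back to a time when it was up to date,
    -- or to its reset, which was at least L ≥ T updates ago.
    busy-behind : ∀ {p ρ acc} → Busy [] p ρ acc 0 → R.caughtUp p ≡ false → ρ ≤ L → r * 2 ^ D ≤ acc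
    busy-behind {s , q} {ρ} {acc} B behind ρ≤L = begin
      r * 2 ^ D                ≤⟨ *-monoʳ-≤ r (dyadic-lower D e (1≤e e refl) e≤2^D) ⟩
      r * (2 * (e * dy))       ≡⟨ rearrange r e dy ⟩
      dy * (β * e)             ≤⟨ +-cancelʳ-≤ (dy * e) _ _ enough ⟩
      acc                      ∎
      where
      open Busy B
      open ≤-Reasoning
      dy = dyadic D e
      rearrange : ∀ r e y → r * (2 * (e * y)) ≡ y * (2 * r * e)
      rearrange = solve-∀
      e≤2^D : e ≤ 2 ^ D
      e≤2^D = ≤-trans (≤-trans (m≤m+n e ρ) recent) 2L≤2^D
      L≤e : L + L ≤ e + ρ → L ≤ e
      L≤e le = +-cancelʳ-≤ L L e (≤-trans le (+-monoʳ-≤ e ρ≤L))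
      σ≤e : σ ≤ e
      σ≤e with slack
      ... | inj₁ refl         = z≤n
      ... | inj₂ (σ≤L , long) = ≤-trans σ≤L (L≤e long)
      1≤e : ∀ e′ → e ≡ e′ → 1 ≤ e′
      1≤e (suc _) _ = s≤s z≤n
      -- With `e` = 0 the backlog would date from after the last arrival. A reset cannot be the
      -- origin, as it lies at least `L` updates back; and a copy that was up to date then would be
      -- so still.
      1≤e zero eq = contradiction (trans (sym behind) up) λ ()
        where
        noslack : σ ≡ 0
        noslack with slack
        ... | inj₁ σ≡0        = σ≡0
        ... | inj₂ (_ , long) = contradiction (≤-trans (L≤e long) (≤-reflexive eq)) λ ()
        up : R.caughtUp (s , q) ≡ true
        up with stage
        ... | inj₁ (lt , _) = contradiction (≤-trans lt (≤-reflexive eq)) λ ()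
        ... | inj₂ (eq′ , ready) = go q h (trans eq′ eq) ready (n≤0⇒n≡0 (≤-trans h≤σ (≤-reflexive noslack)))
          where
          go : ∀ q h → length (q ++ []) ≡ 0 → W.Ready h s → h ≡ 0 → R.caughtUp (s , q) ≡ true
          go [] h _ ready refl = ready []
      -- Of the `suc β` units granted per update, one pays for the construction, which takes at most
      -- `e` of them; the other `β` must have gone to weighted work.
      enough : dy * (β * e) + dy * e ≤ acc + dy * e
      enough = begin
        dy * (β * e) + dy * e  ≡⟨ rearrange′ dy β e ⟩
        dy * (suc β * e)       ≤⟨ *-monoʳ-≤ dy paid ⟩
        dy * (n + 0 + suc β * 0) ≡⟨ cong (dy *_) (rearrange″ n β) ⟩
        dy * n                 ≤⟨ *-monoʳ-≤ dy (m≤m+n n h) ⟩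
        dy * (n + h)           ≤⟨ worked ⟩
        acc + dy * σ           ≤⟨ +-monoʳ-≤ acc (*-monoʳ-≤ dy σ≤e) ⟩
        acc + dy * e           ∎
        where
        rearrange′ : ∀ y β e → y * (β * e) + y * e ≡ y * ((1 + β) * e)
        rearrange′ = solve-∀
        rearrange″ : ∀ n β → n + 0 + (1 + β) * 0 ≡ n
        rearrange″ = solve-∀

    BusyCopy : R′.Process → ℕ → Fin Q → Set
    BusyCopy (κ , us) acc i = Busy us (copy κ i) (untilReset (control κ) i) acc (owed (phase κ) i)

    busy-cast : ∀ {us us′ p p′ ρ ρ′ acc acc′ owe} → us′ ≡ us → p′ ≡ p → ρ′ ≡ ρ → acc′ ≡ acc →
                Busy us p ρ acc owe → Busy us′ p′ ρ′ acc′ owe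
    busy-cast refl refl refl refl B = B

    busy-effect : ∀ κ us x i {acc} (E : Effect κ us i) → Bounded N (current κ) us → length us ≤ n₀ →
                  BusyCopy (κ , us) acc i → BusyCopy (R′.tick x (κ , us)) (acc + gainOf E) i
    busy-effect κ us x i {acc} (still _ stays) bounded d≤n₀ B = stay (stays x)
      where
      stay : Stays κ us i (R′.tick x (κ , us)) → BusyCopy (R′.tick x (κ , us)) (acc + 0) i
      stay (eq , eq′ , eq″ , inj₁ owe≤) = busy-cast eq eq′ eq″ (+-identityʳ acc) (busy-owe owe≤ B)
      stay (eq , eq′ , eq″ , inj₂ up) =
        busy-cast eq eq′ eq″ refl (busy-fresh up d≤n₀ (untilReset≤2L (control κ) i))
    busy-effect κ (u ∷ us) x i {acc} (received _ arrives) bounded d≤n₀ B =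
      let (eq , eq′ , eq″ , eq‴ , eq⁗) = arrives x in
      subst (Busy _ _ _ _) (sym eq⁗) (busy-cast eq eq′ refl (+-identityʳ acc)
        (busy-received (subst₂ (λ ρ owe → Busy (u ∷ us) (copy κ i) ρ acc owe) eq″ eq‴ B)))
    busy-effect κ us x i {acc} (renewed _ renews) bounded d≤n₀ B =
      let (eq , eq′ , eq″) = renews x in
      busy-cast eq eq′ eq″ refl (busy-renewed (bounded⇒small {P} _ us bounded) d≤n₀)
    busy-effect κ us x i {acc} (ticked _ behind runs) bounded d≤n₀ B = running (runs x)
      where
      running : Ticks κ us i x (R′.tick x (κ , us)) →
                BusyCopy (R′.tick x (κ , us))
                  (acc + W.served (window (length us) (untilReset (control κ) i)) (virtual us (copy κ i))) i
      running (eq , eq′ , eq″ , inj₁ owe≤) = busy-cast eq eq′ eq″ refl (busy-ticked x behind owe≤ B)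
      running (eq , eq′ , eq″ , inj₂ up) =
        busy-cast eq refl refl refl (busy-fresh up d≤n₀ (untilReset≤2L (control (proj₁ (R′.tick x (κ , us)))) i))

    busy-step : ∀ κ us x i {acc} → Bounded N (current κ) us → length us ≤ n₀ →
                BusyCopy (κ , us) acc i → BusyCopy (R′.tick x (κ , us)) (acc + gain κ us i) i
    busy-step κ us x i = busy-effect κ us x i (effect κ us i)

    slot : ℕ
    slot = suc (suc β)

    remaining : Phase Q β → ℕ
    remaining (opening i)   = toℕ i * slot + slot + Q
    remaining (serving i s) = toℕ i * slot + suc (toℕ s) + Q
    remaining (seeking i)   = suc (toℕ i)
    remaining _             = 0

    -- One unit begins the update and `Q` pay the toll; the rest are the slots of all copies and the
    -- search. Time in `finishing` is what counts as late.
    deadline : ℕ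
    deadline = suc (Q + remaining (opening top))

    remaining-nextSlot : ∀ i → remaining (nextSlot i) ≡ toℕ i * slot + Q
    remaining-nextSlot zero    = cong suc (toℕ-fromℕ Q′)
    remaining-nextSlot (suc i) rewrite toℕ-inject₁ i = cong (_+ Q) (+-comm (toℕ i * slot) slot)

    remaining-slot : ∀ i o s → remaining (nextPhase (serving i s) o) < remaining (serving i s)
    remaining-slot i true s rewrite remaining-nextSlot i =
      +-monoˡ-< Q (m<m+n (toℕ i * slot) (s≤s z≤n))
    remaining-slot i false zero rewrite remaining-nextSlot i =
      +-monoˡ-< Q (m<m+n (toℕ i * slot) (s≤s z≤n))
    remaining-slot i false (suc s) rewrite toℕ-inject₁ s =
      +-monoˡ-< Q (+-monoʳ-< (toℕ i * slot) ≤-refl)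

    remaining-opening : ∀ i o → remaining (nextPhase (opening i) o) < remaining (opening i)
    remaining-opening i true rewrite remaining-nextSlot i =
      +-monoˡ-< Q (m<m+n (toℕ i * slot) (s≤s z≤n))
    remaining-opening i false rewrite toℕ-fromℕ β =
      +-monoˡ-< Q (+-monoʳ-< (toℕ i * slot) ≤-refl)

    clockAfter : ℕ → Clock → Clock
    clockAfter zero    clock = clock
    clockAfter (suc d) clock = clockAfter d (tickClock clock)

    -- `G` is to be the side that is steady after the last arrival. The clock does not depend on the
    -- symbols, so `G` is known from the start and the product ranges over a fixed set of copies.
    module Late (G : Bool) where

      Slow : (Fin Q → ℕ) → Set
      Slow acc = ∀ i → side i ≡ G → r * 2 ^ D ≤ acc i

      -- Here d updates are yet to arrive, and τ time units have gone to the last one.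
      Timing : Phase Q β → ℕ → ℕ → (Fin Q → ℕ) → ℕ → Set
      Timing ph            (suc d) tl acc τ = τ ≡ 0
      Timing (opening i)   zero    tl acc τ = τ + (tl + remaining (opening i)) ≤ deadline
      Timing (serving i s) zero    tl acc τ = τ + (tl + remaining (serving i s)) ≤ deadline
      Timing (seeking i)   zero    tl acc τ = τ + (tl + remaining (seeking i)) ≤ deadline ×
                                              (∀ i′ → toℕ i < toℕ i′ → side i′ ≡ G → r * 2 ^ D ≤ acc i′)
      Timing (finishing i) zero    tl acc τ = Slow acc
      Timing resting       zero    tl acc τ = τ + tl ≤ deadline ⊎ Slow acc

      one-unit : ∀ τ {m m′ n} → m′ < m → τ + m ≤ n → τ + 1 + m′ ≤ n
      one-unit τ m′<m le = ≤-trans (≤-reflexive (+-assoc τ 1 _)) (≤-trans (+-monoʳ-≤ τ m′<m) le)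

      timing-mono : ∀ ph d tl {acc acc′ τ} → (∀ i → acc i ≤ acc′ i) → Timing ph d tl acc τ → Timing ph d tl acc′ τ
      timing-mono ph            (suc d) tl ≤acc timing = timing
      timing-mono (opening i)   zero    tl ≤acc timing = timing
      timing-mono (serving i s) zero    tl ≤acc timing = timing
      timing-mono (seeking i)   zero    tl ≤acc (timing , slow) =
        timing , λ i′ i<i′ e → ≤-trans (slow i′ i<i′ e) (≤acc i′)
      timing-mono (finishing i) zero    tl ≤acc slow = λ i′ e → ≤-trans (slow i′ e) (≤acc i′)
      timing-mono resting       zero    tl ≤acc (inj₁ timing) = inj₁ timing
      timing-mono resting       zero    tl ≤acc (inj₂ slow) = inj₂ λ i′ e → ≤-trans (slow i′ e) (≤acc i′)

      timing-paying : ∀ ph d tl {acc τ} → Timing ph d (suc tl) acc τ → Timing ph d tl acc (τ + indicator (d ≡ᵇ 0))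
      timing-paying ph            (suc d) tl timing          = trans (+-identityʳ _) timing
      timing-paying (opening i)   zero    tl {τ = τ} timing          = one-unit τ ≤-refl timing
      timing-paying (serving i s) zero    tl {τ = τ} timing          = one-unit τ ≤-refl timing
      timing-paying (seeking i)   zero    tl {τ = τ} (timing , slow) = one-unit τ ≤-refl timing , slow
      timing-paying (finishing i) zero    tl slow            = slow
      timing-paying resting       zero    tl {τ = τ} (inj₁ timing)   = inj₁ (one-unit τ ≤-refl timing)
      timing-paying resting       zero    tl (inj₂ slow)     = inj₂ slow

      timing-slot : ∀ i {acc τ} → τ + remaining (nextSlot i) ≤ deadline → Timing (nextSlot i) 0 0 acc τ
      timing-slot zero    timing = timing , λ i′ top<i′ → contradiction top<i′ (above-top i′)
      timing-slot (suc i) timing = timing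

      -- The search passes through all copies. It fails only after every steady copy has been seen
      -- with a backlog, and then the weighted work of each has reached the threshold; so the
      -- deadline can be missed only under `Slow`.
      timing-acting : ∀ ph o d {acc τ} → ph ≢ resting →
        (∀ i → ph ≡ seeking i → o ≡ false → d ≡ 0 → side i ≡ G → r * 2 ^ D ≤ acc i) →
        Timing ph d 0 acc τ → Timing (nextPhase ph o) d 0 acc (τ + indicator (d ≡ᵇ 0))
      timing-acting ph            o     (suc d) busy found timing = trans (+-identityʳ _) timing
      timing-acting (opening i)   true  zero {τ = τ} busy found timing = timing-slot i (one-unit τ (remaining-opening i true) timing)
      timing-acting (opening i)   false zero {τ = τ} busy found timing = one-unit τ (remaining-opening i false) timing
      timing-acting (serving i s) true  zero {τ = τ} busy found timing = timing-slot i (one-unit τ (remaining-slot i true s) timing)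
      timing-acting (serving i zero)    false zero {τ = τ} busy found timing =
        timing-slot i (one-unit τ (remaining-slot i false zero) timing)
      timing-acting (serving i (suc s)) false zero {τ = τ} busy found timing = one-unit τ (remaining-slot i false (suc s)) timing
      timing-acting (seeking i)       true  zero {τ = τ} busy found (timing , slow) = inj₁ (one-unit τ (s≤s z≤n) timing)
      timing-acting (seeking zero)    false zero {τ = τ} busy found (timing , slow) = λ where
        zero    e → found zero refl refl refl e
        (suc i) e → slow (suc i) (s≤s z≤n) e
      timing-acting (seeking (suc j)) false zero {acc} {τ} busy found (timing , slow) =
        one-unit τ (s≤s (s≤s (≤-reflexive (toℕ-inject₁ j)))) timing , above
        where
        above : ∀ i → toℕ (inject₁ j) < toℕ i → side i ≡ G → r * 2 ^ D ≤ acc i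
        above i j<i e with above-inject₁ j i j<i
        ... | inj₁ refl = found (suc j) refl refl refl e
        ... | inj₂ lt   = slow i lt e
      timing-acting (finishing zero)    true  zero {τ = τ} busy found slow = inj₂ slow
      timing-acting (finishing (suc i)) true  zero {τ = τ} busy found slow = slow
      timing-acting (finishing zero)    false zero {τ = τ} busy found slow = slow
      timing-acting (finishing (suc i)) false zero {τ = τ} busy found slow = slow
      timing-acting resting             o     zero busy found timing = contradiction refl busy

      Clocked : R′.Process → (Fin Q → ℕ) → ℕ → Set
      Clocked (κ , us) acc τ = steadySide (clockAfter (length us) (proj₁ (control κ))) ≡ G ×
                               Timing (phase κ) (length us) (toll κ) acc τ

      Loaded : R′.Process → (Fin Q → ℕ) → Set
      Loaded p acc = Fresh (proj₁ p) ⊎ (∀ i → BusyCopy p (acc i) i)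

      cost : Configuration → List Update → ℕ
      cost κ us = indicator (R′.serves 0 (κ , us))

      cost-busy : ∀ κ us → waiting κ ≡ false → cost κ us ≡ indicator (length us ≡ᵇ 0)
      cost-busy κ us busy = cong indicator (W′.serves-busy 0 {κ} {us} busy)

      cost-wait : ∀ κ → toll κ ≡ 0 → act (control κ) ≡ wait → cost κ [] ≡ 0
      cost-wait κ free waits = cong indicator (W′.serves-empty 0 {κ} (waiting-wait κ free waits))

      cost-arrival : ∀ κ u us → toll κ ≡ 0 → act (control κ) ≡ wait → cost κ (u ∷ us) ≡ indicator (length us ≡ᵇ 0)
      cost-arrival κ u us free waits = cong indicator (W′.serves-idle 0 {κ} {u} {us} (waiting-wait κ free waits))

      clocked-acting : ∀ κ us κ′ o {acc τ} → toll κ ≡ 0 → act (control κ) ≢ wait →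
        control κ′ ≡ next (control κ) o → toll κ′ ≡ toll κ →
        (∀ i → phase κ ≡ seeking i → o ≡ false → length us ≡ 0 → side i ≡ G → r * 2 ^ D ≤ acc i) →
        Clocked (κ , us) acc τ → Clocked (κ′ , us) acc (τ + cost κ us)
      clocked-acting κ us κ′ o {acc} {τ} free busy eq eq′ found (steady , timing)
        rewrite cost-busy κ us (waiting-acting κ busy) | eq | eq′ | free | next-acting (control κ) o busy =
        steady , timing-acting (phase κ) o (length us) (λ rests → busy (resting⇒wait (control κ) rests)) found timing

      not-seeking : ∀ c {i} → phaseOf c ≡ seeking i → act c ≡ point i
      not-seeking (clock , seeking i) refl = refl

      clocked-step : ∀ κ us x {acc acc′ τ} → (∀ i → acc i ≤ acc′ i) → Loaded (κ , us) acc →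
        Clocked (κ , us) acc τ → Clocked (R′.tick x (κ , us)) acc′ (τ + cost κ us)
      clocked-step κ us x {acc} {acc′} {τ} ≤acc loaded (steady , timing) =
        cases (toll κ) refl (act (control κ)) refl us loaded steady (timing-mono _ (length us) _ ≤acc timing)
        where
        cases : ∀ t → toll κ ≡ t → ∀ α → act (control κ) ≡ α → ∀ us → Loaded (κ , us) acc →
          steadySide (clockAfter (length us) (proj₁ (control κ))) ≡ G → Timing (phase κ) (length us) (toll κ) acc′ τ →
          Clocked (R′.tick x (κ , us)) acc′ (τ + cost κ us)
        cases (suc t) tolls α acts us loaded steady timing =
          subst₂ (λ p c → Clocked p acc′ (τ + c)) (sym (tick-paying x κ us tolls))
            (sym (cost-busy κ us (waiting-paying κ tolls)))
            (steady , timing-paying (phase κ) (length us) t (subst (λ tl → Timing (phase κ) (length us) tl acc′ τ) tolls timing))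
        cases zero tolls (run j) acts us loaded steady timing =
          subst (λ p → Clocked p acc′ (τ + cost κ us)) (sym (tick-acting x κ us tolls acts λ ()))
            (clocked-acting κ us (perform (run j) x κ) (R.caughtUp (copy (perform (run j) x κ) j)) tolls (λ waits → contradiction (trans (sym acts) waits) λ ()) refl refl
              (λ i seeks → contradiction (trans (sym acts) (not-seeking (control κ) seeks)) λ ()) (steady , timing))
        cases zero tolls (reset j) acts us loaded steady timing =
          subst (λ p → Clocked p acc′ (τ + cost κ us)) (sym (tick-acting x κ us tolls acts λ ()))
            (clocked-acting κ us (perform (reset j) x κ) (R.caughtUp (copy (perform (reset j) x κ) j)) tolls (λ waits → contradiction (trans (sym acts) waits) λ ()) refl refl
              (λ i seeks → contradiction (trans (sym acts) (not-seeking (control κ) seeks)) λ ()) (steady , timing))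
        cases zero tolls (point j) acts us loaded steady timing =
          subst (λ p → Clocked p acc′ (τ + cost κ us)) (sym (tick-acting x κ us tolls acts λ ()))
            (clocked-acting κ us (perform (point j) x κ) (R.caughtUp (copy κ j)) tolls (λ waits → contradiction (trans (sym acts) waits) λ ()) refl refl
              (λ i seeks behind none e → ≤-trans (slow us none i seeks
                (trans (cong (λ i → R.caughtUp (copy κ i)) (point-injective (trans (sym (not-seeking (control κ) seeks)) acts))) behind)
                e loaded steady) (≤acc i)) (steady , timing))
          where
          point-injective : ∀ {i j : Fin Q} → point i ≡ point j → i ≡ j
          point-injective refl = refl
          slow : ∀ us → length us ≡ 0 → ∀ i → phase κ ≡ seeking i → R.caughtUp (copy κ i) ≡ false → side i ≡ G →
                 Loaded (κ , us) acc → steadySide (clockAfter (length us) (proj₁ (control κ))) ≡ G → r * 2 ^ D ≤ acc i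
          slow [] _ i seeks behind e (inj₁ (_ , j , finishes , _)) steady = contradiction (trans (sym seeks) finishes) λ ()
          slow [] _ i seeks behind e (inj₂ busy) steady =
            busy-behind (subst (λ ph → Busy [] (copy κ i) (untilReset (control κ) i) (acc i) (owed ph i)) seeks (busy i)) behind
              (untilReset-steady (proj₁ (control κ)) (phase κ) i (trans e (sym steady)))
        cases zero tolls wait acts [] loaded steady timing =
          subst₂ (λ p c → Clocked p acc′ (τ + c)) (sym (tick-wait x κ tolls acts)) (sym (cost-wait κ tolls acts))
            (steady , subst (Timing (phase κ) 0 (toll κ) acc′) (sym (+-identityʳ τ)) timing)
        cases zero tolls wait acts (u ∷ us) loaded steady timing =
          subst₂ (λ p c → Clocked p acc′ (τ + c)) (sym (tick-arrival x κ u us tolls acts)) (sym (cost-arrival κ u us tolls acts))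
            (arrive (control κ) (proj₂ (wait⇒resting (control κ) acts)) us steady timing)
          where
          arrive : ∀ c {clock} → c ≡ (clock , resting) → ∀ us →
            steadySide (clockAfter (length us) (tickClock (proj₁ c))) ≡ G → τ ≡ 0 →
            steadySide (clockAfter (length us) (proj₁ (next c false))) ≡ G ×
            Timing (phaseOf (next c false)) (length us) Q acc′ (τ + indicator (length us ≡ᵇ 0))
          -- The unit that begins the last update is the outer `suc` of `deadline`; from here on the
          -- bound holds with equality.
          arrive _ refl []       steady refl = steady , ≤-refl
          arrive _ refl (u ∷ us) steady refl = steady , refl

      loaded-fresh : ∀ κ us x {acc} → length us ≤ n₀ → Fresh κ → Loaded (R′.tick x (κ , us)) acc
      loaded-fresh κ us x {acc} d≤n₀ fresh = load (fresh-step κ us x fresh)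
        where
        load : Finishing κ us (R′.tick x (κ , us)) → Loaded (R′.tick x (κ , us)) acc
        load (_ , _ , inj₁ fresh) = inj₁ fresh
        load (eq , _ , inj₂ (_ , _ , up)) = inj₂ λ i →
          busy-fresh (up i) (subst (λ us → length us ≤ n₀) (sym eq) d≤n₀) (untilReset≤2L (control (proj₁ (R′.tick x (κ , us)))) i)

      record Inv (p : R′.Process) (acc : Fin Q → ℕ) (τ : ℕ) : Set where
        field
          bounded : Bounded N (current (proj₁ p)) (proj₂ p)
          d≤n₀    : length (proj₂ p) ≤ n₀
          clocked : Clocked p acc τ
          loaded  : Loaded p acc

      inv-step : ∀ κ us x {acc τ} → Inv (κ , us) acc τ →
                 Inv (R′.tick x (κ , us)) (λ i → acc i + gain κ us i) (τ + cost κ us)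
      inv-step κ us x {acc} {τ} inv = record
        { bounded = bounded-tick κ us x bounded
        ; d≤n₀    = length-tick κ us x d≤n₀
        ; clocked = clocked-step κ us x (λ i → m≤m+n (acc i) _) loaded clocked
        ; loaded  = load loaded }
        where
        open Inv inv
        load : Loaded (κ , us) acc → Loaded (R′.tick x (κ , us)) (λ i → acc i + gain κ us i)
        load (inj₁ fresh) = loaded-fresh κ us x d≤n₀ fresh
        load (inj₂ busy)  = inj₂ λ i → busy-step κ us x i bounded d≤n₀ (busy i)

      private
        steady : Fin Q → Bool
        steady i = does (side i Bool.≟ G)

      -- As W.totalWork does, a factor scales by the number of sequences.
      factor : ℕ → R′.Process → (Fin Q → ℕ) → Fin Q → ℕ
      factor M p acc i = if steady i then acc i * b ^ M + potential M p i else b ^ M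

      threshold : Fin Q → ℕ
      threshold i = if steady i then r * 2 ^ D else 1

      late : ∀ {M} → ℕ → R′.Process → Vec (Fin b) M → ℕ
      late τ p xs = indicator (deadline <ᵇ τ + R′.time 0 p xs)

      late-slow : ∀ {κ us acc τ} → Inv (κ , us) acc τ → deadline < τ → Slow acc
      late-slow {κ} {us} {acc} {τ} inv late = go (phase κ) us (proj₂ (Inv.clocked inv))
        where
        early : ∀ {τ m} → τ + m ≤ deadline → ¬ (deadline < τ)
        early {τ} {m} le lt = <-irrefl refl (≤-trans lt (≤-trans (m≤m+n τ m) le))
        go : ∀ ph us → Timing ph (length us) (toll κ) acc τ → Slow acc
        go ph            (u ∷ us) refl        = contradiction late λ ()
        go (opening i)   []       le          = contradiction late (early le)
        go (serving i s) []       le          = contradiction late (early le)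
        go (seeking i)   []       (le , _)    = contradiction late (early le)
        go (finishing i) []       slow        = slow
        go resting       []       (inj₁ le)   = contradiction late (early le)
        go resting       []       (inj₂ slow) = slow

      -- If no copy is run, all potentials are constant, and any copy may be the one to which the
      -- sum over symbols goes; `zero` is a default.
      focus : Action Q → Fin Q
      focus (run j) = j
      focus _       = zero

      focus-unique : ∀ α i → i ≢ focus α → α ≢ run i
      focus-unique (run j) i i≢j refl = i≢j refl

      gain-idle : ∀ κ us i (E : Effect κ us i) → act (control κ) ≢ run i → gainOf E ≡ 0
      gain-idle κ us i (still _ _)       idle = refl
      gain-idle κ us i (received _ _)    idle = refl
      gain-idle κ us i (renewed _ _)     idle = refl
      gain-idle κ us i (ticked runs _ _) idle = contradiction runs idle

      if-constant : ∀ (g : Bool) {F : Fin b → ℕ} {f B B′} → (∃[ c ] (∀ x → F x ≡ c) × b * c ≤ f) → b * B ≤ B′ →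
                    ∃[ c ] (∀ x → (if g then F x else B) ≡ c) × b * c ≤ (if g then f else B′)
      if-constant true  constant le = constant
      if-constant false constant le = _ , (λ _ → refl) , le

      if-sum : ∀ (g : Bool) {F : Fin b → ℕ} {f B B′} → ∑ (allFin b) F ≤ f → b * B ≤ B′ →
               ∑ (allFin b) (λ x → if g then F x else B) ≤ (if g then f else B′)
      if-sum true  le le′ = le
      if-sum false {B = B} le le′ = ≤-trans (≤-reflexive (∑-allFin-const b B)) le′

      -- The work that the running copy gains moves from its potential into `acc`, so its factor
      -- does not grow on average. The other `Q′` factors do not depend on the symbol, and each is
      -- normalized by one `b`.
      factor-step : ∀ M κ us {acc τ} → Inv (κ , us) acc τ →
        b ^ Q′ * ∑ (allFin b) (λ x → ∏ (factor M (R′.tick x (κ , us)) (λ i → acc i + gain κ us i)))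
          ≤ ∏ (factor (suc M) (κ , us) acc)
      factor-step M κ us {acc} inv = ∏-focus b j (factor (suc M) (κ , us) acc)
        (λ x → factor M (R′.tick x (κ , us)) acc′)
        (λ i i≢j → if-constant (steady i) (others i (focus-unique (act (control κ)) i i≢j)) ≤-refl)
        (if-sum (steady j) focused ≤-refl)
        where
        open Inv inv
        open Step M κ us bounded d≤n₀
        open ≤-Reasoning
        j : Fin Q
        j = focus (act (control κ))
        acc′ : Fin Q → ℕ
        acc′ i = acc i + gain κ us i
        rearrange : ∀ b a c z → b * (a * c + z) ≡ a * (b * c) + b * z
        rearrange = solve-∀
        rearrange′ : ∀ b a g c z → b * ((a + g) * c) + z ≡ a * (b * c) + (z + b * c * g)
        rearrange′ = solve-∀
        others : ∀ i → act (control κ) ≢ run i →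
          ∃[ c ] (∀ x → acc′ i * b ^ M + potential M (R′.tick x (κ , us)) i ≡ c) ×
                 b * c ≤ acc i * b ^ suc M + potential (suc M) (κ , us) i
        others i idle = let (c , same , drop) = potential-constant i idle in
          acc i * b ^ M + c ,
          (λ x → cong₂ (λ g z → g * b ^ M + z)
            (trans (cong (acc i +_) (gain-idle κ us i (effect κ us i) idle)) (+-identityʳ (acc i))) (same x)) ,
          (begin
            b * (acc i * b ^ M + c)            ≡⟨ rearrange b (acc i) (b ^ M) c ⟩
            acc i * b ^ suc M + b * c          ≤⟨ +-monoʳ-≤ (acc i * b ^ suc M) drop ⟩
            acc i * b ^ suc M + potential (suc M) (κ , us) i ∎)
        focused : ∑ (allFin b) (λ x → acc′ j * b ^ M + potential M (R′.tick x (κ , us)) j)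
                    ≤ acc j * b ^ suc M + potential (suc M) (κ , us) j
        focused = begin
          ∑ (allFin b) (λ x → acc′ j * b ^ M + potential M (R′.tick x (κ , us)) j)
            ≡⟨ ∑-+ (allFin b) (λ _ → acc′ j * b ^ M) (λ x → potential M (R′.tick x (κ , us)) j) ⟩
          ∑ (allFin b) (λ _ → acc′ j * b ^ M) + S
            ≡⟨ cong (_+ S) (∑-allFin-const b (acc′ j * b ^ M)) ⟩
          b * (acc′ j * b ^ M) + S
            ≡⟨ rearrange′ b (acc j) (gain κ us j) (b ^ M) S ⟩
          acc j * b ^ suc M + (S + b ^ suc M * gain κ us j)
            ≤⟨ +-monoʳ-≤ (acc j * b ^ suc M) (potential-step j) ⟩
          acc j * b ^ suc M + potential (suc M) (κ , us) j ∎
          where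
          S : ℕ
          S = ∑ (allFin b) (λ x → potential M (R′.tick x (κ , us)) j)

      if-mono : ∀ (g : Bool) {x y x′ y′} → (g ≡ true → x ≤ y) → x′ ≤ y′ → (if g then x else x′) ≤ (if g then y else y′)
      if-mono true  le le′ = le refl
      if-mono false le le′ = le′

      steady⇒side : ∀ i → steady i ≡ true → side i ≡ G
      steady⇒side i eq with side i Bool.≟ G
      ... | yes e = e

      -- Markov's inequality for the product, by induction on the time left. At the end, lateness
      -- forces every factor up to its threshold. The product carries `b ^ M` once for each copy but
      -- the count only once, whence the exponent `Q′`.
      tail-bound : ∀ M κ us {acc τ} → Inv (κ , us) acc τ →
        (b ^ M) ^ Q′ * (∑ (sequences b M) (late τ (κ , us)) * ∏ threshold) ≤ ∏ (factor M (κ , us) acc)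
      tail-bound zero κ us {acc} {τ} inv
        rewrite ^-zeroˡ Q′ | +-identityʳ τ = go (deadline <ᵇ τ) refl
        where
        go : ∀ l → (deadline <ᵇ τ) ≡ l → 1 * ((indicator l + 0) * ∏ threshold) ≤ ∏ (factor zero (κ , us) acc)
        go false _  = z≤n
        go true  eq = begin
          1 * (1 * ∏ threshold)      ≡⟨ trans (*-identityˡ _) (*-identityˡ _) ⟩
          ∏ threshold                ≤⟨ ∏-mono (λ i → if-mono (steady i) {x′ = 1} (above i) ≤-refl) ⟩
          ∏ (factor 0 (κ , us) acc)  ∎
          where
          open ≤-Reasoning
          above : ∀ i → steady i ≡ true → r * 2 ^ D ≤ acc i * 1 + potential 0 (κ , us) i
          above i e = ≤-trans (late-slow {κ} {us} inv (<ᵇ≡true⇒< eq) i (steady⇒side i e))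
            (≤-trans (≤-reflexive (sym (*-identityʳ (acc i)))) (m≤m+n (acc i * 1) _))
      tail-bound (suc M) κ us {acc} {τ} inv = begin
        (b * b ^ M) ^ Q′ * (∑ (sequences b (suc M)) (late τ (κ , us)) * Θ)
          ≡⟨ cong₂ (λ p s → p * (s * Θ)) (^-distribʳ-* Q′ b (b ^ M))
               (trans (∑-sequences b M (late τ (κ , us)))
                 (∑-cong (allFin b) (λ x → ∑-cong (sequences b M) (λ xs →
                   cong (λ t → indicator (deadline <ᵇ t)) (sym (+-assoc τ (cost κ us) _)))))) ⟩
        b ^ Q′ * (b ^ M) ^ Q′ * (∑ (allFin b) count * Θ)
          ≡⟨ rearrange (b ^ Q′) ((b ^ M) ^ Q′) (∑ (allFin b) count) Θ ⟩
        b ^ Q′ * ((b ^ M) ^ Q′ * Θ * ∑ (allFin b) count)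
          ≡⟨ cong (b ^ Q′ *_) (∑-*ˡ (allFin b) ((b ^ M) ^ Q′ * Θ) count) ⟨
        b ^ Q′ * ∑ (allFin b) (λ x → (b ^ M) ^ Q′ * Θ * count x)
          ≤⟨ *-monoʳ-≤ (b ^ Q′) (∑-mono (allFin b) (λ x → ≤-trans (≤-reflexive (rearrange′ ((b ^ M) ^ Q′) Θ (count x)))
               (tail-bound M _ _ (inv-step κ us x inv)))) ⟩
        b ^ Q′ * ∑ (allFin b) (λ x → ∏ (factor M (R′.tick x (κ , us)) (λ i → acc i + gain κ us i)))
          ≤⟨ factor-step M κ us inv ⟩
        ∏ (factor (suc M) (κ , us) acc) ∎
        where
        open ≤-Reasoning
        Θ : ℕ
        Θ = ∏ threshold
        count : Fin b → ℕ
        count x = ∑ (sequences b M) (late (τ + cost κ us) (R′.tick x (κ , us)))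
        rearrange : ∀ p q s t → p * q * (s * t) ≡ p * (q * t * s)
        rearrange = solve-∀
        rearrange′ : ∀ q t s → q * t * s ≡ q * (s * t)
        rearrange′ = solve-∀

    w-vanishes : ∀ k → n₀ ≤ k → w k ≡ 0
    w-vanishes k n₀≤k rewrite ≥⇒<ᵇ≡false n₀≤k = refl

    w-sum : ∑ (upTo n₀) w ≤ suc D * 2 ^ D
    w-sum = ≤-trans (∑-mono (upTo n₀) below) (dyadic-sum D n₀)
      where
      below : ∀ k → w k ≤ dyadic D (suc k)
      below k with k <ᵇ n₀
      ... | true  = ≤-refl
      ... | false = z≤n

    module _ (S : FinSet Element) (u : Update) (us : List Update)
             (bounded : Bounded N S (u ∷ us)) (n₀≡ : length (u ∷ us) ≡ n₀) where

      steadyEnd : Bool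
      steadyEnd = steadySide (clockAfter (length us) (tickClock (proj₁ initialControl)))

      open Late steadyEnd

      inv-start : Inv (initially S , u ∷ us) (λ _ → 0) 0
      inv-start = record
        { bounded = bounded ; d≤n₀ = ≤-reflexive n₀≡ ; clocked = refl , refl
        ; loaded = inj₁ (fresh-start S) }

      late-bound : ∀ M →
        (b ^ M) ^ Q′ * (∑ (sequences b M) (λ xs → indicator (deadline <ᵇ R′.time 0 (initially S , u ∷ us) xs)) *
          ∏ (λ i → if does (side i Bool.≟ steadyEnd) then r * 2 ^ D else 1))
        ≤ ∏ (λ i → if does (side i Bool.≟ steadyEnd) then a * b ^ M * (suc D * 2 ^ D) else b ^ M)
      late-bound M = ≤-trans (tail-bound M (initially S) (u ∷ us) inv-start)
        (∏-mono (λ i → if-mono (does (side i Bool.≟ steadyEnd)) {x′ = b ^ M}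
          (λ _ → ≤-trans (potential-start M S (u ∷ us) i bounded n₀≡ w-vanishes) (*-monoʳ-≤ (a * b ^ M) w-sum)) ≤-refl))

  -- Amortization

  open Algebra.Properties.CommutativeMonoid.Sum +-0-commutativeMonoid
    using (∑-distrib-+) renaming (sum to Σᶠ; sum-cong-≗ to Σᶠ-cong)

  Σᶠ-mono : ∀ {n} {f g : Fin n → ℕ} → (∀ i → f i ≤ g i) → Σᶠ f ≤ Σᶠ g
  Σᶠ-mono {zero}  f≤g = z≤n
  Σᶠ-mono {suc n} f≤g = +-mono-≤ (f≤g zero) (Σᶠ-mono (f≤g ∘ suc))

  Σᶠ-const : ∀ n c → Σᶠ {n} (λ _ → c) ≡ n * c
  Σᶠ-const zero    c = refl
  Σᶠ-const (suc n) c = cong (c +_) (Σᶠ-const n c)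

  Σᶠ-*ˡ : ∀ c {n} (f : Fin n → ℕ) → Σᶠ (λ i → c * f i) ≡ c * Σᶠ f
  Σᶠ-*ˡ c {zero}  f = sym (*-zeroʳ c)
  Σᶠ-*ˡ c {suc n} f = trans (cong (c * f zero +_) (Σᶠ-*ˡ c (f ∘ suc))) (sym (*-distribˡ-+ c (f zero) _))

  Σᶠ-term : ∀ {n} (f : Fin n → ℕ) i → f i ≤ Σᶠ f
  Σᶠ-term f zero    = m≤m+n (f zero) _
  Σᶠ-term f (suc i) = ≤-trans (Σᶠ-term (f ∘ suc) i) (m≤n+m _ (f zero))

  ∑-Σᶠ-swap : ∀ {X : Set} (xs : List X) {n} (f : X → Fin n → ℕ) →
              ∑ xs (λ x → Σᶠ (f x)) ≡ Σᶠ (λ i → ∑ xs (λ x → f x i))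
  ∑-Σᶠ-swap xs {zero}  f = ∑-zero xs (λ _ → refl)
  ∑-Σᶠ-swap xs {suc n} f = trans (∑-+ xs (λ x → f x zero) (λ x → Σᶠ (f x ∘ suc)))
                                   (cong (∑ xs (λ x → f x zero) +_) (∑-Σᶠ-swap xs (λ x → f x ∘ suc)))

  ∑-upTo-mono-< : ∀ n {f g : ℕ → ℕ} → (∀ k → k < n → f k ≤ g k) → ∑ (upTo n) f ≤ ∑ (upTo n) g
  ∑-upTo-mono-< zero    f≤g = z≤n
  ∑-upTo-mono-< (suc n) {f} {g} f≤g rewrite ∑-upTo-suc n f | ∑-upTo-suc n g =
    +-mono-≤ (f≤g 0 (s≤s z≤n)) (∑-upTo-mono-< n (λ k k<n → f≤g (suc k) (s≤s k<n)))

  module Amortization {P : Problem} (A : Algorithm P) {Q′ : ℕ} (side : Fin (suc Q′) → Bool) (β L′ : ℕ)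
    (N a T : ℕ)
    (T<L : T < suc L′)
    (constructs : ∀ S → size S ≤ N → Run.ConstructedWithin A T S)
    (fast : ∀ S us → Problem.Bounded P N S us → ∀ us₁ u us₂ → us ≡ us₁ ++ u ∷ us₂ → ∀ M →
       ∑ (sequences (Algorithm.symbols A) M) (Run.time A (length us₂) (Algorithm.construct A S , us))
         ≤ a * Algorithm.symbols A ^ M)
    (n₀ : ℕ)
    where

    open Problem P
    open Analysis A side β L′

    w : ℕ → ℕ
    w k = indicator (k <ᵇ n₀)

    w-inside : ∀ {k} → k < n₀ → w k ≡ 1
    w-inside k<n₀ rewrite <⇒<ᵇ≡true k<n₀ = refl

    w-vanishes : ∀ k → n₀ ≤ k → w k ≡ 0
    w-vanishes k n₀≤k rewrite ≥⇒<ᵇ≡false n₀≤k = refl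

    w≤1 : ∀ k → w k ≤ 1
    w≤1 k with k <ᵇ n₀
    ... | true  = ≤-refl
    ... | false = z≤n

    open Potential N a n₀ w fast

    private
      b = A.symbols

    -- h time units suffice for what remains of the construction.
    record Progress (us : List Update) (p : R.Process) (ρ h : ℕ) : Set where
      field
        queued : length (proj₂ p ++ us) + ρ ≤ length us + (L + L)
        total  : length (proj₂ p ++ us) ≤ n₀
        stage  : W.Ready h (proj₁ p) ⊎
                 (length (proj₂ p ++ us) + ρ < length us + (L + L) × length (proj₂ p ++ us) < n₀)

    -- A reset costs T units for the construction and one for itself.
    credit : ℕ → ℕ → ℕ → ℕ
    credit d ρ h = d + L ∸ ρ + h

    spent : ∀ {κ us i} → Effect κ us i → ℕ
    spent (ticked _ _ _) = 1
    spent (renewed _ _)  = 1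
    spent _              = 0

    progress-caughtUp : ∀ {us p ρ} → R.caughtUp p ≡ true → ρ ≤ L + L → length us ≤ n₀ → Progress us p ρ 0
    progress-caughtUp {us} {p} up ρ≤2L d≤n₀ with W.caughtUp⁻ p up
    ... | i , refl = record { queued = +-monoʳ-≤ (length us) ρ≤2L ; total = d≤n₀ ; stage = inj₁ λ { [] → i } }

    progress-renewed : ∀ {us S} → size S ≤ N → length us ≤ n₀ → Progress us (A.construct S , []) (L + L) T
    progress-renewed {S = S} small d≤n₀ =
      record { queued = ≤-refl ; total = d≤n₀ ; stage = inj₁ (constructs S small) }

    progress-received : ∀ {u us p ρ h} → Progress (u ∷ us) p (suc ρ) h → Progress us (enqueue u p) ρ h
    progress-received {u} {us} {s , q} {ρ} {h} B =
      subst (λ n → (n + ρ ≤ length us + (L + L)) → n ≤ n₀ → W.Ready h s ⊎ (n + ρ < length us + (L + L) × n < n₀) →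
                   Progress us (enqueue u (s , q)) ρ h)
        (cong length (++-assoc q (u ∷ []) us)) (λ queued total stage → record { queued = queued ; total = total ; stage = stage })
        (s≤s⁻¹ (subst (_≤ suc (length us + (L + L))) (+-suc _ ρ) queued)) total (stage′ stage)
      where
      open Progress B
      stage′ : W.Ready h s ⊎ (length (q ++ u ∷ us) + suc ρ < suc (length us + (L + L)) × length (q ++ u ∷ us) < n₀) →
               W.Ready h s ⊎ (length (q ++ u ∷ us) + ρ < length us + (L + L) × length (q ++ u ∷ us) < n₀)
      stage′ (inj₁ ready) = inj₁ ready
      stage′ (inj₂ (lt , lt′)) = inj₂ (s≤s⁻¹ (subst (_< suc (length us + (L + L))) (+-suc _ ρ) lt) , lt′)

    -- Each tick has a source of payment: a unit of construction lowers `h`, and any other serves an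
    -- update inside the window and gains its weight 1.
    progress-ticked : ∀ {us p ρ h} x → R.caughtUp p ≡ false → Progress us p ρ h →
      ∃[ h′ ] Progress us (R.tick x p) ρ h′ × h′ + 1 ≤ h + W.served (window (length us) ρ) (virtual us p)
    progress-ticked {us} {s , q} {ρ} {h} x behind B = cases (A.idle s) refl
      where
      open Progress B
      Goal : R.Process → ℕ → Set
      Goal p g = ∃[ h′ ] Progress us p ρ h′ × h′ + 1 ≤ h + g

      arrived : ∀ q → length us ≤ length (q ++ us)
      arrived q = ≤-trans (m≤n+m (length us) (length q)) (≤-reflexive (sym (length-++ q)))

      gained : ∀ q → length (q ++ us) + ρ < length us + (L + L) → length (q ++ us) < n₀ →
               h + 1 ≤ h + window (length us) ρ (length (q ++ us))
      gained q lt lt′ = +-monoʳ-≤ h (≤-reflexive (sym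
        (trans (window-inside (arrived q) (subst (_< length us + (L + L)) (+-comm _ ρ) lt)) (w-inside lt′))))

      cases : ∀ i → A.idle s ≡ i → Goal (R.tick x (s , q)) (W.served (window (length us) ρ) (s , q ++ us))
      cases false eq =
        subst₂ Goal (sym (W.tick-busy x eq)) (sym (W.served-busy (window (length us) ρ) eq)) (go h refl stage)
        where
        go : ∀ h′ → h ≡ h′ → W.Ready h′ s ⊎ (length (q ++ us) + ρ < length us + (L + L) × length (q ++ us) < n₀) →
             Goal (A.step x s , q) (window (length us) ρ (length (q ++ us)))
        go h′ eq′ (inj₂ (lt , lt′)) =
          h , record { queued = queued ; total = total ; stage = inj₂ (lt , lt′) } , gained q lt lt′
        go zero    _    (inj₁ ready) = contradiction (trans (sym eq) (ready [])) λ ()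
        go (suc h′) refl (inj₁ ready) =
          h′ , record { queued = queued ; total = total ; stage = inj₁ (W.Ready-step x eq ready) } ,
          ≤-trans (≤-reflexive (+-comm h′ 1)) (m≤m+n (suc h′) _)
      cases true eq = go q refl
        where
        go : ∀ q′ → q ≡ q′ → Goal (R.tick x (s , q′)) (W.served (window (length us) ρ) (s , q′ ++ us))
        go []       refl = contradiction (trans (sym eq) behind) λ ()
        go (u ∷ q′) refl = subst₂ Goal (sym (W.tick-idle x eq)) (sym (W.served-idle (window (length us) ρ) eq))
          (h , record { queued = ≤-trans (n≤1+n _) queued ; total = ≤-trans (n≤1+n _) total ; stage = inj₂ (queued , total) } ,
           gained q′ queued total)

    -- At a reset the count of updates to the next one jumps from 0 to `L + L`. The credit falls by
    -- at least `L`, even near the end, where the subtraction is truncated, and `T` < `L` leaves a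
    -- unit for the reset itself.
    restart-credit : ∀ d → d + L ∸ (L + L) + T + 1 ≤ d + L ∸ 0
    restart-credit d = begin
      d + L ∸ (L + L) + T + 1    ≡⟨ cong (λ z → z + T + 1) ([m+n]∸[o+n]≡m∸o d L L) ⟩
      d ∸ L + T + 1              ≡⟨ trans (+-assoc (d ∸ L) T 1) (cong (d ∸ L +_) (+-comm T 1)) ⟩
      d ∸ L + suc T              ≤⟨ +-mono-≤ (m∸n≤m d L) T<L ⟩
      d + L                      ∎
      where
      open ≤-Reasoning
      [m+n]∸[o+n]≡m∸o : ∀ m n o → m + n ∸ (o + n) ≡ m ∸ o
      [m+n]∸[o+n]≡m∸o m n o = trans (cong₂ _∸_ (+-comm m n) (+-comm o n)) ([m+n]∸[m+o]≡n∸o n m o)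

    CopyProgress : R′.Process → Fin Q → ℕ → Set
    CopyProgress (κ , us) i h = Progress us (copy κ i) (untilReset (control κ) i) h

    copyCredit : R′.Process → Fin Q → ℕ → ℕ
    copyCredit (κ , us) i h = credit (length us) (untilReset (control κ) i) h

    progress-cast : ∀ {us us′ p p′ ρ ρ′ h h′ c} → us′ ≡ us → p′ ≡ p → ρ′ ≡ ρ → Progress us p ρ h′ →
      credit (length us) ρ h′ + c ≤ h →
      ∃[ h′ ] Progress us′ p′ ρ′ h′ × credit (length us′) ρ′ h′ + c ≤ h
    progress-cast refl refl refl B le = _ , B , le

    progress-effect : ∀ κ us x i {h} (E : Effect κ us i) → Bounded N (current κ) us → length us ≤ n₀ →
      CopyProgress (κ , us) i h →
      ∃[ h′ ] CopyProgress (R′.tick x (κ , us)) i h′ ×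
              copyCredit (R′.tick x (κ , us)) i h′ + spent E ≤ copyCredit (κ , us) i h + gainOf E
    progress-effect κ us x i (still _ stays) bounded d≤n₀ B =
      let (eq , eq′ , eq″ , _) = stays x in progress-cast eq eq′ eq″ B ≤-refl
    progress-effect κ (u ∷ us) x i {h} (received _ arrives) bounded d≤n₀ B =
      let (eq , eq′ , eq″ , _) = arrives x in
      progress-cast eq eq′ refl (progress-received (subst (λ ρ → Progress (u ∷ us) (copy κ i) ρ h) eq″ B))
        (≤-reflexive (cong (λ ρ → credit (suc (length us)) ρ h + 0) (sym eq″)))
    progress-effect κ us x i {h} (renewed due renews) bounded d≤n₀ B =
      let (eq , eq′ , eq″) = renews x in
      progress-cast eq eq′ eq″ (progress-renewed (bounded⇒small {P} _ us bounded) d≤n₀)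
        (≤-trans (restart-credit (length us)) (≤-trans (≤-reflexive (cong (length us + L ∸_) (sym due)))
          (≤-trans (m≤m+n _ h) (m≤m+n _ 0))))
    progress-effect κ us x i {h} (ticked _ behind runs) bounded d≤n₀ B =
      let (eq , eq′ , eq″ , _) = runs x
          (h′ , B′ , le) = progress-ticked x behind B
          c = length us + L ∸ untilReset (control κ) i
          g = W.served (window (length us) (untilReset (control κ) i)) (virtual us (copy κ i)) in
      progress-cast eq eq′ eq″ B′
        (≤-trans (≤-reflexive (+-assoc c h′ 1)) (≤-trans (+-monoʳ-≤ c le) (≤-reflexive (sym (+-assoc c h g)))))

    -- A tick of a copy is paid by the copy, unless it was up to date, when its
    -- slot ends; so a slot costs at most one further time unit.
    overhead : Phase Q β → ℕ
    overhead (opening i)   = suc (toℕ i) + (Q + Q)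
    overhead (serving i s) = suc (toℕ i) + (Q + Q)
    overhead (seeking i)   = suc (toℕ i) + Q
    overhead (finishing i) = suc (toℕ i)
    overhead resting       = 0

    round : ℕ
    round = suc (Q + overhead (opening top))

    suc-top : suc (toℕ top) ≡ Q
    suc-top = cong suc (toℕ-fromℕ Q′)

    overhead-nextSlot : ∀ i → overhead (nextSlot i) < suc (toℕ i) + (Q + Q)
    overhead-nextSlot zero    rewrite toℕ-fromℕ Q′ = ≤-refl
    overhead-nextSlot (suc i) rewrite toℕ-inject₁ i = ≤-refl

    overhead-true : ∀ ph → ph ≢ resting → overhead (nextPhase ph true) < overhead ph
    overhead-true (opening i)         busy = overhead-nextSlot i
    overhead-true (serving i s)       busy = overhead-nextSlot i
    overhead-true (seeking i)         busy = s≤s z≤n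
    overhead-true (finishing zero)    busy = s≤s z≤n
    overhead-true (finishing (suc i)) busy rewrite toℕ-inject₁ i = ≤-refl
    overhead-true resting             busy = contradiction refl busy

    overhead-seeking : ∀ i o → overhead (nextPhase (seeking i) o) < overhead (seeking i)
    overhead-seeking i       true  = s≤s z≤n
    overhead-seeking zero    false rewrite toℕ-fromℕ Q′ = ≤-refl
    overhead-seeking (suc i) false rewrite toℕ-inject₁ i = ≤-refl

    overhead-next : ∀ ph o → ph ≢ resting → overhead (nextPhase ph o) ≤ overhead ph
    overhead-next ph                  true  busy = <⇒≤ (overhead-true ph busy)
    overhead-next (opening i)         false busy = ≤-refl
    overhead-next (serving i zero)    false busy = <⇒≤ (overhead-nextSlot i)
    overhead-next (serving i (suc s)) false busy = ≤-refl
    overhead-next (seeking i)         false busy = <⇒≤ (overhead-seeking i false)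
    overhead-next (finishing zero)    false busy = ≤-refl
    overhead-next (finishing (suc i)) false busy = ≤-refl
    overhead-next resting             false busy = contradiction refl busy

    point⇒seeking : ∀ c {j} → act c ≡ point j → ∃[ i ] phaseOf c ≡ seeking i
    point⇒seeking ((γ , zero) , opening j) acts with does (side j Bool.≟ γ)
    point⇒seeking ((γ , zero) , opening j) () | true
    point⇒seeking ((γ , zero) , opening j) () | false
    point⇒seeking (clock , seeking i) acts = i , refl

    charge : Configuration → List Update → ℕ
    charge κ us = W′.served w (κ , us)

    charge≤1 : ∀ κ us → charge κ us ≤ 1
    charge≤1 κ us with waiting κ | us
    ... | false | us     = w≤1 (length us)
    ... | true  | []     = z≤n
    ... | true  | u ∷ us = w≤1 (length us)

    charge-wait : ∀ κ → toll κ ≡ 0 → act (control κ) ≡ wait → charge κ [] ≡ 0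
    charge-wait κ free waits = W′.served-empty w {κ} (waiting-wait κ free waits)

    charge-busy : ∀ κ us → waiting κ ≡ false → charge κ us ≡ w (length us)
    charge-busy κ us busy = W′.served-busy w {κ} {us} busy

    standing : R′.Process → ℕ
    standing (κ , us) = toll κ + overhead (phase κ) + length us * round

    Spending : Configuration → List Update → ℕ
    Spending κ us = Σᶠ (λ i → spent (effect κ us i))

    -- Every unit has a payer. A toll, a pointer move or the run of a copy that is up to date lowers
    -- the reserve of the phase; a reset, or the run of a copy with a backlog, is spent by the copy;
    -- and an arrival opens a round whose cost was set aside.
    standing-step : ∀ κ us x → standing (R′.tick x (κ , us)) + charge κ us ≤ standing (κ , us) + Spending κ us
    standing-step κ us x = cases (toll κ) refl (act (control κ)) refl us
      where
      open ≤-Reasoning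

      paid-by-phase : ∀ {c u s} {m n} → c ≤ 1 → m < n → m + u + c ≤ n + u + s
      paid-by-phase {c} {u} {s} {m} {n} c≤1 m<n = begin
        m + u + c  ≤⟨ +-monoʳ-≤ (m + u) c≤1 ⟩
        m + u + 1  ≡⟨ +-comm (m + u) 1 ⟩
        suc m + u  ≤⟨ +-monoˡ-≤ u m<n ⟩
        n + u      ≤⟨ m≤m+n (n + u) s ⟩
        n + u + s  ∎

      paid-by-copy : ∀ {c u s} {m n} → c ≤ 1 → m ≤ n → 1 ≤ s → m + u + c ≤ n + u + s
      paid-by-copy {u = u} c≤1 m≤n 1≤s = +-mono-≤ (+-monoˡ-≤ u m≤n) (≤-trans c≤1 1≤s)

      passive : ∀ us j → toll κ ≡ 0 → (E : Effect κ us j) → act (control κ) ≢ wait →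
                (act (control κ) ≡ run j × R.caughtUp (copy κ j) ≡ false ⊎ act (control κ) ≡ reset j) → 1 ≤ spent E
      passive us j free (still idle _) busy (inj₁ (runs , behind)) =
        contradiction (trans (sym behind) (proj₁ (idle free) runs)) λ ()
      passive us j free (still idle _) busy (inj₂ resets) = contradiction resets (proj₂ (idle free))
      passive us j free (received waits _) busy _ = contradiction waits busy
      passive us j free (renewed _ _)  busy _ = ≤-refl
      passive us j free (ticked _ _ _) busy _ = ≤-refl

      spending : ∀ us j → toll κ ≡ 0 → act (control κ) ≢ wait →
                 (act (control κ) ≡ run j × R.caughtUp (copy κ j) ≡ false ⊎ act (control κ) ≡ reset j) → 1 ≤ Spending κ us
      spending us j free busy how =
        ≤-trans (passive us j free (effect κ us j) busy how) (Σᶠ-term (λ i → spent (effect κ us i)) j)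

      not-wait : ∀ {α} → act (control κ) ≡ α → α ≢ wait → act (control κ) ≢ wait
      not-wait acts α≢wait waits = α≢wait (trans (sym acts) waits)

      standing-acting : ∀ us κ′ o → toll κ ≡ 0 → act (control κ) ≢ wait → control κ′ ≡ next (control κ) o → toll κ′ ≡ toll κ →
        standing (κ′ , us) ≡ overhead (nextPhase (phase κ) o) + length us * round
      standing-acting us κ′ o free busy eq eq′ rewrite eq | eq′ | free | next-acting (control κ) o busy = refl

      standing-free : ∀ us → toll κ ≡ 0 → standing (κ , us) ≡ overhead (phase κ) + length us * round
      standing-free us free rewrite free = refl

      Goal : List Update → R′.Process → Set
      Goal us p = standing p + charge κ us ≤ standing (κ , us) + Spending κ us

      acting : ∀ us κ′ o → toll κ ≡ 0 → act (control κ) ≢ wait → control κ′ ≡ next (control κ) o → toll κ′ ≡ toll κ →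
        (overhead (nextPhase (phase κ) o) < overhead (phase κ) ⊎ 1 ≤ Spending κ us) → Goal us (κ′ , us)
      acting us κ′ o free busy eq eq′ (inj₁ lt) =
        subst₂ (λ m n → m + charge κ us ≤ n + Spending κ us)
          (sym (standing-acting us κ′ o free busy eq eq′)) (sym (standing-free us free))
          (paid-by-phase (charge≤1 κ us) lt)
      acting us κ′ o free busy eq eq′ (inj₂ spends) =
        subst₂ (λ m n → m + charge κ us ≤ n + Spending κ us)
          (sym (standing-acting us κ′ o free busy eq eq′)) (sym (standing-free us free))
          (paid-by-copy (charge≤1 κ us) (overhead-next (phase κ) o (busy ∘ resting⇒wait (control κ))) spends)

      cases : ∀ t → toll κ ≡ t → ∀ α → act (control κ) ≡ α → ∀ us → Goal us (R′.tick x (κ , us))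
      cases (suc t) tolls α acts us = subst (Goal us) (sym (tick-paying x κ us tolls))
        (subst (λ t′ → t + overhead (phase κ) + length us * round + charge κ us ≤
                       t′ + overhead (phase κ) + length us * round + Spending κ us) (sym tolls)
          (paid-by-phase {u = length us * round} {m = t + overhead (phase κ)} (charge≤1 κ us) ≤-refl))
      cases zero tolls (reset j) acts us = subst (Goal us) (sym (tick-acting x κ us tolls acts λ ()))
        (acting us (perform (reset j) x κ) _ tolls (not-wait acts λ ()) refl refl
          (inj₂ (spending us j tolls (not-wait acts λ ()) (inj₂ acts))))
      cases zero tolls (point j) acts us = subst (Goal us) (sym (tick-acting x κ us tolls acts λ ()))
        (acting us (perform (point j) x κ) (R.caughtUp (copy κ j)) tolls (not-wait acts λ ()) refl refl
          (let (i , seeks) = point⇒seeking (control κ) acts in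
           inj₁ (subst (λ ph → overhead (nextPhase ph (R.caughtUp (copy κ j))) < overhead ph) (sym seeks)
             (overhead-seeking i (R.caughtUp (copy κ j))))))
      cases zero tolls (run j) acts us = subst (Goal us) (sym (tick-acting x κ us tolls acts λ ()))
        (acting us (perform (run j) x κ) (R.caughtUp (copy (perform (run j) x κ) j)) tolls (not-wait acts λ ()) refl refl
          (payer (R.caughtUp (copy κ j)) refl))
        where
        payer : ∀ o → R.caughtUp (copy κ j) ≡ o →
                overhead (nextPhase (phase κ) (R.caughtUp (copy (perform (run j) x κ) j))) < overhead (phase κ) ⊎ 1 ≤ Spending κ us
        payer false behind = inj₂ (spending us j tolls (not-wait acts λ ()) (inj₁ (acts , behind)))
        payer true  up = inj₁ (subst (λ o → overhead (nextPhase (phase κ) o) < overhead (phase κ))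
          (sym (trans (cong R.caughtUp (trans (lookup∘update j (copies κ) _) (W.tick-caughtUp x (copy κ j) up))) up))
          (overhead-true (phase κ) (not-wait acts (λ ()) ∘ resting⇒wait (control κ))))
      cases zero tolls wait acts [] = subst (Goal []) (sym (tick-wait x κ tolls acts))
        (subst (λ c → standing (κ , []) + c ≤ standing (κ , []) + Spending κ []) (sym (charge-wait κ tolls acts))
          (+-monoʳ-≤ (standing (κ , [])) z≤n))
      cases zero tolls wait acts (u ∷ us) = subst (Goal (u ∷ us)) (sym (tick-arrival x κ u us tolls acts)) (begin
        standing (receive u κ , us) + charge κ (u ∷ us)
          ≤⟨ +-monoʳ-≤ (standing (receive u κ , us)) (charge≤1 κ (u ∷ us)) ⟩
        Q + overhead (phaseOf (next (control κ) false)) + length us * round + 1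
          ≡⟨ cong (λ m → Q + m + length us * round + 1) (arrive (control κ) (proj₂ (wait⇒resting (control κ) acts))) ⟩
        Q + overhead (opening top) + length us * round + 1
          ≡⟨ +-comm (Q + overhead (opening top) + length us * round) 1 ⟩
        length (u ∷ us) * round
          ≤⟨ m≤n+m _ (toll κ + overhead (phase κ)) ⟩
        standing (κ , u ∷ us)
          ≤⟨ m≤m+n _ (Spending κ (u ∷ us)) ⟩
        standing (κ , u ∷ us) + Spending κ (u ∷ us) ∎)
        where
        arrive : ∀ c {clock} → c ≡ (clock , resting) → overhead (phaseOf (next c false)) ≡ overhead (opening top)
        arrive _ refl = refl

    Gains : Configuration → List Update → ℕ
    Gains κ us = Σᶠ (gain κ us)

    -- During the initial construction all `n₀` updates are queued. The index served is `n₀`, where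
    -- the weight vanishes, so nothing is charged and the funds remain as they were. The accounts of
    -- the copies are opened when all are up to date.
    data Funded (κ : Configuration) (us : List Update) (O : ℕ) : Set where
      initial : Fresh κ → length us ≡ n₀ →
                n₀ * round + Σᶠ (λ i → copyCredit (κ , us) i 0) ≤ O → Funded κ us O
      started : ∀ (h : Fin Q → ℕ) → (∀ i → CopyProgress (κ , us) i (h i)) →
                standing (κ , us) + Σᶠ (λ i → copyCredit (κ , us) i (h i)) ≤ O → Funded κ us O

    funded-step : ∀ κ us {O} → Bounded N (current κ) us → length us ≤ n₀ → Funded κ us O → ∀ x →
      ∃[ O′ ] Funded (proj₁ (R′.tick x (κ , us))) (proj₂ (R′.tick x (κ , us))) O′ × O′ + charge κ us ≤ O + Gains κ us
    funded-step κ us {O} bounded d≤n₀ (initial fresh d≡n₀ le) x = O , go (fresh-step κ us x fresh) ,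
      +-monoʳ-≤ O (≤-trans (≤-reflexive free) z≤n)
      where
      free : charge κ us ≡ 0
      free = let (j , runs) = fresh-act κ fresh in
        trans (charge-busy κ us (waiting-acting κ (λ waits → contradiction (trans (sym runs) waits) λ ())))
          (w-vanishes (length us) (≤-reflexive (sym d≡n₀)))
      start′ : ∀ κ′ us′ → us′ ≡ us → (∀ i → untilReset (control κ′) i ≡ untilReset (control κ) i) →
               Fresh κ′ ⊎ Rested κ′ → Funded κ′ us′ O
      start′ κ′ us′ refl same (inj₁ fresh) = initial fresh d≡n₀
        (subst (λ s → n₀ * round + s ≤ O) (Σᶠ-cong (λ i → cong (λ ρ → credit (length us) ρ 0) (sym (same i)))) le)
      start′ κ′ us′ refl same (inj₂ (free , rests , up)) = started (λ _ → 0)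
        (λ i → progress-caughtUp (up i) (untilReset≤2L (control κ′) i) d≤n₀)
        (subst₂ (λ m s → m + s ≤ O) (standing-rest free rests)
          (Σᶠ-cong (λ i → cong (λ ρ → credit (length us) ρ 0) (sym (same i)))) le)
        where
        standing-rest : toll κ′ ≡ 0 → phase κ′ ≡ resting → n₀ * round ≡ standing (κ′ , us)
        standing-rest free rests rewrite free | rests | d≡n₀ = refl
      go : Finishing κ us (R′.tick x (κ , us)) →
           Funded (proj₁ (R′.tick x (κ , us))) (proj₂ (R′.tick x (κ , us))) O
      go (eq , same , state) = start′ _ _ eq same state
    funded-step κ us {O} bounded d≤n₀ (started h progress le) x =
      standing p′ + C′ , started (λ i → proj₁ (next′ i)) (λ i → proj₁ (proj₂ (next′ i))) ≤-refl , (begin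
        standing p′ + C′ + charge κ us                    ≡⟨ rearrange (standing p′) C′ (charge κ us) ⟩
        standing p′ + charge κ us + C′                    ≤⟨ +-monoˡ-≤ C′ (standing-step κ us x) ⟩
        standing (κ , us) + Spending κ us + C′            ≡⟨ rearrange′ (standing (κ , us)) (Spending κ us) C′ ⟩
        standing (κ , us) + (C′ + Spending κ us)          ≤⟨ +-monoʳ-≤ (standing (κ , us)) credits ⟩
        standing (κ , us) + (C + Gains κ us)              ≡⟨ +-assoc (standing (κ , us)) C (Gains κ us) ⟨
        standing (κ , us) + C + Gains κ us                ≤⟨ +-monoˡ-≤ (Gains κ us) le ⟩
        O + Gains κ us                                    ∎)
      where
      open ≤-Reasoning
      p′ : R′.Process
      p′ = R′.tick x (κ , us)
      next′ : ∀ i → ∃[ h′ ] CopyProgress p′ i h′ ×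
                    copyCredit p′ i h′ + spent (effect κ us i) ≤ copyCredit (κ , us) i (h i) + gain κ us i
      next′ i = progress-effect κ us x i (effect κ us i) bounded d≤n₀ (progress i)
      C C′ : ℕ
      C  = Σᶠ (λ i → copyCredit (κ , us) i (h i))
      C′ = Σᶠ (λ i → copyCredit p′ i (proj₁ (next′ i)))
      credits : C′ + Spending κ us ≤ C + Gains κ us
      credits = begin
        C′ + Spending κ us
          ≡⟨ ∑-distrib-+ (λ i → copyCredit p′ i (proj₁ (next′ i))) (λ i → spent (effect κ us i)) ⟨
        Σᶠ (λ i → copyCredit p′ i (proj₁ (next′ i)) + spent (effect κ us i))
          ≤⟨ Σᶠ-mono (λ i → proj₂ (proj₂ (next′ i))) ⟩
        Σᶠ (λ i → copyCredit (κ , us) i (h i) + gain κ us i)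
          ≡⟨ ∑-distrib-+ (λ i → copyCredit (κ , us) i (h i)) (gain κ us) ⟩
        C + Gains κ us ∎
      rearrange : ∀ s c g → s + c + g ≡ s + g + c
      rearrange = solve-∀
      rearrange′ : ∀ s p c → s + p + c ≡ s + (c + p)
      rearrange′ = solve-∀

    potential-sum-step : ∀ M κ us → Bounded N (current κ) us → length us ≤ n₀ →
      ∑ (allFin b) (λ x → Σᶠ (potential M (R′.tick x (κ , us)))) + b ^ suc M * Gains κ us
        ≤ Σᶠ (potential (suc M) (κ , us))
    potential-sum-step M κ us bounded d≤n₀ = begin
      ∑ (allFin b) (λ x → Σᶠ (potential M (R′.tick x (κ , us)))) + b ^ suc M * Gains κ us
        ≡⟨ cong₂ _+_ (∑-Σᶠ-swap (allFin b) (λ x → potential M (R′.tick x (κ , us)))) (sym (Σᶠ-*ˡ (b ^ suc M) (gain κ us))) ⟩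
      Σᶠ (λ i → ∑ (allFin b) (λ x → potential M (R′.tick x (κ , us)) i)) + Σᶠ (λ i → b ^ suc M * gain κ us i)
        ≡⟨ ∑-distrib-+ (λ i → ∑ (allFin b) (λ x → potential M (R′.tick x (κ , us)) i)) (λ i → b ^ suc M * gain κ us i) ⟨
      Σᶠ (λ i → ∑ (allFin b) (λ x → potential M (R′.tick x (κ , us)) i) + b ^ suc M * gain κ us i)
        ≤⟨ Σᶠ-mono (λ i → Step.potential-step M κ us bounded d≤n₀ i) ⟩
      Σᶠ (potential (suc M) (κ , us)) ∎
      where open ≤-Reasoning

    -- The gains of a unit leave the potentials, whose expectation falls accordingly, and join the
    -- funds `O`, from which the charge is paid.
    work-bound : ∀ M κ us {O} → Bounded N (current κ) us → length us ≤ n₀ → Funded κ us O →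
      W′.totalWork w M (κ , us) ≤ b ^ M * O + Σᶠ (potential M (κ , us))
    work-bound zero    κ us bounded d≤n₀ funded = z≤n
    work-bound (suc M) κ us {O} bounded d≤n₀ funded = begin
      W′.totalWork w (suc M) (κ , us)
        ≡⟨ W′.totalWork-suc w M (κ , us) ⟩
      b ^ suc M * c + ∑ (allFin b) (λ x → W′.totalWork w M (R′.tick x (κ , us)))
        ≤⟨ +-monoʳ-≤ (b ^ suc M * c) (∑-mono (allFin b) (λ x →
             work-bound M _ _ (bounded-tick κ us x bounded) (length-tick κ us x d≤n₀) (proj₁ (proj₂ (after x))))) ⟩
      b ^ suc M * c + ∑ (allFin b) (λ x → b ^ M * O′ x + Σᶠ (potential M (R′.tick x (κ , us))))
        ≡⟨ cong₂ _+_ (trans (*-assoc b (b ^ M) c) (sym (∑-allFin-const b (b ^ M * c))))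
             (∑-+ (allFin b) (λ x → b ^ M * O′ x) _) ⟩
      ∑ (allFin b) (λ _ → b ^ M * c) + (∑ (allFin b) (λ x → b ^ M * O′ x) + Z)
        ≡⟨ trans (sym (+-assoc (∑ (allFin b) (λ _ → b ^ M * c)) _ Z))
             (cong (_+ Z) (sym (∑-+ (allFin b) (λ _ → b ^ M * c) (λ x → b ^ M * O′ x)))) ⟩
      ∑ (allFin b) (λ x → b ^ M * c + b ^ M * O′ x) + Z
        ≤⟨ +-monoˡ-≤ Z (∑-mono (allFin b) (λ x → ≤-trans (≤-reflexive (rearrange (b ^ M) c (O′ x)))
             (*-monoʳ-≤ (b ^ M) (proj₂ (proj₂ (after x)))))) ⟩
      ∑ (allFin b) (λ _ → b ^ M * (O + Gains κ us)) + Z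
        ≡⟨ cong (_+ Z) (∑-allFin-const b (b ^ M * (O + Gains κ us))) ⟩
      b * (b ^ M * (O + Gains κ us)) + Z
        ≡⟨ rearrange′ b (b ^ M) O (Gains κ us) Z ⟩
      b ^ suc M * O + (Z + b ^ suc M * Gains κ us)
        ≤⟨ +-monoʳ-≤ (b ^ suc M * O) (potential-sum-step M κ us bounded d≤n₀) ⟩
      b ^ suc M * O + Σᶠ (potential (suc M) (κ , us)) ∎
      where
      open ≤-Reasoning
      c : ℕ
      c = charge κ us
      after : ∀ x → ∃[ O′ ] Funded (proj₁ (R′.tick x (κ , us))) (proj₂ (R′.tick x (κ , us))) O′ × O′ + c ≤ O + Gains κ us
      after = funded-step κ us bounded d≤n₀ funded
      O′ : Fin b → ℕ
      O′ x = proj₁ (after x)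
      Z : ℕ
      Z = ∑ (allFin b) (λ x → Σᶠ (potential M (R′.tick x (κ , us))))
      rearrange : ∀ p c o → p * c + p * o ≡ p * (o + c)
      rearrange = solve-∀
      rearrange′ : ∀ b p o g z → b * (p * (o + g)) + z ≡ b * p * o + (z + b * p * g)
      rearrange′ = solve-∀

    -- Per update, a round costs 1 for the arrival and `Q` each for toll, slots, search and
    -- finishing; the credits for resets add another `Q`, and the potentials of the copies `Q * a`.
    totalTime-bound : ∀ S us → Bounded N S us → length us ≡ n₀ → ∀ M →
      ∑ (sequences b M) (R′.totalTime (initially S , us)) ≤ b ^ M * (n₀ * (1 + 5 * Q + Q * a))
    totalTime-bound S us bounded d≡n₀ M = begin
      ∑ (sequences b M) (R′.totalTime (initially S , us))
        ≤⟨ ∑-mono (sequences b M) time≤work ⟩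
      W′.totalWork w M (initially S , us)
        ≤⟨ work-bound M (initially S) us bounded (≤-reflexive d≡n₀) (initial (fresh-start S) d≡n₀ ≤-refl) ⟩
      b ^ M * (n₀ * round + Σᶠ (λ i → copyCredit (initially S , us) i 0)) + Σᶠ (potential M (initially S , us))
        ≤⟨ +-mono-≤ (*-monoʳ-≤ (b ^ M) (+-monoʳ-≤ (n₀ * round) (≤-trans (Σᶠ-mono credit≤) (≤-reflexive (Σᶠ-const Q n₀)))))
             (≤-trans (Σᶠ-mono potential≤) (≤-reflexive (Σᶠ-const Q _))) ⟩
      b ^ M * (n₀ * round + Q * n₀) + Q * (a * b ^ M * n₀)
        ≡⟨ cong (λ m → b ^ M * (n₀ * suc (Q + (m + (Q + Q))) + Q * n₀) + Q * (a * b ^ M * n₀)) suc-top ⟩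
      b ^ M * (n₀ * suc (Q + (Q + (Q + Q))) + Q * n₀) + Q * (a * b ^ M * n₀)
        ≡⟨ rearrange (b ^ M) n₀ Q a ⟩
      b ^ M * (n₀ * (1 + 5 * Q + Q * a)) ∎
      where
      open ≤-Reasoning
      time≤work : ∀ (xs : Vec (Fin b) M) → R′.totalTime (initially S , us) xs ≤ W′.work w (initially S , us) xs
      time≤work xs = ≤-trans (≤-reflexive (cong (λ n → ∑ (upTo n) (λ k → R′.time k (initially S , us) xs)) d≡n₀)) (≤-trans
        (∑-upTo-mono-< n₀ (λ k k<n₀ → ≤-reflexive (sym (trans (cong (_* R′.time k (initially S , us) xs) (w-inside k<n₀)) (+-identityʳ _)))))
        (≤-reflexive (sym (W′.work-time n₀ w w-vanishes (initially S , us) xs))))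
      credit≤ : ∀ i → copyCredit (initially S , us) i 0 ≤ n₀
      credit≤ i = begin
        length us + L ∸ untilReset initialControl i + 0  ≡⟨ +-identityʳ _ ⟩
        length us + L ∸ untilReset initialControl i      ≤⟨ ∸-monoʳ-≤ (length us + L) (untilReset-start i) ⟩
        length us + L ∸ L                       ≡⟨ m+n∸n≡m (length us) L ⟩
        length us                               ≡⟨ d≡n₀ ⟩
        n₀                                      ∎
      w-sum : ∑ (upTo n₀) w ≤ n₀
      w-sum = ≤-trans (∑-mono (upTo n₀) w≤1) (≤-reflexive
        (trans (∑-const (upTo n₀) 1) (trans (*-identityʳ _) (length-upTo n₀))))
      potential≤ : ∀ i → potential M (initially S , us) i ≤ a * b ^ M * n₀
      potential≤ i = ≤-trans (potential-start M S us i bounded d≡n₀ w-vanishes) (*-monoʳ-≤ (a * b ^ M) w-sum)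
      rearrange : ∀ p n q a → p * (n * (1 + (q + (q + (q + q)))) + q * n) + q * (a * p * n) ≡ p * (n * (1 + 5 * q + q * a))
      rearrange = solve-∀

  -- Correctness and construction

  module _ {P : Problem} (A : Algorithm P) where
    open Problem P
    open Algorithm A
    open Run A renaming (run to execute)
    open Work A

    execute-∷ʳ : ∀ {M} (xs : Vec (Fin symbols) M) x p → execute (xs ∷ʳ x) p ≡ tick x (execute xs p)
    execute-∷ʳ []       x p = refl
    execute-∷ʳ (y ∷ xs) x p = execute-∷ʳ xs x (tick y p)

    -- Runs that never wait, and so are not changed if further updates are queued.
    infix 4 _↝_
    data _↝_ (p : Process) : Process → Set where
      stop : p ↝ p
      _▹_  : ∀ {q} → p ↝ q → ∀ x → caughtUp q ≡ false → p ↝ tick x q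

    behind-++ : ∀ s us vs → caughtUp (s , us) ≡ false → caughtUp (s , us ++ vs) ≡ false
    behind-++ s []       []       behind = behind
    behind-++ s []       (v ∷ vs) behind = refl
    behind-++ s (u ∷ us) vs       behind = refl

    ↝-++ : ∀ {s us p} vs → (s , us) ↝ p → (s , us ++ vs) ↝ (proj₁ p , proj₂ p ++ vs)
    ↝-++ vs stop = stop
    ↝-++ vs (_▹_ {s′ , us′} steps x behind) =
      subst (_ ↝_) (tick-++ x s′ us′ vs behind) ((↝-++ vs steps ▹ x) (behind-++ s′ us′ vs behind))

    ↝⇒execute : ∀ {p q} → p ↝ q → ∃[ M ] Σ[ xs ∈ Vec (Fin symbols) M ] execute xs p ≡ q
    ↝⇒execute stop = 0 , [] , refl
    ↝⇒execute {p} ((steps ▹ x) _) =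
      let (M , xs , eq) = ↝⇒execute steps in suc M , xs ∷ʳ x , trans (execute-∷ʳ xs x p) (cong (tick x) eq)

    applyAll-∷ʳ : ∀ us u S → applyAll (us ++ u ∷ []) S ≡ apply u (applyAll us S)
    applyAll-∷ʳ []       u S = refl
    applyAll-∷ʳ (v ∷ us) u S = applyAll-∷ʳ us u (apply v S)

    -- The process will represent S, once it is up to date.
    Represents : FinSet Element → Process → Set
    Represents S p = ∃[ S₀ ] ∃[ us ] (construct S₀ , us) ↝ p × applyAll us S₀ ≡ S

    represents-construct : ∀ S → Represents S (construct S , [])
    represents-construct S = S , [] , stop , refl

    represents-enqueue : ∀ {S s q} u → Represents S (s , q) → Represents (apply u S) (s , q ++ u ∷ [])
    represents-enqueue u (S₀ , us , steps , refl) = S₀ , us ++ u ∷ [] , ↝-++ (u ∷ []) steps , applyAll-∷ʳ us u S₀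

    -- Units in which the copy merely waits are left out of the recorded run. This is what allows
    -- updates that arrived later to be placed in the queue from the beginning.
    represents-tick : ∀ {S p} x → Represents S p → Represents S (tick x p)
    represents-tick {S} {p} x (S₀ , us , steps , eq) with caughtUp p in up
    ... | true  = S₀ , us , subst ((construct S₀ , us) ↝_) (sym (tick-caughtUp x p up)) steps , eq
    ... | false = S₀ , us , (steps ▹ x) up , eq

    represents⇒correct : ∀ {S p} → Represents S p → caughtUp p ≡ true → Correct (proj₁ p) S
    represents⇒correct {S} {p} (S₀ , us , steps , eq) up with caughtUp⁻ p up
    ... | i , refl = let (M , xs , eq′) = ↝⇒execute steps in i , S₀ , us , M , xs , eq′ , eq

  module Correctness {P : Problem} (A : Algorithm P) {Q′ : ℕ} (side : Fin (suc Q′) → Bool) (β L′ : ℕ) where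
    open Problem P
    open Analysis A side β L′

    UpToDate : Phase Q β → Configuration → Set
    UpToDate (finishing j) κ = ∀ i → toℕ j < toℕ i → R.caughtUp (copy κ i) ≡ true
    UpToDate resting       κ = R.caughtUp (copy κ (pointer κ)) ≡ true
    UpToDate _             κ = ⊤

    record Sound (S : FinSet Element) (p : R′.Process) : Set where
      field
        represents : ∀ i → Represents A (current (proj₁ p)) (copy (proj₁ p) i)
        upToDate   : UpToDate (phase (proj₁ p)) (proj₁ p)
        pending    : applyAll (proj₂ p) (current (proj₁ p)) ≡ S

    represents-update : ∀ {κ : Configuration} (S : FinSet Element) (ps : Vec R.Process Q) j p →
      (∀ i → Represents A S (lookup ps i)) → Represents A S p → ∀ i → Represents A S (lookup (ps [ j ]≔ p) i)
    represents-update S ps j p all new i with i Fin.≟ j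
    ... | yes refl = subst (Represents A S) (sym (lookup∘update i ps p)) new
    ... | no  i≢j  = subst (Represents A S) (sym (lookup∘update′ i≢j ps p)) (all i)

    upToDate-nextSlot : ∀ i κ → UpToDate (nextSlot i) κ
    upToDate-nextSlot zero    κ = tt
    upToDate-nextSlot (suc i) κ = tt

    upToDate-finishing : ∀ j o κ κ′ → (∀ i → toℕ j < toℕ i → R.caughtUp (copy κ i) ≡ true) →
      (∀ i → i ≢ j → copy κ′ i ≡ copy κ i) → R.caughtUp (copy κ′ j) ≡ o → UpToDate (nextPhase (finishing j) o) κ′
    upToDate-finishing j o κ κ′ up others eq = go j o up others eq
      where
      keep : ∀ j → (∀ i → toℕ j < toℕ i → R.caughtUp (copy κ i) ≡ true) → (∀ i → i ≢ j → copy κ′ i ≡ copy κ i) →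
             ∀ i → toℕ j < toℕ i → R.caughtUp (copy κ′ i) ≡ true
      keep j up others i j<i = trans (cong R.caughtUp (others i (λ { refl → <-irrefl refl j<i }))) (up i j<i)
      go : ∀ j o → (∀ i → toℕ j < toℕ i → R.caughtUp (copy κ i) ≡ true) → (∀ i → i ≢ j → copy κ′ i ≡ copy κ i) →
           R.caughtUp (copy κ′ j) ≡ o → UpToDate (nextPhase (finishing j) o) κ′
      go zero    false up others eq = keep zero up others
      go (suc j) false up others eq = keep (suc j) up others
      -- All copies are up to date by now, so the one where the failed search left the pointer will
      -- do.
      go zero    true  up others eq = all (pointer κ′)
        where
        all : ∀ i → R.caughtUp (copy κ′ i) ≡ true
        all zero    = eq
        all (suc i) = keep zero up others (suc i) (s≤s z≤n)
      go (suc j) true  up others eq i j<i with above-inject₁ j i j<i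
      ... | inj₁ refl = eq
      ... | inj₂ lt   = keep (suc j) up others i lt

    sound-step : ∀ S κ us x → Sound S (κ , us) → Sound S (R′.tick x (κ , us))
    sound-step S κ us x sound = cases (toll κ) refl (act (control κ)) refl us pending
      where
      open Sound sound

      acting : ∀ us κ′ o → applyAll us (current κ) ≡ S → act (control κ) ≢ wait → current κ′ ≡ current κ →
        control κ′ ≡ next (control κ) o → (∀ i → Represents A (current κ) (copy κ′ i)) →
        UpToDate (nextPhase (phase κ) o) κ′ → Sound S (κ′ , us)
      acting us κ′ o pending busy eq eq′ represents′ upToDate′ = record
        { represents = λ i → subst (λ S → Represents A S (copy κ′ i)) (sym eq) (represents′ i)
        ; upToDate   = subst (λ c → UpToDate (phaseOf c) κ′) (sym (trans eq′ (next-acting (control κ) o busy))) upToDate′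
        ; pending    = trans (cong (applyAll us) eq) pending }

      not-wait : ∀ {α} → act (control κ) ≡ α → α ≢ wait → act (control κ) ≢ wait
      not-wait acts α≢wait waits = α≢wait (trans (sym acts) waits)

      up-reset : ∀ c o κ′ j → act c ≡ reset j → UpToDate (nextPhase (phaseOf c) o) κ′
      up-reset c o κ′ j acts with reset⇒opening c j acts
      up-reset c true  κ′ j acts | γ , refl , _ = upToDate-nextSlot j κ′
      up-reset c false κ′ j acts | γ , refl , _ = tt

      up-point : ∀ c o κ′ j → act c ≡ point j → pointer κ′ ≡ j → R.caughtUp (copy κ′ j) ≡ o →
                 UpToDate (nextPhase (phaseOf c) o) κ′
      up-point ((γ , zero) , opening i) o κ′ j acts at eq with does (side i Bool.≟ γ)
      up-point ((γ , zero) , opening i) o κ′ j () at eq | true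
      up-point ((γ , zero) , opening i) o κ′ j () at eq | false
      up-point (clock , seeking i)       true  κ′ _ refl refl eq = eq
      up-point (clock , seeking zero)    false κ′ _ refl at eq   = λ i top<i → contradiction top<i (above-top i)
      up-point (clock , seeking (suc i)) false κ′ _ refl at eq   = tt

      up-run : ∀ c o κ′ j → act c ≡ run j → UpToDate (phaseOf c) κ →
               (∀ i → i ≢ j → copy κ′ i ≡ copy κ i) → R.caughtUp (copy κ′ j) ≡ o →
               UpToDate (nextPhase (phaseOf c) o) κ′
      up-run (clock , opening i)         true  κ′ j acts up others eq = upToDate-nextSlot i κ′
      up-run (clock , opening i)         false κ′ j acts up others eq = tt
      up-run (clock , serving i s)       true  κ′ j acts up others eq = upToDate-nextSlot i κ′
      up-run (clock , serving i zero)    false κ′ j acts up others eq = upToDate-nextSlot i κ′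
      up-run (clock , serving i (suc s)) false κ′ j acts up others eq = tt
      up-run (clock , finishing j)       o     κ′ _ refl up others eq = upToDate-finishing j o κ κ′ up others eq

      cases : ∀ t → toll κ ≡ t → ∀ α → act (control κ) ≡ α → ∀ us → applyAll us (current κ) ≡ S →
              Sound S (R′.tick x (κ , us))
      cases (suc t) tolls α acts us pending = subst (Sound S) (sym (tick-paying x κ us tolls))
        record { represents = represents ; upToDate = keep (phase κ) upToDate ; pending = pending }
        where
        keep : ∀ ph → UpToDate ph κ → UpToDate ph (record κ { toll = t })
        keep (opening i)   up = tt
        keep (serving i s) up = tt
        keep (seeking i)   up = tt
        keep (finishing i) up = up
        keep resting       up = up
      cases zero tolls (reset j) acts us pending = subst (Sound S) (sym (tick-acting x κ us tolls acts λ ()))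
        (acting us (perform (reset j) x κ) _ pending (not-wait acts λ ()) refl refl
          (represents-update {κ} (current κ) (copies κ) j _ represents (represents-construct A (current κ)))
          (up-reset (control κ) _ (perform (reset j) x κ) j acts))
      cases zero tolls (run j) acts us pending = subst (Sound S) (sym (tick-acting x κ us tolls acts λ ()))
        (acting us (perform (run j) x κ) _ pending (not-wait acts λ ()) refl refl
          (represents-update {κ} (current κ) (copies κ) j _ represents (represents-tick A x (represents j)))
          (up-run (control κ) _ (perform (run j) x κ) j acts upToDate (λ i i≢j → lookup∘update′ i≢j (copies κ) _) refl))
      cases zero tolls (point j) acts us pending = subst (Sound S) (sym (tick-acting x κ us tolls acts λ ()))
        (acting us (perform (point j) x κ) _ pending (not-wait acts λ ()) refl refl represents
          (up-point (control κ) _ (perform (point j) x κ) j acts refl refl))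
      cases zero tolls wait acts [] pending = subst (Sound S) (sym (tick-wait x κ tolls acts))
        record { represents = represents ; upToDate = upToDate ; pending = pending }
      cases zero tolls wait acts (u ∷ us) pending = subst (Sound S) (sym (tick-arrival x κ u us tolls acts))
        record
          { represents = λ i → subst (Represents A (apply u (current κ))) (sym (lookup-map i (enqueue u) (copies κ)))
                                 (represents-enqueue A u (represents i))
          ; upToDate   = arrive (control κ) (proj₂ (wait⇒resting (control κ) acts))
          ; pending    = pending }
        where
        arrive : ∀ c {clock} → c ≡ (clock , resting) → UpToDate (phaseOf (next c false)) (receive u κ)
        arrive _ refl = tt

    sound-run : ∀ S {M} (xs : Vec (Fin A.symbols) M) p → Sound S p → Sound S (R′.run xs p)
    sound-run S []       p        sound = sound
    sound-run S (x ∷ xs) (κ , us) sound = sound-run S xs (R′.tick x (κ , us)) (sound-step S κ us x sound)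

    waiting⇒resting : ∀ κ → waiting κ ≡ true → phase κ ≡ resting
    waiting⇒resting κ waits with toll κ | act (control κ) in acts
    ... | zero | wait with wait⇒resting (control κ) acts
    ...   | clock , eq = cong phaseOf eq

    pointerCorrect : ∀ N → PointerCorrect N
    pointerCorrect N S us bounded xs up =
      represents⇒correct A
        (subst (λ S′ → Represents A S′ (copy κ (pointer κ)))
          (trans (cong (λ us → applyAll us (current κ)) (sym (proj₂ idle))) pending) (represents (pointer κ)))
        (subst (λ ph → UpToDate ph κ) (waiting⇒resting κ (proj₁ idle)) upToDate)
      where
      p : R′.Process
      p = R′.run xs (initially S , us)
      κ : Configuration
      κ = proj₁ p
      sound : Sound (applyAll us S) p
      sound = sound-run _ xs (initially S , us) record
        { represents = λ i → subst (Represents A S) (sym (lookup-replicate i (A.construct S , []))) (represents-construct A S)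
        ; upToDate   = λ i top<i → contradiction top<i (above-top i)
        ; pending    = refl }
      open Sound sound
      idle : waiting κ ≡ true × proj₂ p ≡ []
      idle = W′.caughtUp⁻ p up

    module _ (T : ℕ) where

      record Constructing (κ : Configuration) (j : Fin Q) (h : ℕ) : Set where
        field
          free     : toll κ ≡ 0
          finishes : phase κ ≡ finishing j
          noUpdate : ∀ i → proj₂ (copy κ i) ≡ []
          up       : ∀ i → toℕ j < toℕ i → R.caughtUp (copy κ i) ≡ true
          this     : W.Ready h (proj₁ (copy κ j))
          below    : ∀ i → toℕ i < toℕ j → W.Ready T (proj₁ (copy κ i))

      rested : ∀ {M} (xs : Vec (Fin A.symbols) M) κ → Rested κ → R′.caughtUp (R′.run xs (κ , [])) ≡ true
      rested [] κ (free , rests , _) = waiting-wait κ free (resting⇒wait (control κ) rests)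
      rested (x ∷ xs) κ (free , rests , up) =
        subst (λ p → R′.caughtUp (R′.run xs p) ≡ true) (sym (tick-wait x κ free (resting⇒wait (control κ) rests)))
          (rested xs κ (free , rests , up))

      Continued : Fin Q → ℕ → Configuration → Set
      Continued j h κ = (∃[ h′ ] h ≡ suc h′ × Constructing κ j h′) ⊎
                        (∃[ j′ ] j ≡ suc j′ × Constructing κ (inject₁ j′) T) ⊎ Rested κ

      constructing-step : ∀ κ x j h → Constructing κ j h →
        let p = R′.tick x (κ , []) in proj₂ p ≡ [] × Continued j h (proj₁ p)
      constructing-step κ x j h C =
        subst (λ p → proj₂ p ≡ [] × Continued j h (proj₁ p))
          (sym (tick-acting x κ [] free acts λ ())) (refl , go (R.caughtUp (copy κ′ j)) refl)
        where
        open Constructing C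
        acts : act (control κ) ≡ run j
        acts = finishing⇒run (control κ) finishes
        κ′ : Configuration
        κ′ = perform (run j) x κ
        others : ∀ i → i ≢ j → copy κ′ i ≡ copy κ i
        others i i≢j = lookup∘update′ i≢j (copies κ) _
        itself : copy κ′ j ≡ R.tick x (copy κ j)
        itself = lookup∘update j (copies κ) _
        tick-empty : ∀ p → proj₂ p ≡ [] → proj₂ (R.tick x p) ≡ []
        tick-empty (s , []) refl with A.idle s
        ... | true  = refl
        ... | false = refl
        empty : ∀ i → proj₂ (copy κ′ i) ≡ []
        empty i with i Fin.≟ j
        ... | yes refl = trans (cong proj₂ itself) (tick-empty (copy κ j) (noUpdate j))
        ... | no  i≢j  = trans (cong proj₂ (others i i≢j)) (noUpdate i)
        phase′ : ∀ o → R.caughtUp (copy κ′ j) ≡ o → phase κ′ ≡ nextPhase (finishing j) o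
        phase′ o eq = trans (cong phaseOf (next-acting (control κ) (R.caughtUp (copy κ′ j)) (λ waits → contradiction (trans (sym acts) waits) λ ())))
          (cong₂ nextPhase finishes eq)
        stays : ∀ (j : Fin Q) → nextPhase (finishing j) false ≡ finishing j
        stays zero    = refl
        stays (suc j) = refl
        above′ : ∀ i → toℕ j < toℕ i → R.caughtUp (copy κ′ i) ≡ true
        above′ i j<i = trans (cong R.caughtUp (others i (λ { refl → <-irrefl refl j<i }))) (up i j<i)
        below′ : ∀ i → toℕ i < toℕ j → W.Ready T (proj₁ (copy κ′ i))
        below′ i i<j = subst (λ p → W.Ready T (proj₁ p)) (sym (others i (λ { refl → <-irrefl refl i<j }))) (below i i<j)
        stepped : ∀ p h → proj₂ p ≡ [] → W.Ready h (proj₁ p) → R.caughtUp (R.tick x p) ≡ false →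
                  ∃[ h′ ] h ≡ suc h′ × W.Ready h′ (proj₁ (R.tick x p))
        stepped (s , []) h refl ready behind with A.idle s in eq
        ... | true = contradiction (trans (sym behind) eq) λ ()
        stepped (s , []) zero     refl ready behind | false = contradiction (trans (sym eq) (ready [])) λ ()
        stepped (s , []) (suc h′) refl ready behind | false = h′ , refl , W.Ready-step x eq ready
        go : ∀ o → R.caughtUp (copy κ′ j) ≡ o → Continued j h κ′
        go false behind = let (h′ , eq , ready) = stepped (copy κ j) h (noUpdate j) this (trans (cong R.caughtUp (sym itself)) behind) in
          inj₁ (h′ , eq , record
            { free = free ; finishes = trans (phase′ false behind) (stays j) ; noUpdate = empty ; up = above′
            ; this = subst (λ p → W.Ready h′ (proj₁ p)) (sym itself) ready ; below = below′ })
        go true done = finished j refl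
          where
          finished : ∀ k → j ≡ k → Continued j h κ′
          finished zero    refl = inj₂ (inj₂ (free , phase′ true done , all))
            where
            all : ∀ i → R.caughtUp (copy κ′ i) ≡ true
            all zero    = done
            all (suc i) = above′ (suc i) (s≤s z≤n)
          finished (suc k) refl = inj₂ (inj₁ (k , refl , record
            { free = free ; finishes = phase′ true done ; noUpdate = empty ; up = up′
            ; this = below′ (inject₁ k) (s≤s (≤-reflexive (toℕ-inject₁ k)))
            ; below = λ i i<k → below′ i (≤-trans i<k (≤-trans (≤-reflexive (toℕ-inject₁ k)) (n≤1+n _))) }))
            where
            up′ : ∀ i → toℕ (inject₁ k) < toℕ i → R.caughtUp (copy κ′ i) ≡ true
            up′ i k<i with above-inject₁ k i k<i
            ... | inj₁ refl = done
            ... | inj₂ lt   = above′ i lt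

      constructed : ∀ {M} (xs : Vec (Fin A.symbols) M) κ j h → Constructing κ j h → h + suc (toℕ j * suc T) ≤ M →
                    R′.caughtUp (R′.run xs (κ , [])) ≡ true
      constructed []       κ j h C le = contradiction (≤-trans (≤-reflexive (sym (+-suc h _))) le) λ ()
      constructed (x ∷ xs) κ j h C le = go (R′.tick x (κ , [])) (constructing-step κ x j h C)
        where
        go : ∀ p → proj₂ p ≡ [] × Continued j h (proj₁ p) →
             R′.caughtUp (R′.run xs p) ≡ true
        go (κ′ , _) (refl , inj₁ (h′ , refl , C′)) = constructed xs κ′ j h′ C′ (s≤s⁻¹ le)
        go (κ′ , _) (refl , inj₂ (inj₁ (j′ , refl , C′))) = constructed xs κ′ (inject₁ j′) T C′
          (≤-trans (≤-reflexive (trans (cong (λ m → T + suc (m * suc T)) (toℕ-inject₁ j′)) (+-suc T _)))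
            (s≤s⁻¹ (≤-trans (m≤n+m _ h) le)))
        go (κ′ , _) (refl , inj₂ (inj₂ rest)) = rested xs κ′ rest

      -- The copies are constructed one after the other. The extra unit for each copy covers `T` =
      -- 0: a copy that is idle at once still takes a unit to be noticed.
      constructedWithin : ∀ S → R.ConstructedWithin T S → R′.ConstructedWithin (Q * suc T) S
      constructedWithin S ready xs = constructed xs (initially S) top T
        record
          { free = refl ; finishes = refl ; noUpdate = λ i → cong proj₂ (copy≡ i)
          ; up = λ i top<i → contradiction top<i (above-top i)
          ; this = subst (λ p → W.Ready T (proj₁ p)) (sym (copy≡ top)) ready
          ; below = λ i _ → subst (λ p → W.Ready T (proj₁ p)) (sym (copy≡ i)) ready }
        (≤-reflexive (trans (cong (λ m → T + suc (m * suc T)) (toℕ-fromℕ Q′)) (+-suc T _)))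
        where
        copy≡ : ∀ i → copy (initially S) i ≡ (A.construct S , [])
        copy≡ i = lookup-replicate i (A.construct S , [])

  -- Arithmetic of the bounds

  ∏-const : ∀ n c → ∏ {n} (λ _ → c) ≡ c ^ n
  ∏-const zero    c = refl
  ∏-const (suc n) c = cong (c *_) (∏-const n c)

  ∏-++ : ∀ m n (f : Fin (m + n) → ℕ) → ∏ f ≡ ∏ (λ i → f (i ↑ˡ n)) * ∏ (λ j → f (m ↑ʳ j))
  ∏-++ zero    n f = sym (*-identityˡ _)
  ∏-++ (suc m) n f = trans (cong (f zero *_) (∏-++ m n (f ∘ suc))) (sym (*-assoc (f zero) _ _))

  half : ∀ m → Fin (m + m) → Bool
  half m i = [ const false , const true ]′ (splitAt m i)

  ∏-half : ∀ m G x y → ∏ (λ i → if does (half m i Bool.≟ G) then x else y) ≡ x ^ m * y ^ m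
  ∏-half m G x y = trans (∏-++ m m _) (trans (cong₂ _*_ (∏-cong left) (∏-cong right)) (go G))
    where
    choose : Bool → ℕ
    choose s = if does (s Bool.≟ G) then x else y
    left : ∀ i → choose (half m (i ↑ˡ m)) ≡ choose false
    left i rewrite splitAt-↑ˡ m i m = refl
    right : ∀ j → choose (half m (m ↑ʳ j)) ≡ choose true
    right j rewrite splitAt-↑ʳ m m j = refl
    go : ∀ G → ∏ {m} (λ _ → if does (false Bool.≟ G) then x else y) * ∏ {m} (λ _ → if does (true Bool.≟ G) then x else y)
               ≡ x ^ m * y ^ m
    go false = cong₂ _*_ (∏-const m x) (∏-const m y)
    go true  = trans (cong₂ _*_ (∏-const m y) (∏-const m x)) (*-comm (y ^ m) (x ^ m))

  n<2^n : ∀ n → n < 2 ^ n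
  n<2^n zero    = s≤s z≤n
  n<2^n (suc n) = ≤-trans (+-mono-≤ (m^n>0 2 n) (n<2^n n)) (≤-reflexive (cong (2 ^ n +_) (sym (+-identityʳ (2 ^ n)))))

  ⌈log₂⌉-suc : ∀ n → 2 ≤ n → ⌈log₂ n ⌉ ≡ suc ⌈log₂ ⌈ n /2⌉ ⌉
  ⌈log₂⌉-suc n 2≤n = sym (trans (cong suc (⌈log₂⌈n/2⌉⌉≡⌈log₂n⌉∸1 n)) (m+[n∸m]≡n (⌈log₂⌉-mono-≤ 2≤n)))

  1≤⌈log₂⌉ : ∀ {n} → 2 ≤ n → 1 ≤ ⌈log₂ n ⌉
  1≤⌈log₂⌉ 2≤n = ⌈log₂⌉-mono-≤ 2≤n

  ⌈n/2⌉-lower : ∀ n → n ≤ 2 * ⌈ n /2⌉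
  ⌈n/2⌉-lower n = begin
    n                       ≡⟨ ⌊n/2⌋+⌈n/2⌉≡n n ⟨
    ⌊ n /2⌋ + ⌈ n /2⌉       ≤⟨ +-monoˡ-≤ ⌈ n /2⌉ (⌊n/2⌋≤⌈n/2⌉ n) ⟩
    ⌈ n /2⌉ + ⌈ n /2⌉       ≡⟨ cong (⌈ n /2⌉ +_) (+-identityʳ ⌈ n /2⌉) ⟨
    2 * ⌈ n /2⌉             ∎
    where open ≤-Reasoning

  ⌈n/2⌉-upper : ∀ n → 2 * ⌈ n /2⌉ ≤ suc n
  ⌈n/2⌉-upper zero          = z≤n
  ⌈n/2⌉-upper (suc zero)    = ≤-refl
  ⌈n/2⌉-upper (suc (suc n)) = ≤-trans (≤-reflexive (*-suc 2 ⌈ n /2⌉)) (s≤s (s≤s (⌈n/2⌉-upper n)))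

  ⌈log₂n⌉≤n : ∀ n → ⌈log₂ n ⌉ ≤ n
  ⌈log₂n⌉≤n = <-rec _ λ where
      zero          rec → z≤n
      (suc zero)    rec → z≤n
      (suc (suc n)) rec → begin
        ⌈log₂ 2+ n ⌉                ≡⟨ ⌈log₂⌉-suc (2+ n) (s≤s (s≤s z≤n)) ⟩
        suc ⌈log₂ ⌈ 2+ n /2⌉ ⌉      ≤⟨ s≤s (rec (⌈n/2⌉<n n)) ⟩
        suc ⌈ 2+ n /2⌉              ≤⟨ ⌈n/2⌉<n n ⟩
        2+ n                        ∎
    where open ≤-Reasoning

  n≤2^⌈log₂n⌉ : ∀ n → n ≤ 2 ^ ⌈log₂ n ⌉
  n≤2^⌈log₂n⌉ = <-rec _ λ where
      zero          rec → z≤n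
      (suc zero)    rec → ≤-refl
      (suc (suc n)) rec → begin
        2+ n                          ≤⟨ ⌈n/2⌉-lower (2+ n) ⟩
        2 * ⌈ 2+ n /2⌉                ≤⟨ *-monoʳ-≤ 2 (rec (⌈n/2⌉<n n)) ⟩
        2 ^ suc ⌈log₂ ⌈ 2+ n /2⌉ ⌉    ≡⟨ cong (2 ^_) (⌈log₂⌉-suc (2+ n) (s≤s (s≤s z≤n))) ⟨
        2 ^ ⌈log₂ 2+ n ⌉              ∎
    where open ≤-Reasoning

  -- The summand 2 makes the induction work: rounding up in `⌈ n /2⌉` costs 2 after doubling twice,
  -- and the stronger bound absorbs it.
  2^⌈log₂n⌉+2≤2n : ∀ n → 2 ≤ n → 2 ^ ⌈log₂ n ⌉ + 2 ≤ 2 * n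
  2^⌈log₂n⌉+2≤2n = <-rec _ λ where
      (suc zero) rec (s≤s ())
      (suc (suc zero)) rec _ → ≤-refl
      (suc (suc (suc n))) rec _ → +-cancelʳ-≤ 2 _ _ (begin
        2 ^ ⌈log₂ 3 + n ⌉ + 2 + 2             ≡⟨ cong (λ l → 2 ^ l + 2 + 2) (⌈log₂⌉-suc (3 + n) (s≤s (s≤s z≤n))) ⟩
        2 * 2 ^ ⌈log₂ ⌈ 3 + n /2⌉ ⌉ + 2 + 2   ≡⟨ rearrange (2 ^ ⌈log₂ ⌈ 3 + n /2⌉ ⌉) ⟩
        2 * (2 ^ ⌈log₂ ⌈ 3 + n /2⌉ ⌉ + 2)     ≤⟨ *-monoʳ-≤ 2 (rec (⌈n/2⌉<n (suc n)) (s≤s (s≤s z≤n))) ⟩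
        2 * (2 * ⌈ 3 + n /2⌉)                 ≤⟨ *-monoʳ-≤ 2 (⌈n/2⌉-upper (3 + n)) ⟩
        2 * suc (3 + n)                       ≡⟨ trans (*-suc 2 (3 + n)) (+-comm 2 _) ⟩
        2 * (3 + n) + 2                       ∎)
    where
    open ≤-Reasoning
    rearrange : ∀ p → 2 * p + 2 + 2 ≡ 2 * (p + 2)
    rearrange = solve-∀

  -- For positive `n` the additive constants are absorbed into the powers. At 0, where positive
  -- powers vanish, the additive `K` has to carry the bound, so it must dominate `4 * (k * l)`.
  polynomial-* : ∀ {f g} → Polynomial f → Polynomial g → Polynomial (λ n → f n * g n)
  polynomial-* {f} {g} (k , f≤) (l , g≤) = K , λ n → ≤-trans (*-mono-≤ (f≤ n) (g≤ n)) (bound n)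
    where
    open ≤-Reasoning
    K : ℕ
    K = 4 * (k * l) + (k + l)
    expand : ∀ k l p → (k * p + k) * (l * p + l) ≡ k * l * (p * p) + 2 * (k * l) * p + k * l
    expand = solve-∀
    rearrange : ∀ k l x y → (k * x + k * x) * (l * y + l * y) ≡ 4 * (k * l) * (x * y)
    rearrange = solve-∀
    bound : ∀ n → (k * n ^ k + k) * (l * n ^ l + l) ≤ K * n ^ K + K
    bound zero = begin
      (k * 0 ^ k + k) * (l * 0 ^ l + l)  ≤⟨ *-mono-≤ (twice k) (twice l) ⟩
      (k * 1 + k * 1) * (l * 1 + l * 1)  ≡⟨ rearrange k l 1 1 ⟩
      4 * (k * l) * 1                    ≡⟨ *-identityʳ _ ⟩
      4 * (k * l)                        ≤⟨ m≤m+n _ (k + l) ⟩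
      K                                  ≤⟨ m≤n+m K (K * 0 ^ K) ⟩
      K * 0 ^ K + K                      ∎
      where
      0^≤1 : ∀ k → 0 ^ k ≤ 1
      0^≤1 zero    = ≤-refl
      0^≤1 (suc k) = z≤n
      twice : ∀ k → k * 0 ^ k + k ≤ k * 1 + k * 1
      twice k = +-mono-≤ (*-monoʳ-≤ k (0^≤1 k)) (≤-reflexive (sym (*-identityʳ k)))
    bound n@(suc _) = begin
      (k * n ^ k + k) * (l * n ^ l + l)                    ≤⟨ *-mono-≤ (twice k) (twice l) ⟩
      (k * n ^ k + k * n ^ k) * (l * n ^ l + l * n ^ l)    ≡⟨ rearrange k l (n ^ k) (n ^ l) ⟩
      4 * (k * l) * (n ^ k * n ^ l)                        ≡⟨ cong (4 * (k * l) *_) (^-distribˡ-+-* n k l) ⟨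
      4 * (k * l) * n ^ (k + l)                            ≤⟨ *-mono-≤ (m≤m+n (4 * (k * l)) (k + l)) (^-monoʳ-≤ n (m≤n+m (k + l) (4 * (k * l)))) ⟩
      K * n ^ K                                            ≤⟨ m≤m+n _ K ⟩
      K * n ^ K + K                                        ∎
      where
      twice : ∀ k → k * n ^ k + k ≤ k * n ^ k + k * n ^ k
      twice k = +-monoʳ-≤ (k * n ^ k) (≤-trans (≤-reflexive (sym (*-identityʳ k))) (*-monoʳ-≤ k (m^n>0 n k)))

  polynomial-suc : ∀ {f} → Polynomial f → Polynomial (suc ∘ f)
  polynomial-suc {f} (k , f≤) = suc k , bound
    where
    bound : ∀ n → suc (f n) ≤ suc k * n ^ suc k + suc k
    bound zero    = begin
      suc (f 0)                  ≤⟨ s≤s (f≤ 0) ⟩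
      suc (k * 0 ^ k + k)        ≤⟨ s≤s (+-monoˡ-≤ k (k*0^k≤0 k)) ⟩
      suc k                      ≤⟨ m≤n+m (suc k) _ ⟩
      suc k * 0 ^ suc k + suc k  ∎
      where
      open ≤-Reasoning
      k*0^k≤0 : ∀ k → k * 0 ^ k ≤ 0
      k*0^k≤0 zero    = z≤n
      k*0^k≤0 (suc k) = ≤-reflexive (*-zeroʳ (suc k))
    bound n@(suc _) = begin
      suc (f n)                  ≤⟨ s≤s (f≤ n) ⟩
      suc (k * n ^ k + k)        ≡⟨ +-suc _ k ⟨
      k * n ^ k + suc k          ≤⟨ +-monoˡ-≤ (suc k) (*-mono-≤ (n≤1+n k) (^-monoʳ-≤ n (n≤1+n k))) ⟩
      suc k * n ^ suc k + suc k  ∎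
      where open ≤-Reasoning

  polynomial-linear : ∀ {f} → (∀ n → f n ≤ 2 * n + 2) → Polynomial f
  polynomial-linear {f} f≤ = 2 , λ n → ≤-trans (f≤ n) (+-monoˡ-≤ 2 (*-monoʳ-≤ 2 (square n)))
    where
    square : ∀ n → n ≤ n ^ 2
    square zero    = z≤n
    square (suc n) = m≤m*n (suc n) (suc n * 1) {{m*n≢0 (suc n) 1}}

  -- Provides a period `L` that is a power of 2, exceeds the construction time and is still
  -- polynomial in `n`.
  polynomial<2^ : ∀ k n → 2 ≤ n → k * n ^ k + k < 2 ^ ((1 + 3 * k) * ⌈log₂ n ⌉)
  polynomial<2^ k n 2≤n = begin-strict
    k * n ^ k + k                   ≤⟨ +-mono-≤ (*-monoʳ-≤ k n^k≤x) (≤-trans (≤-reflexive (sym (*-identityʳ k))) (*-monoʳ-≤ k 1≤x)) ⟩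
    k * x + k * x                   <⟨ m<m+n _ 1≤x ⟩
    k * x + k * x + x               ≡⟨ rearrange k x ⟩
    (1 + 2 * k) * x                 ≤⟨ *-monoˡ-≤ x (<⇒≤ (n<2^n (1 + 2 * k))) ⟩
    2 ^ (1 + 2 * k) * x             ≡⟨ ^-distribˡ-+-* 2 (1 + 2 * k) (l * k) ⟨
    2 ^ (1 + 2 * k + l * k)         ≤⟨ ^-monoʳ-≤ 2 (+-monoˡ-≤ (l * k) (≤-trans (≤-reflexive (sym (*-identityʳ (1 + 2 * k)))) (*-monoʳ-≤ (1 + 2 * k) (1≤⌈log₂⌉ 2≤n)))) ⟩
    2 ^ ((1 + 2 * k) * l + l * k)   ≡⟨ cong (2 ^_) (rearrange′ k l) ⟩
    2 ^ ((1 + 3 * k) * l)           ∎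
    where
    open ≤-Reasoning
    l x : ℕ
    l = ⌈log₂ n ⌉
    x = 2 ^ (l * k)
    n^k≤x : n ^ k ≤ x
    n^k≤x = ≤-trans (^-monoˡ-≤ k (n≤2^⌈log₂n⌉ n)) (≤-reflexive (^-*-assoc 2 l k))
    1≤x : 1 ≤ x
    1≤x = m^n>0 2 (l * k)
    rearrange : ∀ k x → k * x + k * x + x ≡ (1 + 2 * k) * x
    rearrange = solve-∀
    rearrange′ : ∀ k l → (1 + 2 * k) * l + l * k ≡ (1 + 3 * k) * l
    rearrange′ = solve-∀

  -- From counts to rational bounds

  module Fractions where
    open import Data.Integer.Base using (+_; -[1+_])

    ≤-/⇒ : ∀ {m n} d .{{_ : NonZero d}} → (+ m / d) ℚ.≤ fromℕ n → m ≤ n * d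
    ≤-/⇒ {m} {n} d@(suc _) (*≤* le) = subst (_≤ n * d) (*-identityʳ m)
      (ℤ.drop‿+≤+ (subst₂ ℤ._≤_ (sym (ℤ.pos-* m 1)) (sym (ℤ.pos-* n d)) le))

    1≤-/ : ∀ {m} d .{{_ : NonZero d}} → d ≤ m → 1ℚᵘ ℚ.≤ (+ m / d)
    1≤-/ {m} d@(suc _) d≤m = *≤* (subst₂ ℤ._≤_ (sym (ℤ.*-identityˡ (+ d))) (sym (ℤ.*-identityʳ (+ m))) (ℤ.+≤+ d≤m))

    *-/-≤1 : ∀ m k d .{{_ : NonZero d}} → m * k ≤ d → fromℕ m ℚ.* (+ k / d) ℚ.≤ 1ℚᵘ
    *-/-≤1 m k d@(suc d-1) le = *≤* (subst₂ ℤ._≤_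
      (trans (ℤ.pos-* m k) (sym (ℤ.*-identityʳ (+ m ℤ.* + k))))
      (trans (cong +_ (sym (+-identityʳ d))) (sym (ℤ.*-identityˡ _)))
      (ℤ.+≤+ le))

    -- The `⊔ 1` keeps budgets positive even where no admissible update constrains `α`; positivity
    -- is needed to cancel this factor from the tail bound.
    natural : ℚᵘ → ℕ
    natural α = ∣ ceiling α ∣ ⊔ 1

    i≤∣i∣ : ∀ i → i ℤ.≤ + ∣ i ∣
    i≤∣i∣ (+ n)    = ℤ.≤-refl
    i≤∣i∣ -[1+ n ] = ℤ.-≤+

    ceiling-lower : ∀ n d → n ℤ.≤ ceiling (mkℚᵘ n d) ℤ.* + suc d
    ceiling-lower n d = subst₂ ℤ._≤_ (ℤ.neg-involutive n) (ℤ.neg-distribˡ-* f (+ suc d))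
      (ℤ.neg-mono-≤ (ℤ.[n/d]*d≤n (ℤ.- n) (+ suc d)))
      where
      f : ℤ
      f = (ℤ.- n) ℤ./ + suc d

    ≤-natural : ∀ α → α ℚ.≤ fromℕ (natural α)
    ≤-natural α@(mkℚᵘ n d) = *≤* (begin
      n ℤ.* + 1                            ≡⟨ ℤ.*-identityʳ n ⟩
      n                                    ≤⟨ ceiling-lower n d ⟩
      ceiling α ℤ.* + suc d                ≤⟨ ℤ.*-monoʳ-≤-nonNeg (+ suc d) (i≤∣i∣ (ceiling α)) ⟩
      + ∣ ceiling α ∣ ℤ.* + suc d          ≤⟨ ℤ.*-monoʳ-≤-nonNeg (+ suc d) (ℤ.+≤+ (m≤m⊔n ∣ ceiling α ∣ 1)) ⟩
      + natural α ℤ.* + suc d              ∎)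
      where open ℤ.≤-Reasoning

    -- Rounding up adds less than 1, and 1 is at most `α`. This factor 2 is why the final constants
    -- have to be at least `2 * K₁`.
    natural-upper : ∀ α → 1ℚᵘ ℚ.≤ α → ∃[ n ] ∃[ d ] α ≡ mkℚᵘ (+ n) d × natural α * suc d ≤ 2 * n
    natural-upper (mkℚᵘ -[1+ n ] d) (*≤* ())
    natural-upper α@(mkℚᵘ (+ n) d) (*≤* 1≤α) = n , d , refl , bound
      where
      sd≤n : suc d ≤ n
      sd≤n = ℤ.drop‿+≤+ (subst₂ ℤ._≤_ (ℤ.*-identityˡ (+ suc d)) (ℤ.*-identityʳ (+ n)) 1≤α)
      f y : ℤ
      f = (ℤ.- (+ n)) ℤ./ + suc d
      y = f ℤ.* + suc d
      r : ℕ
      r = (ℤ.- (+ n)) ℤ.% + suc d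
      c*d≡n+r : ceiling α ℤ.* + suc d ≡ + (n + r)
      c*d≡n+r = begin
        ℤ.- f ℤ.* + suc d               ≡⟨ ℤ.neg-distribˡ-* f (+ suc d) ⟨
        ℤ.- y                           ≡⟨ ℤ.+-identityˡ (ℤ.- y) ⟨
        + 0 ℤ.+ ℤ.- y                   ≡⟨ cong (ℤ._+ ℤ.- y) (ℤ.+-inverseʳ (+ r)) ⟨
        + r ℤ.+ ℤ.- (+ r) ℤ.+ ℤ.- y     ≡⟨ ℤ.+-assoc (+ r) (ℤ.- (+ r)) (ℤ.- y) ⟩
        + r ℤ.+ (ℤ.- (+ r) ℤ.+ ℤ.- y)   ≡⟨ cong (λ z → + r ℤ.+ z) (ℤ.neg-distrib-+ (+ r) y) ⟨
        + r ℤ.+ ℤ.- (+ r ℤ.+ y)         ≡⟨ cong (λ z → + r ℤ.+ ℤ.- z) (ℤ.a≡a%n+[a/n]*n (ℤ.- (+ n)) (+ suc d)) ⟨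
        + r ℤ.+ ℤ.- (ℤ.- (+ n))         ≡⟨ cong (λ z → + r ℤ.+ z) (ℤ.neg-involutive (+ n)) ⟩
        + r ℤ.+ + n                     ≡⟨ ℤ.+-comm (+ r) (+ n) ⟩
        + (n + r)                       ∎
        where open ≡-Reasoning
      bound : natural α * suc d ≤ 2 * n
      bound = begin
        (∣ ceiling α ∣ ⊔ 1) * suc d               ≡⟨ *-distribʳ-⊔ (suc d) ∣ ceiling α ∣ 1 ⟩
        ∣ ceiling α ∣ * suc d ⊔ 1 * suc d         ≤⟨ ⊔-lub (≤-trans (≤-reflexive (trans (sym (ℤ.abs-* (ceiling α) (+ suc d))) (cong ∣_∣ c*d≡n+r)))
                                                       (+-monoʳ-≤ n (≤-trans (<⇒≤ (ℤ.n%d<d (ℤ.- (+ n)) (+ suc d))) sd≤n)))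
                                                     (≤-trans (≤-reflexive (*-identityˡ (suc d))) (≤-trans sd≤n (m≤m+n n n))) ⟩
        n + n                                     ≡⟨ cong (λ m → n + m) (+-identityʳ n) ⟨
        2 * n                                     ∎
        where open ≤-Reasoning

    ≤-scaled : ∀ {m K n d y} e .{{_ : NonZero e}} → m * suc d ≤ K * n * y * e →
               (+ m / e) ℚ.≤ fromℕ K ℚ.* mkℚᵘ (+ n) d ℚ.* fromℕ y
    ≤-scaled {m} {K} {n} {d} {y} e@(suc _) le = *≤* (subst₂ ℤ._≤_
      (trans (cong (λ z → + (m * z)) (sym denominator)) (ℤ.pos-* m (suc ((d + 0) * 1))))
      (trans (ℤ.pos-* (K * n * y) e) (cong (ℤ._* + e)
        (trans (ℤ.pos-* (K * n) y) (cong (ℤ._* + y) (ℤ.pos-* K n)))))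
      (ℤ.+≤+ le))
      where
      denominator : suc ((d + 0) * 1) ≡ suc d
      denominator = cong suc (trans (*-identityʳ (d + 0)) (+-identityʳ d))

    0≤*0 : ∀ p e .{{_ : NonZero e}} → (+ 0 / e) ℚ.≤ p ℚ.* fromℕ 0
    0≤*0 (mkℚᵘ n d) e@(suc _) = *≤* (ℤ.≤-reflexive (sym (cong (ℤ._* + e) (ℤ.*-zeroʳ n))))

    fromℕ-* : ∀ m n → fromℕ m ℚ.* fromℕ n ℚ.≃ fromℕ (m * n)
    fromℕ-* m n = ℚ.*≡* (cong (ℤ._* + 1) (sym (ℤ.pos-* m n)))

    ≤-natural-scaled : ∀ {α m K y} K₁ e .{{_ : NonZero e}} → 1ℚᵘ ℚ.≤ α → m ≤ K₁ * natural α * y * e → 2 * K₁ ≤ K →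
                       (+ m / e) ℚ.≤ fromℕ K ℚ.* α ℚ.* fromℕ y
    ≤-natural-scaled {α} {m} {K} {y} K₁ e 1≤α m≤ 2K₁≤K with natural-upper α 1≤α
    ... | n , d , refl , a≤ = ≤-scaled {m} {K} {n} {d} {y} e (begin
      m * suc d                               ≤⟨ *-monoˡ-≤ (suc d) m≤ ⟩
      K₁ * natural α * y * e * suc d          ≡⟨ rearrange K₁ (natural α) y e (suc d) ⟩
      K₁ * y * e * (natural α * suc d)        ≤⟨ *-monoʳ-≤ (K₁ * y * e) a≤ ⟩
      K₁ * y * e * (2 * n)                    ≡⟨ rearrange′ K₁ y e n ⟩
      2 * K₁ * n * y * e                      ≤⟨ *-monoˡ-≤ e (*-monoˡ-≤ y (*-monoˡ-≤ n 2K₁≤K)) ⟩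
      K * n * y * e                           ∎)
      where
      open ≤-Reasoning
      rearrange : ∀ k a y e d → k * a * y * e * d ≡ k * y * e * (a * d)
      rearrange = solve-∀
      rearrange′ : ∀ k y e n → k * y * e * (2 * n) ≡ 2 * k * n * y * e
      rearrange′ = solve-∀

    1≤natural : ∀ α → 1 ≤ natural α
    1≤natural α = m≤n⊔m ∣ ceiling α ∣ 1

    ≤-natural-rate : ∀ {α s K y n₀} K₁ e .{{_ : NonZero e}} → 1ℚᵘ ℚ.≤ α → s ≤ e * (n₀ * (K₁ * natural α * y)) → 2 * K₁ ≤ K →
                     (+ s / e) ℚ.≤ fromℕ K ℚ.* α ℚ.* fromℕ y ℚ.* fromℕ n₀
    ≤-natural-rate {α} {s} {K} {y} {n₀} K₁ e 1≤α s≤ 2K₁≤K =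
      ℚ.≤-respʳ-≃ (ℚ.≃-sym (ℚ.≃-trans (ℚ.*-assoc (fromℕ K ℚ.* α) (fromℕ y) (fromℕ n₀))
                    (ℚ.*-congˡ {fromℕ K ℚ.* α} (fromℕ-* y n₀))))
        (≤-natural-scaled {α} {s} {K} {y * n₀} K₁ e 1≤α
          (≤-trans s≤ (≤-reflexive (rearrange e n₀ K₁ (natural α) y))) 2K₁≤K)
      where
      rearrange : ∀ p n k a y → p * (n * (k * a * y)) ≡ k * a * (y * n) * p
      rearrange = solve-∀

  open Fractions public

  rarely-late : ∀ {X : Set} {α K y d m} K₁ e .{{_ : NonZero e}} (xs : List X) (τ τ′ : X → ℕ) deadline →
    1ℚᵘ ℚ.≤ α → deadline ≤ K₁ * natural α * y → 2 * K₁ ≤ K → (∀ x → τ x ≡ τ′ x) → d ≤ m →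
    m * ∑ xs (λ x → indicator (deadline <ᵇ τ′ x)) ≤ e →
    fromℕ d ℚ.* (ℤ.+ length (filter (λ x → fromℕ K ℚ.* α ℚ.* fromℕ y ℚ.<? fromℕ (τ x)) xs) / e) ℚ.≤ 1ℚᵘ
  rarely-late {X} {α} {K} {y} {d} {m} K₁ e xs τ τ′ deadline 1≤α deadline≤ 2K₁≤K τ≡τ′ d≤m m*late≤e =
    *-/-≤1 d _ e (≤-trans (*-mono-≤ d≤m (length-filter-≤ (λ x → t ℚ.<? fromℕ (τ x)) late late-if xs)) m*late≤e)
    where
    t : ℚᵘ
    t = fromℕ K ℚ.* α ℚ.* fromℕ y
    late : X → ℕ
    late x = indicator (deadline <ᵇ τ′ x)
    soon : ∀ x → τ′ x ≤ deadline → fromℕ (τ x) ℚ.≤ t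
    soon x τ≤ = ≤-natural-scaled {α} {τ x} {K} {y} K₁ 1 1≤α
      (≤-trans (≤-reflexive (τ≡τ′ x)) (≤-trans τ≤ (≤-trans deadline≤ (≤-reflexive (sym (*-identityʳ _)))))) 2K₁≤K
    late-if : ∀ x → t ℚ.< fromℕ (τ x) → 1 ≤ late x
    late-if x slow = ≤-reflexive (cong indicator (sym (<⇒<ᵇ≡true {deadline} {τ′ x} (≰⇒> (λ τ≤ →
      ℚ.<-irrefl ℚ.≃-refl (ℚ.<-≤-trans slow (soon x τ≤)))))))

  -- The parameters for one value of n; l stands for ⌈log₂ n⌉.
  module Instance {P : Problem} (A : Algorithm P) (N : ℕ) (α : ℚᵘ)
    (worst : Run.WorstCaseExpectedTime A N α)
    (T : ℕ) (constructs : ∀ S → size S ≤ N → Run.ConstructedWithin A T S)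
    (c l D′ a r L′ : ℕ) (T<2^D′ : T < 2 ^ D′)
    (a≡ : a ≡ natural α) (r≡ : r ≡ 2 ^ c * (a * suc (suc D′))) (L≡2^D′ : suc L′ ≡ 2 ^ D′) where

    open Problem P

    side : Fin (suc l + suc l) → Bool
    side = half (suc l)

    private
      b = Algorithm.symbols A
      instance
        b≢0 : NonZero b
        b≢0 = Algorithm.nonZero A

    open Analysis A side (2 * r) L′ using (initially; module R′)

    T<L : T < suc L′
    T<L = subst (T <_) (sym L≡2^D′) T<2^D′

    2L≤2^D : suc L′ + suc L′ ≤ 2 ^ suc D′
    2L≤2^D = ≤-reflexive (cong₂ _+_ L≡2^D′ (trans L≡2^D′ (sym (+-identityʳ (2 ^ D′)))))

    fast : ∀ S us → Bounded N S us → ∀ us₁ u us₂ → us ≡ us₁ ++ u ∷ us₂ → ∀ M →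
           ∑ (sequences b M) (Run.time A (length us₂) (Algorithm.construct A S , us)) ≤ a * b ^ M
    fast S _ bounded us₁ u us₂ refl M =
      ≤-/⇒ (b ^ M) {{m^n≢0 b M}} (ℚ.≤-trans (worst S us₁ u us₂ bounded M) (subst (λ a → α ℚ.≤ fromℕ a) (sym a≡) (≤-natural α)))

    -- After `suc T` units the construction is over and the first update has been begun on every
    -- symbol sequence, so its truncated expected time is at least 1 already.
    1≤α : ∀ S u us → Bounded N S (u ∷ us) → 1ℚᵘ ℚ.≤ α
    1≤α S u us bounded = ℚ.≤-trans (1≤-/ (b ^ suc T) {{m^n≢0 b (suc T)}} (begin
        b ^ suc T                                    ≡⟨ trans (∑-sequences-const b (suc T) 1) (*-identityʳ (b ^ suc T)) ⟨
        ∑ (sequences b (suc T)) (λ _ → 1)            ≤⟨ ∑-mono (sequences b (suc T)) (Work.time-first A T _ u us (constructs S (proj₁ bounded))) ⟩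
        ∑ (sequences b (suc T)) (Run.time A (length us) (Algorithm.construct A S , u ∷ us)) ∎))
      (worst S [] u us bounded (suc T))
      where open ≤-Reasoning

    -- The value is the same for every number of updates; 0 stands in for that number here.
    deadline : ℕ
    deadline = Punctuality.deadline A side r L′ N a T (suc D′) (<⇒≤ T<L) 2L≤2^D constructs fast 0

    -- By the choice of `r`, the threshold of a copy is `2 ^ c` times the bound `a * Z` for its
    -- expected weighted work. Each of the `suc l` steady copies thus contributes a factor `2 ^ c`,
    -- while the other side contributes only normalization, and the common powers are cancelled.
    late-count : ∀ S us → Bounded N S us → 1 ≤ length us → ∀ M →
      (2 ^ c) ^ suc l * ∑ (sequences b M) (λ xs → indicator (deadline <ᵇ R′.time 0 (initially S , us) xs)) ≤ b ^ M
    late-count S (u ∷ us) bounded _ M = *-cancelˡ-≤ (B ^ Q′ * (a * Z) ^ g) {{factor≢0}} (begin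
      B ^ Q′ * (a * Z) ^ g * ((2 ^ c) ^ g * count)
        ≡⟨ rearrange (B ^ Q′) ((a * Z) ^ g) ((2 ^ c) ^ g) count ⟩
      B ^ Q′ * (count * ((2 ^ c) ^ g * (a * Z) ^ g))
        ≡⟨ cong (λ p → B ^ Q′ * (count * p)) (trans (sym (^-distribʳ-* g (2 ^ c) (a * Z)))
             (trans (cong (_^ g) (trans (rearrange′ (2 ^ c) a (suc (suc D′)) (2 ^ suc D′)) (cong (_* 2 ^ suc D′) (sym r≡))))
               (trans (sym (*-identityʳ _)) (cong (threshold ^ g *_) (sym (^-zeroˡ g)))))) ⟩
      B ^ Q′ * (count * (threshold ^ g * 1 ^ g))
        ≡⟨ cong (λ p → B ^ Q′ * (count * p)) (∏-half g G threshold 1) ⟨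
      B ^ Q′ * (count * ∏ (λ i → if does (side i Bool.≟ G) then threshold else 1))
        ≤⟨ late-bound S u us bounded refl M ⟩
      ∏ (λ i → if does (side i Bool.≟ G) then a * B * Z else B)
        ≡⟨ ∏-half g G (a * B * Z) B ⟩
      (a * B * Z) ^ g * B ^ g
        ≡⟨ cong (_* B ^ g) (trans (cong (_^ g) (rearrange″ a B Z)) (^-distribʳ-* g (a * Z) B)) ⟩
      (a * Z) ^ g * B ^ g * B ^ g
        ≡⟨ trans (*-assoc ((a * Z) ^ g) _ _) (cong ((a * Z) ^ g *_) (sym (^-distribˡ-+-* B g g))) ⟩
      (a * Z) ^ g * (B * B ^ Q′)
        ≡⟨ rearrange‴ ((a * Z) ^ g) B (B ^ Q′) ⟩
      B ^ Q′ * (a * Z) ^ g * B ∎)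
      where
      open ≤-Reasoning
      open Punctuality A side r L′ N a T (suc D′) (<⇒≤ T<L) 2L≤2^D constructs fast (suc (length us))
        using (steadyEnd; late-bound)
      G : Bool
      G = steadyEnd S u us bounded refl
      g Q′ B Z threshold count : ℕ
      g = suc l
      Q′ = l + suc l
      B = b ^ M
      Z = suc (suc D′) * 2 ^ suc D′
      threshold = r * 2 ^ suc D′
      count = ∑ (sequences b M) (λ xs → indicator (deadline <ᵇ R′.time 0 (initially S , u ∷ us) xs))
      factor≢0 : NonZero (B ^ Q′ * (a * Z) ^ g)
      factor≢0 = m*n≢0 (B ^ Q′) ((a * Z) ^ g) {{m^n≢0 B Q′ {{m^n≢0 b M}}}}
        {{m^n≢0 (a * Z) g {{m*n≢0 a Z {{>-nonZero (subst (1 ≤_) (sym a≡) (1≤natural α))}} {{m*n≢0 (suc (suc D′)) (2 ^ suc D′) {{_}} {{m^n≢0 2 (suc D′)}}}}}}}}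
      rearrange : ∀ p z t c → p * z * (t * c) ≡ p * (c * (t * z))
      rearrange = solve-∀
      rearrange′ : ∀ t a s d → t * (a * (s * d)) ≡ t * (a * s) * d
      rearrange′ = solve-∀
      rearrange″ : ∀ a b z → a * b * z ≡ a * z * b
      rearrange″ = solve-∀
      rearrange‴ : ∀ z b p → z * (b * p) ≡ p * z * b
      rearrange‴ = solve-∀

    timely : ∀ {C} → C ≡ Scheduler.controller side (2 * r) L′ → ∀ K₁ {K y d} → deadline ≤ K₁ * a * y → 2 * K₁ ≤ K → d ≤ (2 ^ c) ^ suc l →
             Run.TimeWithHighProbability (Copies.algorithm A C) N (fromℕ K ℚ.* α ℚ.* fromℕ y) d
    timely refl K₁ {K} {y} {d} deadline≤ 2K₁≤K d≤ S us u vs bounded M =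
      rarely-late {α = α} {K} {y} {d} {(2 ^ c) ^ suc l} K₁ (b ^ M) {{m^n≢0 b M}} (sequences b M)
        (R′.time (length vs) (initially S , us ++ u ∷ vs)) (R′.time 0 (initially S , us ++ u ∷ [])) deadline
        (large us bounded) (subst (λ a → deadline ≤ K₁ * a * y) a≡ deadline≤) 2K₁≤K
        (Work.time-prefix (Copies.algorithm A (Scheduler.controller side (2 * r) L′)) (initially S) us u vs) d≤
        (late-count S (us ++ u ∷ []) bounded′ 1≤length M)
      where
      bounded′ : Bounded N S (us ++ u ∷ [])
      bounded′ = bounded-prefix {P} S (us ++ u ∷ []) vs (subst (Bounded N S) (sym (++-assoc us (u ∷ []) vs)) bounded)
      1≤length : 1 ≤ length (us ++ u ∷ [])
      1≤length = ≤-trans (m≤n+m 1 (length us)) (≤-reflexive (sym (length-++ us)))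
      large : ∀ us → Bounded N S (us ++ u ∷ vs) → 1ℚᵘ ℚ.≤ α
      large []       bounded = 1≤α S u vs bounded
      large (v ∷ us) bounded = 1≤α S v (us ++ u ∷ vs) bounded

    amortized : ∀ {C} → C ≡ Scheduler.controller side (2 * r) L′ → ∀ K₁ {K y} → 1 + 5 * (suc l + suc l) + (suc l + suc l) * a ≤ K₁ * a * y → 2 * K₁ ≤ K →
                Run.AmortizedExpectedTime (Copies.algorithm A C) N (fromℕ K ℚ.* α ℚ.* fromℕ y)
    -- Without any update nothing is known about `α`, not even its sign; both sides are 0.
    amortized refl K₁ {K} {y} le 2K₁≤K S [] bounded M =
      subst (λ s → uniform b M s ℚ.≤ fromℕ K ℚ.* α ℚ.* fromℕ y ℚ.* fromℕ 0)
        (sym (∑-zero (sequences b M) (λ _ → refl))) (0≤*0 (fromℕ K ℚ.* α ℚ.* fromℕ y) (b ^ M) {{m^n≢0 b M}})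
    amortized refl K₁ {K} {y} le 2K₁≤K S (u ∷ us) bounded M =
      ≤-natural-rate {α} {∑ (sequences b M) (R′.totalTime (initially S , u ∷ us))} {K} {y} {length (u ∷ us)}
        K₁ (b ^ M) {{m^n≢0 b M}} (1≤α S u us bounded) (total-count S (u ∷ us) bounded M) 2K₁≤K
      where
      total-count : ∀ S us → Bounded N S us → ∀ M →
        ∑ (sequences b M) (R′.totalTime (initially S , us)) ≤ b ^ M * (length us * (K₁ * natural α * y))
      total-count S us bounded M =
        ≤-trans (Amortization.totalTime-bound A side (2 * r) L′ N a T T<L constructs fast (length us) S us bounded refl M)
          (*-monoʳ-≤ (b ^ M) (*-monoʳ-≤ (length us) (subst (λ a → _ ≤ K₁ * a * y) a≡ le)))

  -- Absorbing the parameters into constants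

  m≤m*n′ : ∀ m {n} → 1 ≤ n → m ≤ m * n
  m≤m*n′ m 1≤n = ≤-trans (≤-reflexive (sym (*-identityʳ m))) (*-monoʳ-≤ m 1≤n)

  m≤n*m′ : ∀ m {n} → 1 ≤ n → m ≤ n * m
  m≤n*m′ m {n} 1≤n = ≤-trans (m≤m*n′ m 1≤n) (≤-reflexive (*-comm m n))

  slots-bound : ∀ {l r} → 1 ≤ l → 1 ≤ r →
    let Q = suc (l + suc l) in
    suc (Q + ((l + suc l) * (2 + 2 * r) + (2 + 2 * r) + Q)) ≤ 25 * (l * r)
  slots-bound {l} {r} 1≤l 1≤r = begin
    suc (suc (l + suc l) + ((l + suc l) * (2 + 2 * r) + (2 + 2 * r) + suc (l + suc l)))
      ≡⟨ expand l r ⟩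
    9 * 1 + 8 * l + 4 * r + 4 * (l * r)
      ≤⟨ +-monoˡ-≤ (4 * (l * r)) (+-mono-≤ (+-mono-≤ (*-monoʳ-≤ 9 (*-mono-≤ 1≤l 1≤r)) (*-monoʳ-≤ 8 (m≤m*n′ l 1≤r))) (*-monoʳ-≤ 4 (m≤n*m′ r 1≤l))) ⟩
    9 * (l * r) + 8 * (l * r) + 4 * (l * r) + 4 * (l * r)
      ≡⟨ collect (l * r) ⟩
    25 * (l * r) ∎
    where
    open ≤-Reasoning
    expand : ∀ l r → suc (suc (l + suc l) + ((l + suc l) * (2 + 2 * r) + (2 + 2 * r) + suc (l + suc l)))
                     ≡ 9 * 1 + 8 * l + 4 * r + 4 * (l * r)
    expand = solve-∀
    collect : ∀ x → 9 * x + 8 * x + 4 * x + 4 * x ≡ 25 * x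
    collect = solve-∀

  overhead-bound : ∀ {l a} → 1 ≤ l → 1 ≤ a →
    1 + 5 * (suc l + suc l) + (suc l + suc l) * a ≤ 25 * a * l
  overhead-bound {l} {a} 1≤l 1≤a = begin
    1 + 5 * (suc l + suc l) + (suc l + suc l) * a
      ≡⟨ expand l a ⟩
    11 * 1 + 10 * l + 2 * a + 2 * (a * l)
      ≤⟨ +-monoˡ-≤ (2 * (a * l)) (+-mono-≤ (+-mono-≤ (*-monoʳ-≤ 11 (*-mono-≤ 1≤a 1≤l)) (*-monoʳ-≤ 10 (m≤n*m′ l 1≤a))) (*-monoʳ-≤ 2 (m≤m*n′ a 1≤l))) ⟩
    11 * (a * l) + 10 * (a * l) + 2 * (a * l) + 2 * (a * l)
      ≡⟨ collect a l ⟩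
    25 * a * l ∎
    where
    open ≤-Reasoning
    expand : ∀ l a → 1 + 5 * (suc l + suc l) + (suc l + suc l) * a ≡ 11 * 1 + 10 * l + 2 * a + 2 * (a * l)
    expand = solve-∀
    collect : ∀ a l → 11 * (a * l) + 10 * (a * l) + 2 * (a * l) + 2 * (a * l) ≡ 25 * a * l
    collect = solve-∀

  budget-bound : ∀ c k {l} a → 1 ≤ l → 2 ^ c * (a * suc (suc ((1 + 3 * k) * l))) ≤ 2 ^ c * (3 + 3 * k) * a * l
  budget-bound c k {l} a 1≤l = begin
    2 ^ c * (a * (2 + (1 + 3 * k) * l))          ≤⟨ *-monoʳ-≤ (2 ^ c) (*-monoʳ-≤ a (+-monoˡ-≤ ((1 + 3 * k) * l) (m≤m*n′ 2 1≤l))) ⟩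
    2 ^ c * (a * (2 * l + (1 + 3 * k) * l))    ≡⟨ rearrange (2 ^ c) a l k ⟩
    2 ^ c * (3 + 3 * k) * a * l                  ∎
    where
    open ≤-Reasoning
    rearrange : ∀ p a l k → p * (a * (2 * l + (1 + 3 * k) * l)) ≡ p * (3 + 3 * k) * a * l
    rearrange = solve-∀

  phases-bound : ∀ {l r} → 1 ≤ l → 1 ≤ r → phases (suc (l + suc l)) (2 * r) ≤ 32 * (l * r)
  phases-bound {l} {r} 1≤l 1≤r = begin
    phases (suc (l + suc l)) (2 * r)
      ≡⟨ expand l r ⟩
    9 * 1 + 8 * l + 4 * r + 4 * (l * r)
      ≤⟨ +-monoˡ-≤ (4 * (l * r)) (+-mono-≤ (+-mono-≤ (*-monoʳ-≤ 9 (*-mono-≤ 1≤l 1≤r)) (*-monoʳ-≤ 8 (m≤m*n′ l 1≤r))) (*-monoʳ-≤ 4 (m≤n*m′ r 1≤l))) ⟩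
    9 * (l * r) + 8 * (l * r) + 4 * (l * r) + 4 * (l * r)
      ≤⟨ ≤-trans (≤-reflexive (collect (l * r))) (m≤m+n (25 * (l * r)) (7 * (l * r))) ⟩
    25 * (l * r) + 7 * (l * r)
      ≡⟨ *-distribʳ-+ (l * r) 25 7 ⟨
    32 * (l * r) ∎
    where
    open ≤-Reasoning
    expand : ∀ l r → suc (l + suc l) + (suc (l + suc l) * suc (2 * r) + (suc (l + suc l) + (suc (l + suc l) + 1)))
                     ≡ 9 * 1 + 8 * l + 4 * r + 4 * (l * r)
    expand = solve-∀
    collect : ∀ x → 9 * x + 8 * x + 4 * x + 4 * x ≡ 25 * x
    collect = solve-∀

  -- The period contributes the exponent `2 * (1 + 3 * k)`, since `2 ^ l` is at most the square of
  -- `n + z`; the number of slots and the two factors `a` and `l` of a budget contribute 3 more.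
  states-bound : ∀ c k n z → 2 ≤ n → let l = ⌈log₂ n ⌉ ; a = z ⊔ 1 ; R = 2 ^ c * (3 + 3 * k) in ∀ {r} → 1 ≤ r → r ≤ R * a * l →
    2 * 2 ^ ((1 + 3 * k) * l) * phases (suc (l + suc l)) (2 * r)
      ≤ 64 * R * (n + z) ^ (3 + 2 * (1 + 3 * k))
  states-bound c k n z 2≤n {r} 1≤r r≤ = begin
    2 * 2 ^ ((1 + 3 * k) * l) * phases (suc (l + suc l)) (2 * r)
      ≤⟨ *-mono-≤ (*-monoʳ-≤ 2 2^≤) (≤-trans (phases-bound (1≤⌈log₂⌉ 2≤n) 1≤r) (*-monoʳ-≤ 32 (*-mono-≤ l≤y
           (≤-trans r≤ (*-mono-≤ (*-monoʳ-≤ R a≤y) l≤y))))) ⟩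
    2 * y ^ e * (32 * (y * (R * y * y)))
      ≡⟨ rearrange (y ^ e) y R ⟩
    64 * R * (y ^ 3 * y ^ e)
      ≡⟨ cong (64 * R *_) (^-distribˡ-+-* y 3 e) ⟨
    64 * R * y ^ (3 + e) ∎
    where
    open ≤-Reasoning
    l a R y e : ℕ
    l = ⌈log₂ n ⌉
    a = z ⊔ 1
    R = 2 ^ c * (3 + 3 * k)
    y = n + z
    e = 2 * (1 + 3 * k)
    2≤y : 2 ≤ y
    2≤y = ≤-trans 2≤n (m≤m+n n z)
    a≤y : a ≤ y
    a≤y = ⊔-lub (m≤n+m z n) (≤-trans (n≤1+n 1) 2≤y)
    l≤y : l ≤ y
    l≤y = ≤-trans (⌈log₂n⌉≤n n) (m≤m+n n z)
    2^l≤y² : 2 ^ l ≤ y ^ 2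
    2^l≤y² = begin
      2 ^ l        ≤⟨ m≤m+n (2 ^ l) 2 ⟩
      2 ^ l + 2    ≤⟨ 2^⌈log₂n⌉+2≤2n n 2≤n ⟩
      2 * n      ≤⟨ *-mono-≤ 2≤y (≤-trans (m≤m+n n z) (≤-reflexive (sym (*-identityʳ y)))) ⟩
      y ^ 2        ∎
    2^≤ : 2 ^ ((1 + 3 * k) * l) ≤ y ^ e
    2^≤ = begin
      2 ^ ((1 + 3 * k) * l)    ≡⟨ cong (2 ^_) (*-comm (1 + 3 * k) l) ⟩
      2 ^ (l * (1 + 3 * k))    ≡⟨ ^-*-assoc 2 l (1 + 3 * k) ⟨
      (2 ^ l) ^ (1 + 3 * k)      ≤⟨ ^-monoˡ-≤ (1 + 3 * k) 2^l≤y² ⟩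
      (y ^ 2) ^ (1 + 3 * k)      ≡⟨ ^-*-assoc y 2 (1 + 3 * k) ⟩
      y ^ e                        ∎
    rearrange : ∀ p y r → 2 * p * (32 * (y * (r * y * y))) ≡ 64 * r * (y * (y * (y * 1)) * p)
    rearrange = solve-∀

-- The choice of the parameters

open Development
open import Data.Nat.Base using (suc; pred; _+_; _^_; _⊔_; _≤_; s≤s; z≤n; >-nonZero)
open import Data.Nat.Properties
open import Data.Nat.Tactic.RingSolver using (solve-∀)
open import Data.Fin.Properties using (toℕ-fromℕ)
open import Data.Product.Base using (_,_; proj₁; proj₂)
open import Data.Rational.Unnormalised.Base using (_*_)
open import Relation.Binary.PropositionalEquality using (_≡_; refl; sym; cong)

theorem1p1 : (P : ℕ → Problem) (A : (n : ℕ) → Algorithm (P n)) (α : ℕ → ℚᵘ) (N : ℕ → ℕ) →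
    Polynomial N →
    (∀ n → Run.WorstCaseExpectedTime (A n) (N n) (α n)) →
    ConstructibleInPolynomialTime A →
    (c : ℕ) →
    Σ[ q ∈ (ℕ → ℕ) ] Σ[ C ∈ ((n : ℕ) → Controller (q n)) ]
    ConstructibleInPolynomialTime (λ n → Copies.algorithm (A n) (C n)) ×
    (∃[ K ] ∀ n → 2 ℕ.≤ n →
    Controller.states (C n) ℕ.≤ K ℕ.* (n ℕ.+ ∣ ceiling (α n) ∣) ℕ.^ K ×
    Run.TimeWithHighProbability (Copies.algorithm (A n) (C n)) (N n)
    (fromℕ K * α n * fromℕ (⌈log₂ n ⌉ ℕ.^ 2)) (n ℕ.^ c) ×
    Run.AmortizedExpectedTime (Copies.algorithm (A n) (C n)) (N n)
    (fromℕ K * α n * fromℕ ⌈log₂ n ⌉) ×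
    (⌈log₂ n ⌉ ℕ.≤ K ℕ.* q n × q n ℕ.≤ K ℕ.* ⌈log₂ n ⌉) ×
    Copies.PointerCorrect (A n) (C n) (N n))
theorem1p1 P A α N N-polynomial worst constructible c =
  q , C , C-constructible , K , λ n 2≤n →
    states n 2≤n , timely n 2≤n , amortized n 2≤n , (l≤Kq n 2≤n , q≤Kl n 2≤n) ,
    Correctness.pointerCorrect (A n) (half (suc (l n))) (2 ℕ.* r n) (L′ n) (N n)
  where
  T : ℕ → ℕ
  T = proj₁ (constructible N N-polynomial)
  k : ℕ
  k = proj₁ (proj₁ (proj₂ (constructible N N-polynomial)))
  T≤ : ∀ n → T n ≤ k ℕ.* n ^ k + k
  T≤ = proj₂ (proj₁ (proj₂ (constructible N N-polynomial)))

  -- The period is `2 ^ D′ n`, and `suc (D′ n)` scales of doubling cover two periods. The factor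
  -- `suc (suc (D′ n))` in `r` matches the sum of the dyadic weights, and `2 ^ c` is the margin of a
  -- single copy. There are `suc (l n)` copies on each side.
  l D′ a r L′ q : ℕ → ℕ
  l n  = ⌈log₂ n ⌉
  D′ n = (1 + 3 ℕ.* k) ℕ.* l n
  a n  = natural (α n)
  r n  = 2 ^ c ℕ.* (a n ℕ.* suc (suc (D′ n)))
  L′ n = pred (2 ^ D′ n)
  q n  = suc (l n + suc (l n))

  C : ∀ n → Controller (q n)
  C n = Scheduler.controller (half (suc (l n))) (2 ℕ.* r n) (L′ n)

  R K₁ K : ℕ
  R  = 2 ^ c ℕ.* (3 + 3 ℕ.* k)
  K₁ = 25 ℕ.* R
  -- A sum in place of a maximum: the first two summands dominate the constant and the exponent for
  -- the number of states, the third serves the high-probability bound and the last the amortized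
  -- one.
  K  = 64 ℕ.* R + (3 + 2 ℕ.* (1 + 3 ℕ.* k)) + 2 ℕ.* K₁ + 2 ℕ.* 25

  L≡ : ∀ n → suc (L′ n) ≡ 2 ^ D′ n
  L≡ n = suc-pred (2 ^ D′ n) {{m^n≢0 2 (D′ n)}}

  1≤a : ∀ n → 1 ≤ a n
  1≤a n = 1≤natural (α n)

  1≤r : ∀ n → 1 ≤ r n
  1≤r n = *-mono-≤ (m^n>0 2 c) (*-mono-≤ (1≤a n) (s≤s z≤n))

  r≤ : ∀ n → 2 ≤ n → r n ≤ R ℕ.* a n ℕ.* l n
  r≤ n 2≤n = budget-bound c k (a n) (1≤⌈log₂⌉ 2≤n)

  C-constructible : ConstructibleInPolynomialTime (λ n → Copies.algorithm (A n) (C n))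
  C-constructible s s-polynomial = let (t , t-polynomial , within) = constructible s s-polynomial in
    (λ n → q n ℕ.* suc (t n)) ,
    polynomial-* (polynomial-linear q≤) (polynomial-suc t-polynomial) ,
    λ n S small → Correctness.constructedWithin (A n) (half (suc (l n))) (2 ℕ.* r n) (L′ n) (t n) S (within n S small)
    where
    rearrange : ∀ l → suc (l + suc l) ≡ 2 ℕ.* l + 2
    rearrange = solve-∀
    q≤ : ∀ n → q n ≤ 2 ℕ.* n + 2
    q≤ n = ≤-trans (≤-reflexive (rearrange (l n))) (+-monoˡ-≤ 2 (*-monoʳ-≤ 2 (⌈log₂n⌉≤n n)))

  module I n (2≤n : 2 ≤ n) = Instance (A n) (N n) (α n) (worst n) (T n)
    (proj₂ (proj₂ (constructible N N-polynomial)) n) c (l n) (D′ n) (a n) (r n) (L′ n)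
    (≤-trans (s≤s (T≤ n)) (polynomial<2^ k n 2≤n)) refl refl (L≡ n)

  states : ∀ n → 2 ≤ n → Controller.states (C n) ≤ K ℕ.* (n + ∣ ceiling (α n) ∣) ^ K
  states n 2≤n = begin
    2 ℕ.* suc (L′ n) ℕ.* phases (q n) (2 ℕ.* r n)
      ≡⟨ cong (λ L → 2 ℕ.* L ℕ.* phases (q n) (2 ℕ.* r n)) (L≡ n) ⟩
    2 ℕ.* 2 ^ D′ n ℕ.* phases (q n) (2 ℕ.* r n)
      ≤⟨ states-bound c k n ∣ ceiling (α n) ∣ 2≤n (1≤r n) (r≤ n 2≤n) ⟩
    64 ℕ.* R ℕ.* y ^ e
      ≤⟨ *-mono-≤ (≤-trans (m≤m+n (64 ℕ.* R) e) e′≤K) (^-monoʳ-≤ y {{>-nonZero (≤-trans (≤-trans (n≤1+n 1) 2≤n) (m≤m+n n _))}} (≤-trans (m≤n+m e (64 ℕ.* R)) e′≤K)) ⟩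
    K ℕ.* y ^ K ∎
    where
    open ≤-Reasoning
    y e : ℕ
    y = n + ∣ ceiling (α n) ∣
    e = 3 + 2 ℕ.* (1 + 3 ℕ.* k)
    e′≤K : 64 ℕ.* R + e ≤ K
    e′≤K = ≤-trans (m≤m+n (64 ℕ.* R + e) (2 ℕ.* K₁)) (m≤m+n _ (2 ℕ.* 25))

  deadline≤ : ∀ n 2≤n → I.deadline n 2≤n ≤ K₁ ℕ.* a n ℕ.* l n ^ 2
  deadline≤ n 2≤n = begin
    I.deadline n 2≤n
      ≡⟨ cong (λ t → suc (q n + (t ℕ.* (2 + 2 ℕ.* r n) + (2 + 2 ℕ.* r n) + q n))) (toℕ-fromℕ (l n + suc (l n))) ⟩
    suc (q n + ((l n + suc (l n)) ℕ.* (2 + 2 ℕ.* r n) + (2 + 2 ℕ.* r n) + q n))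
      ≤⟨ slots-bound (1≤⌈log₂⌉ 2≤n) (1≤r n) ⟩
    25 ℕ.* (l n ℕ.* r n)
      ≤⟨ *-monoʳ-≤ 25 (*-monoʳ-≤ (l n) (r≤ n 2≤n)) ⟩
    25 ℕ.* (l n ℕ.* (R ℕ.* a n ℕ.* l n))
      ≡⟨ rearrange (l n) R (a n) ⟩
    K₁ ℕ.* a n ℕ.* l n ^ 2 ∎
    where
    open ≤-Reasoning
    rearrange : ∀ l R a → 25 ℕ.* (l ℕ.* (R ℕ.* a ℕ.* l)) ≡ 25 ℕ.* R ℕ.* a ℕ.* (l ℕ.* (l ℕ.* 1))
    rearrange = solve-∀

  n^c≤ : ∀ n → n ^ c ≤ (2 ^ c) ^ suc (l n)
  n^c≤ n = begin
    n ^ c                  ≤⟨ ^-monoˡ-≤ c (≤-trans (n≤2^⌈log₂n⌉ n) (^-monoʳ-≤ 2 (n≤1+n (l n)))) ⟩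
    (2 ^ suc (l n)) ^ c    ≡⟨ ^-*-assoc 2 (suc (l n)) c ⟩
    2 ^ (suc (l n) ℕ.* c)  ≡⟨ cong (2 ^_) (*-comm (suc (l n)) c) ⟩
    2 ^ (c ℕ.* suc (l n))  ≡⟨ ^-*-assoc 2 c (suc (l n)) ⟨
    (2 ^ c) ^ suc (l n)    ∎
    where open ≤-Reasoning

  timely : ∀ n → 2 ≤ n → Run.TimeWithHighProbability (Copies.algorithm (A n) (C n)) (N n)
    (fromℕ K * α n * fromℕ (l n ^ 2)) (n ^ c)
  timely n 2≤n = I.timely n 2≤n {C n} refl K₁ {K} {l n ^ 2} {n ^ c} (deadline≤ n 2≤n)
    (≤-trans (m≤n+m (2 ℕ.* K₁) (64 ℕ.* R + (3 + 2 ℕ.* (1 + 3 ℕ.* k)))) (m≤m+n _ (2 ℕ.* 25))) (n^c≤ n)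

  amortized : ∀ n → 2 ≤ n → Run.AmortizedExpectedTime (Copies.algorithm (A n) (C n)) (N n)
    (fromℕ K * α n * fromℕ (l n))
  amortized n 2≤n = I.amortized n 2≤n {C n} refl 25 {K} {l n} (overhead-bound (1≤⌈log₂⌉ 2≤n) (1≤a n)) (m≤n+m (2 ℕ.* 25) _)

  4≤K : 4 ≤ K
  4≤K = ≤-trans (m≤m+n 4 46) (m≤n+m 50 _)

  l≤Kq : ∀ n → 2 ≤ n → l n ≤ K ℕ.* q n
  l≤Kq n 2≤n = ≤-trans (≤-trans (m≤m+n (l n) (suc (l n))) (n≤1+n _)) (m≤n*m′ (q n) (≤-trans (s≤s z≤n) 4≤K))

  q≤Kl : ∀ n → 2 ≤ n → q n ≤ K ℕ.* l n
  q≤Kl n 2≤n = begin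
    suc (l n + suc (l n))        ≡⟨ rearrange (l n) ⟩
    2 + 2 ℕ.* l n                ≤⟨ +-monoˡ-≤ (2 ℕ.* l n) (m≤m*n′ 2 (1≤⌈log₂⌉ 2≤n)) ⟩
    2 ℕ.* l n + 2 ℕ.* l n        ≡⟨ *-distribʳ-+ (l n) 2 2 ⟨
    4 ℕ.* l n                    ≤⟨ *-monoˡ-≤ (l n) 4≤K ⟩
    K ℕ.* l n                    ∎
    where
    open ≤-Reasoning
    rearrange : ∀ l → suc (l + suc l) ≡ 2 + 2 ℕ.* l
    rearrange = solve-∀
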